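{- For every integer $N\geq 1$, $$\varepsilon_1(N,2)=4^{N-4}\,\frac{N(N-1)(N-2)(13N+3)}{3}.$$
   Context: Let $N\ge 1$. A gluing datum with $N$ edges and $2$ faces consists of a composition $(m_1,m_2)$ of $2N$ into positive integers and a fixed-point-free involution $\iota$ of $\{1,\dots,2N\}$. Let $\tau$ have cycles $(1,\dots,m_1)$ and $(m_1+1,\dots,2N)$. The datum is connected if $\langle\iota,\tau\rangle$ acts transitively and has genus $1$ if $\tau\iota$ has exactly $N-2$ cycles. (Geometrically: gluings of two numbered polygons with distinguished edges, $2N$ edges in total, into a torus, gluing paired edges with opposite orientations.) $\varepsilon_1(N,2)$ is the number of connected genus-$1$ such data. -}

module Defs where

open import Data.Nat using (ℕ; zero; suc; _+_; _*_; _∸_; _^_; _≤_; _<_; _<?_; _≡ᵇ_; _≤ᵇ_; _<ᵇ_)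
open import Data.Bool using (Bool; true; false; not; _∧_; _∨_; if_then_else_)
open import Data.Fin using (Fin; toℕ; fromℕ<)
open import Data.Vec using (Vec; []; _∷_; lookup)
open import Data.List using (List; []; _∷_; [_]; map; concatMap; allFin; upTo; filterᵇ; length; all; any)
open import Data.Nat.ListAction using (sum)
open import Relation.Nullary using (yes; no)

-- Points {1,…,2N} are encoded 0-based as {0,…,2N-1} (ℕ below n = 2N).

allVecs : (n k : ℕ) → List (Vec (Fin n) k)
allVecs n zero    = [ [] ]
allVecs n (suc k) = concatMap (λ x → map (x ∷_) (allVecs n k)) (allFin n)

app : {n : ℕ} → Vec (Fin n) n → ℕ → ℕ
app {n} v i with i <? n
... | yes p = toℕ (lookup v (fromℕ< p))
... | no  _ = i

isFPFInvolution : {n : ℕ} → Vec (Fin n) n → Bool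
isFPFInvolution {n} v =
  all (λ i → not (app v i ≡ᵇ i) ∧ (app v (app v i) ≡ᵇ i)) (upTo n)

-- τ with cycles (0 … m₁-1)(m₁ … n-1)  (0-based version of (1…m₁)(m₁+1…2N))
tau : (m₁ n : ℕ) → ℕ → ℕ
tau m₁ n i =
  if i <ᵇ m₁
  then (if suc i ≡ᵇ m₁ then 0 else suc i)
  else (if suc i ≡ᵇ n then m₁ else suc i)

-- Orbit of 0 under the monoid generated by ι and τ, after k steps
-- (membership predicate). On a finite set the generated monoid is the
-- generated group, so after n steps this is the ⟨ι,τ⟩-orbit of 0.
reach : (n : ℕ) → (ℕ → ℕ) → (ℕ → ℕ) → ℕ → ℕ → Bool
reach n f g zero    i = i ≡ᵇ 0
reach n f g (suc k) i =
  reach n f g k i ∨ any (λ j → reach n f g k j ∧ ((f j ≡ᵇ i) ∨ (g j ≡ᵇ i))) (upTo n)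

isTransitive : (n : ℕ) → (ℕ → ℕ) → (ℕ → ℕ) → Bool
isTransitive n f g = all (reach n f g n) (upTo n)

iter : (ℕ → ℕ) → ℕ → ℕ → ℕ
iter f zero    x = x
iter f (suc k) x = f (iter f k x)

-- number of cycles of a permutation σ of {0..n-1}: count the points that
-- are the minimum of their cycle
numCycles : (n : ℕ) → (ℕ → ℕ) → ℕ
numCycles n σ =
  length (filterᵇ (λ i → all (λ k → i ≤ᵇ iter σ (suc k) i) (upTo n)) (upTo n))

-- connected genus-1 gluing datum with first face of size m₁ (n = 2N)
isGenus1Datum : (N m₁ : ℕ) → Vec (Fin (2 * N)) (2 * N) → Bool
isGenus1Datum N m₁ v =
  isFPFInvolution v
  ∧ isTransitive (2 * N) (app v) (tau m₁ (2 * N))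
  ∧ (numCycles (2 * N) (λ i → tau m₁ (2 * N) (app v i)) ≡ᵇ (N ∸ 2))

ε₁-2 : ℕ → ℕ
ε₁-2 N =
  sum (map (λ m₁ → length (filterᵇ (isGenus1Datum N m₁) (allVecs (2 * N) (2 * N))))
           (map suc (upTo (2 * N ∸ 1))))

module Submission where

-- Glue the sides one pair at a time, always starting from the first side of the first face
-- (the Tutte/loop recursion). Gluing two sides of one face splits it, gluing sides of two faces
-- joins them; with V the number of cycles of τ ∘ ι and a 0-gon counted as a completed vertex,
-- V + 2 · (number of joins) = N + (number of faces) throughout. So a connected two-face gluing
-- has genus 1 iff it is built with exactly two joins, and it is connected iff one of the joins
-- uses the second polygon. Counting runs with at most two joins gives linear loop equations
-- in the size of the first face, all solved by the series u = (1 - 4 x)^(-1/2), x = z². Summing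
-- over the size of the second face, everything stays in ℤ[x,u], on which z d/dz acts by
-- θ x = 2 x, θ u = 4 x u³, and the answer is Σ ε₁(N,2) xᴺ = (21 x³ + 20 x⁴) u¹⁰.

open import Defs
open import Level using (0ℓ)
open import Algebra.Bundles using (CommutativeRing)
import Algebra.Properties.AbelianGroup as AbelianGroupProperties
import Algebra.Solver.CommutativeMonoid as CommutativeMonoidSolver
import Algebra.Solver.Ring as RingSolver
open import Algebra.Solver.Ring.AlmostCommutativeRing using (_-Raw-AlmostCommutative⟶_; fromCommutativeRing)
open import Data.Bool using (Bool; true; false; T; if_then_else_; _∧_; _∨_; not)
import Data.Bool.Properties as Boolₚ
open import Data.Bool.ListAction using (all)
open import Data.Empty using (⊥-elim)
open import Data.Fin using (Fin; zero; suc; toℕ; fromℕ<)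
import Data.Fin.Properties as Finₚ
open import Data.Integer using (ℤ; +_; -_; 0ℤ; 1ℤ)
import Data.Integer.Properties as ℤₚ
open import Data.Integer.Tactic.RingSolver using (solve-∀)
open import Data.List using (List; []; _∷_; _++_; map; concat; concatMap; length; upTo; allFin; applyUpTo; filterᵇ)
open import Data.List.Membership.Propositional using (_∈_; lose; find)
open import Data.List.Membership.Propositional.Properties using
  (∈-++⁻; ∈-++⁺ʳ; ∈-map⁻; ∈-map⁺; ∈-concatMap⁻; ∈-upTo⁺; ∈-upTo⁻; ∈-allFin; ∈-∃++)
open import Data.List.Membership.Propositional.Properties.WithK using (unique∧set⇒bag)
import Data.List.Properties as Listₚ
open import Data.List.Relation.Binary.BagAndSetEquality using (∼bag⇒↭)
open import Data.List.Relation.Binary.Permutation.Propositional as Perm using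
  (_↭_; ↭-refl; ↭-sym; ↭-trans; ↭-prep; ↭-reflexive; ↭-swap; ↭⇒↭ₛ)
import Data.List.Relation.Binary.Permutation.Propositional.Properties as Permₚ
import Data.List.Relation.Binary.Permutation.Setoid.Properties as SetoidPermₚ
open import Data.List.Relation.Unary.All as All using (All; []; _∷_)
import Data.List.Relation.Unary.All.Properties as Allₚ
open import Data.List.Relation.Unary.AllPairs using ([]; _∷_)
open import Data.List.Relation.Unary.Any using (here; there)
import Data.List.Relation.Unary.Any.Properties as Anyₚ
open import Data.List.Relation.Unary.Unique.Propositional using (Unique)
import Data.List.Relation.Unary.Unique.Propositional.Properties as Uniqueₚ
open import Data.Maybe using (Maybe)
open import Data.Nat as ℕ using
  (ℕ; zero; suc; pred; _∸_; _≤_; _<_; _<?_; _≡ᵇ_; _≤ᵇ_; _<ᵇ_; z≤n; s≤s)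
open import Data.Nat.ListAction using (sum)
import Data.Nat.Properties as ℕₚ
open import Data.Nat.Tactic.RingSolver using () renaming (solve-∀ to ℕ-solve-∀)
open import Data.Product using (∃; _×_; _,_; proj₁; proj₂; map₁; map₂)
open import Data.Sum using (_⊎_; inj₁; inj₂)
open import Data.Unit using (tt)
open import Data.Vec as Vec using (Vec; []; _∷_)
open import Function using (_∘_; mk⇔; Equivalence)
import Relation.Binary.Reasoning.Setoid as SetoidReasoning
open import Relation.Nullary using (yes; no; ¬_)
open import Relation.Nullary.Decidable using (dec⇒maybe; map′)
open import Relation.Binary.PropositionalEquality
  using (_≡_; _≢_; refl; sym; trans; cong; cong₂; subst; module ≡-Reasoning)
  renaming (setoid to ≡-setoid)

-- The obstacle is `w`: it enters the sources of the loop equations, and x w = (1 - 1/u)/2 brings in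
-- a denominator 2. But for a fixed total number of sides a join always produces a face of the same
-- size, so summing over the second face only multiplies coefficient n by a polynomial in n. All
-- polynomials that occur vanish at n = 0, so that just θ (x w) = 2 x u is needed. The coefficients
-- of the answer are read off without expanding u¹⁰: θ (θ - 2) (θ - 4) (13 θ + 6), applied to u² =
-- 1/(1 - 4 x) = Σ 4ᴺ xᴺ, gives 12288 times the answer. At n = 2N its factors are 2N, 2(N - 1), 2(N
-- - 2) and 2(13N + 3), and 12288 = 2⁴ · 3 · 4⁴. On the combinatorial side the sum over involutions
-- is traded for a sum over all vectors: a run contributes 0 unless the vector is a fixed-point-free
-- involution.

module _ where

  open import Data.Integer using (_+_; _*_)

  -- Finite sums and formal power series

  ∑ : {A : Set} → List A → (A → ℤ) → ℤ
  ∑ []       f = 0ℤ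
  ∑ (x ∷ xs) f = f x + ∑ xs f

  ∑-cong : {A : Set} (xs : List A) {f g : A → ℤ} → (∀ x → f x ≡ g x) → ∑ xs f ≡ ∑ xs g
  ∑-cong []       eq = refl
  ∑-cong (x ∷ xs) eq = cong₂ _+_ (eq x) (∑-cong xs eq)

  ∑-zero : {A : Set} (xs : List A) → ∑ xs (λ _ → 0ℤ) ≡ 0ℤ
  ∑-zero []       = refl
  ∑-zero (x ∷ xs) = trans (ℤₚ.+-identityˡ _) (∑-zero xs)

  ∑-++ : {A : Set} (xs ys : List A) (f : A → ℤ) → ∑ (xs ++ ys) f ≡ ∑ xs f + ∑ ys f
  ∑-++ []       ys f = sym (ℤₚ.+-identityˡ _)
  ∑-++ (x ∷ xs) ys f = trans (cong (_+_ (f x)) (∑-++ xs ys f)) (sym (ℤₚ.+-assoc (f x) _ _))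

  ∑-map : {A B : Set} (g : A → B) (xs : List A) (f : B → ℤ) → ∑ (map g xs) f ≡ ∑ xs (f ∘ g)
  ∑-map g []       f = refl
  ∑-map g (x ∷ xs) f = cong (_+_ (f (g x))) (∑-map g xs f)

  ∑-concatMap : {A B : Set} (g : A → List B) (xs : List A) (f : B → ℤ) →
    ∑ (concatMap g xs) f ≡ ∑ xs (λ x → ∑ (g x) f)
  ∑-concatMap g []       f = refl
  ∑-concatMap g (x ∷ xs) f =
    trans (∑-++ (g x) (concatMap g xs) f) (cong (_+_ (∑ (g x) f)) (∑-concatMap g xs f))

  +-interchange : ∀ a b c d → (a + b) + (c + d) ≡ (a + c) + (b + d)
  +-interchange = solve-∀

  ∑-+ : {A : Set} (xs : List A) (f g : A → ℤ) → ∑ xs (λ x → f x + g x) ≡ ∑ xs f + ∑ xs g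
  ∑-+ []       f g = refl
  ∑-+ (x ∷ xs) f g =
    trans (cong (_+_ (f x + g x)) (∑-+ xs f g)) (+-interchange (f x) (g x) (∑ xs f) (∑ xs g))

  ∑-*ˡ : {A : Set} (c : ℤ) (xs : List A) (f : A → ℤ) → ∑ xs (λ x → c * f x) ≡ c * ∑ xs f
  ∑-*ˡ c []       f = sym (ℤₚ.*-zeroʳ c)
  ∑-*ˡ c (x ∷ xs) f =
    trans (cong (_+_ (c * f x)) (∑-*ˡ c xs f)) (sym (ℤₚ.*-distribˡ-+ c (f x) (∑ xs f)))

  ∑-*ʳ : {A : Set} (c : ℤ) (xs : List A) (f : A → ℤ) → ∑ xs (λ x → f x * c) ≡ ∑ xs f * c
  ∑-*ʳ c xs f = trans (∑-cong xs (λ x → ℤₚ.*-comm (f x) c)) (trans (∑-*ˡ c xs f) (ℤₚ.*-comm c (∑ xs f)))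

  ∑-comm : {A B : Set} (xs : List A) (ys : List B) (f : A → B → ℤ) →
    ∑ xs (λ x → ∑ ys (f x)) ≡ ∑ ys (λ y → ∑ xs (λ x → f x y))
  ∑-comm []       ys f = sym (∑-zero ys)
  ∑-comm (x ∷ xs) ys f =
    trans (cong (_+_ (∑ ys (f x))) (∑-comm xs ys f)) (sym (∑-+ ys (f x) (λ y → ∑ xs (λ x → f x y))))

  ∑-↭ : {A : Set} {xs ys : List A} (f : A → ℤ) → xs ↭ ys → ∑ xs f ≡ ∑ ys f
  ∑-↭ f Perm.refl         = refl
  ∑-↭ f (Perm.prep x p)   = cong (_+_ (f x)) (∑-↭ f p)
  ∑-↭ f (Perm.swap x y p) = trans (cong (λ t → f x + (f y + t)) (∑-↭ f p)) (lemma (f x) (f y) _)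
    where
    lemma : ∀ a b c → a + (b + c) ≡ b + (a + c)
    lemma = solve-∀
  ∑-↭ f (Perm.trans p q)  = trans (∑-↭ f p) (∑-↭ f q)

  abstract

    -- The pairs (i , j) with i + j + 1 = p: the two arcs left by a chord from the root of a
    -- face with p further sides.
    splits : ℕ → List (ℕ × ℕ)
    splits zero    = []
    splits (suc p) = (0 , p) ∷ map (map₁ suc) (splits p)

    ∑-splits-zero : (f : ℕ × ℕ → ℤ) → ∑ (splits 0) f ≡ 0ℤ
    ∑-splits-zero f = refl

    ∑-splits-suc : ∀ p (f : ℕ × ℕ → ℤ) →
      ∑ (splits (suc p)) f ≡ f (0 , p) + ∑ (splits p) (f ∘ map₁ suc)
    ∑-splits-suc p f = cong (_+_ (f (0 , p))) (∑-map (map₁ suc) (splits p) f)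

  ∑-splits-one : (f : ℕ × ℕ → ℤ) → ∑ (splits 1) f ≡ f (0 , 0)
  ∑-splits-one f = trans (∑-splits-suc 0 f)
    (trans (cong (_+_ (f (0 , 0))) (∑-splits-zero (f ∘ map₁ suc))) (ℤₚ.+-identityʳ _))

  ∑-splits-cong : ∀ p {f g : ℕ × ℕ → ℤ} → (∀ i j → suc (i ℕ.+ j) ≡ p → f (i , j) ≡ g (i , j)) →
    ∑ (splits p) f ≡ ∑ (splits p) g
  ∑-splits-cong zero {f} {g} eq = trans (∑-splits-zero f) (sym (∑-splits-zero g))
  ∑-splits-cong (suc p) {f} {g} eq = trans (∑-splits-suc p f)
    (trans (cong₂ _+_ (eq 0 p refl) (∑-splits-cong p (λ i j e → eq (suc i) j (cong suc e))))
           (sym (∑-splits-suc p g)))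

  ∑-splits-last : ∀ p (f : ℕ × ℕ → ℤ) →
    ∑ (splits (suc p)) f ≡ ∑ (splits p) (f ∘ map₂ suc) + f (p , 0)
  ∑-splits-last zero    f = trans (∑-splits-one f)
    (sym (trans (cong (λ t → t + f (0 , 0)) (∑-splits-zero (f ∘ map₂ suc))) (ℤₚ.+-identityˡ _)))
  ∑-splits-last (suc p) f = begin
    ∑ (splits (suc (suc p))) f
      ≡⟨ ∑-splits-suc (suc p) f ⟩
    f (0 , suc p) + ∑ (splits (suc p)) (f ∘ map₁ suc)
      ≡⟨ cong (_+_ (f (0 , suc p))) (∑-splits-last p (f ∘ map₁ suc)) ⟩
    f (0 , suc p) + (∑ (splits p) (f ∘ map₁ suc ∘ map₂ suc) + f (suc p , 0))
      ≡⟨ sym (ℤₚ.+-assoc (f (0 , suc p)) _ _) ⟩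
    f (0 , suc p) + ∑ (splits p) (f ∘ map₂ suc ∘ map₁ suc) + f (suc p , 0)
      ≡⟨ cong (_+ f (suc p , 0)) (sym (∑-splits-suc p (f ∘ map₂ suc))) ⟩
    ∑ (splits (suc p)) (f ∘ map₂ suc) + f (suc p , 0) ∎
    where open ≡-Reasoning

  ∑-splits-swap : ∀ p (f : ℕ → ℕ → ℤ) →
    ∑ (splits p) (λ (i , j) → f i j) ≡ ∑ (splits p) (λ (i , j) → f j i)
  ∑-splits-swap zero    f = trans (∑-splits-zero _) (sym (∑-splits-zero _))
  ∑-splits-swap (suc p) f = begin
    ∑ (splits (suc p)) (λ (i , j) → f i j)
      ≡⟨ ∑-splits-suc p _ ⟩
    f 0 p + ∑ (splits p) (λ (i , j) → f (suc i) j)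
      ≡⟨ cong (_+_ (f 0 p)) (∑-splits-swap p (λ i j → f (suc i) j)) ⟩
    f 0 p + ∑ (splits p) (λ (i , j) → f (suc j) i)
      ≡⟨ ℤₚ.+-comm (f 0 p) _ ⟩
    ∑ (splits p) (λ (i , j) → f (suc j) i) + f 0 p
      ≡⟨ sym (∑-splits-last p (λ (i , j) → f j i)) ⟩
    ∑ (splits (suc p)) (λ (i , j) → f j i) ∎
    where open ≡-Reasoning

  -- Both sides run over the triples with i + j + k = n, grouped in two ways. Associativity of `⊛`,
  -- `diag-⊛` and `diag-diag` all rest on this exchange.
  ∑-splits-assoc : ∀ n (f : ℕ → ℕ → ℕ → ℤ) →
    ∑ (splits (suc n)) (λ (m , k) → ∑ (splits (suc m)) (λ (i , j) → f i j k)) ≡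
    ∑ (splits (suc n)) (λ (i , m) → ∑ (splits (suc m)) (λ (j , k) → f i j k))
  ∑-splits-assoc zero    f =
    trans (trans (∑-splits-one _) (∑-splits-one _)) (sym (trans (∑-splits-one _) (∑-splits-one _)))
  ∑-splits-assoc (suc n) f = begin
    ∑ (splits (suc (suc n))) (λ (m , k) → ∑ (splits (suc m)) (λ (i , j) → f i j k))
      ≡⟨ trans (∑-splits-suc (suc n) _) (cong₂ _+_ (∑-splits-one (λ (i , j) → f i j (suc n))) refl) ⟩
    f 0 0 (suc n) + ∑ (splits (suc n)) (λ (m , k) → ∑ (splits (suc (suc m))) (λ (i , j) → f i j k))
      ≡⟨ cong (_+_ (f 0 0 (suc n)))
           (trans (∑-cong (splits (suc n)) (λ (m , k) → ∑-splits-suc (suc m) (λ (i , j) → f i j k)))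
                  (∑-+ (splits (suc n)) _ _)) ⟩
    f 0 0 (suc n) +
      (∑ (splits (suc n)) (λ (m , k) → f 0 (suc m) k) +
       ∑ (splits (suc n)) (λ (m , k) → ∑ (splits (suc m)) (λ (i , j) → f (suc i) j k)))
      ≡⟨ cong (λ t → f 0 0 (suc n) + (∑ (splits (suc n)) (λ (m , k) → f 0 (suc m) k) + t))
           (∑-splits-assoc n (λ i → f (suc i))) ⟩
    f 0 0 (suc n) +
      (∑ (splits (suc n)) (λ (m , k) → f 0 (suc m) k) +
       ∑ (splits (suc n)) (λ (i , m) → ∑ (splits (suc m)) (λ (j , k) → f (suc i) j k)))
      ≡⟨ sym (ℤₚ.+-assoc (f 0 0 (suc n)) _ _) ⟩
    (f 0 0 (suc n) + ∑ (splits (suc n)) (λ (m , k) → f 0 (suc m) k)) +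
       ∑ (splits (suc n)) (λ (i , m) → ∑ (splits (suc m)) (λ (j , k) → f (suc i) j k))
      ≡⟨ cong (_+ ∑ (splits (suc n)) (λ (i , m) → ∑ (splits (suc m)) (λ (j , k) → f (suc i) j k)))
           (sym (∑-splits-suc (suc n) (λ (j , k) → f 0 j k))) ⟩
    ∑ (splits (suc (suc n))) (λ (j , k) → f 0 j k) +
       ∑ (splits (suc n)) (λ (i , m) → ∑ (splits (suc m)) (λ (j , k) → f (suc i) j k))
      ≡⟨ sym (∑-splits-suc (suc n) (λ (i , m) → ∑ (splits (suc m)) (λ (j , k) → f i j k))) ⟩
    ∑ (splits (suc (suc n))) (λ (i , m) → ∑ (splits (suc m)) (λ (j , k) → f i j k)) ∎
    where open ≡-Reasoning

  -- The ring of formal power series over ℤ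

  Seq : Set
  Seq = ℕ → ℤ

  infix  4 _≈_
  infixl 6 _⊕_
  infixl 7 _⊛_

  _≈_ : Seq → Seq → Set
  a ≈ b = ∀ n → a n ≡ b n

  _⊕_ _⊛_ : Seq → Seq → Seq
  (a ⊕ b) n = a n + b n
  (a ⊛ b) n = ∑ (splits (suc n)) (λ (i , j) → a i * b j)

  ⊖_ : Seq → Seq
  (⊖ a) n = - a n

  const : ℤ → Seq
  const c zero    = c
  const c (suc n) = 0ℤ

  ⊛-cong : ∀ {a b c d} → a ≈ b → c ≈ d → a ⊛ c ≈ b ⊛ d
  ⊛-cong p q n = ∑-cong (splits (suc n)) (λ (i , j) → cong₂ _*_ (p i) (q j))

  ⊛-comm : ∀ a b → a ⊛ b ≈ b ⊛ a
  ⊛-comm a b n = trans (∑-splits-swap (suc n) (λ i j → a i * b j))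
    (∑-cong (splits (suc n)) (λ (i , j) → ℤₚ.*-comm (a j) (b i)))

  ⊛-assoc : ∀ a b c → (a ⊛ b) ⊛ c ≈ a ⊛ (b ⊛ c)
  ⊛-assoc a b c n = begin
    ∑ (splits (suc n)) (λ (m , k) → ∑ (splits (suc m)) (λ (i , j) → a i * b j) * c k)
      ≡⟨ ∑-cong (splits (suc n)) (λ (m , k) → sym (∑-*ʳ (c k) (splits (suc m)) _)) ⟩
    ∑ (splits (suc n)) (λ (m , k) → ∑ (splits (suc m)) (λ (i , j) → a i * b j * c k))
      ≡⟨ ∑-splits-assoc n (λ i j k → a i * b j * c k) ⟩
    ∑ (splits (suc n)) (λ (i , m) → ∑ (splits (suc m)) (λ (j , k) → a i * b j * c k))
      ≡⟨ ∑-cong (splits (suc n)) (λ (i , m) →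
           trans (∑-cong (splits (suc m)) (λ (j , k) → ℤₚ.*-assoc (a i) (b j) (c k)))
                 (∑-*ˡ (a i) (splits (suc m)) _)) ⟩
    ∑ (splits (suc n)) (λ (i , m) → a i * ∑ (splits (suc m)) (λ (j , k) → b j * c k)) ∎
    where open ≡-Reasoning

  const-⊛ : ∀ c a n → (const c ⊛ a) n ≡ c * a n
  const-⊛ c a n = begin
    (const c ⊛ a) n
      ≡⟨ ∑-splits-suc n _ ⟩
    c * a n + ∑ (splits n) (λ (i , j) → 0ℤ * a j)
      ≡⟨ cong (_+_ (c * a n)) (trans (∑-cong (splits n) (λ (i , j) → ℤₚ.*-zeroˡ (a j))) (∑-zero (splits n))) ⟩
    c * a n + 0ℤ
      ≡⟨ ℤₚ.+-identityʳ _ ⟩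
    c * a n ∎
    where open ≡-Reasoning

  ⊛-identityˡ : ∀ a → const 1ℤ ⊛ a ≈ a
  ⊛-identityˡ a n = trans (const-⊛ 1ℤ a n) (ℤₚ.*-identityˡ (a n))

  ⊛-distribˡ : ∀ a b c → a ⊛ (b ⊕ c) ≈ (a ⊛ b) ⊕ (a ⊛ c)
  ⊛-distribˡ a b c n = trans
    (∑-cong (splits (suc n)) (λ (i , j) → ℤₚ.*-distribˡ-+ (a i) (b j) (c j)))
    (∑-+ (splits (suc n)) _ _)

  seqRing : CommutativeRing 0ℓ 0ℓ
  seqRing = record
    { Carrier = Seq
    ; _≈_ = _≈_
    ; _+_ = _⊕_
    ; _*_ = _⊛_
    ; -_ = ⊖_
    ; 0# = λ _ → 0ℤ
    ; 1# = const 1ℤ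
    ; isCommutativeRing = record
      { isRing = record
        { +-isAbelianGroup = record
          { isGroup = record
            { isMonoid = record
              { isSemigroup = record
                { isMagma = record
                  { isEquivalence = record
                    { refl = λ n → refl
                    ; sym = λ p n → sym (p n)
                    ; trans = λ p q n → trans (p n) (q n)
                    }
                  ; ∙-cong = λ p q n → cong₂ _+_ (p n) (q n)
                  }
                ; assoc = λ a b c n → ℤₚ.+-assoc (a n) (b n) (c n)
                }
              ; identity = (λ a n → ℤₚ.+-identityˡ (a n)) , (λ a n → ℤₚ.+-identityʳ (a n))
              }
            ; inverse = (λ a n → ℤₚ.+-inverseˡ (a n)) , (λ a n → ℤₚ.+-inverseʳ (a n))
            ; ⁻¹-cong = λ p n → cong -_ (p n)
            }
          ; comm = λ a b n → ℤₚ.+-comm (a n) (b n)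
          }
        ; *-cong = ⊛-cong
        ; *-assoc = ⊛-assoc
        ; *-identity = ⊛-identityˡ , λ a n → trans (⊛-comm a (const 1ℤ) n) (⊛-identityˡ a n)
        ; distrib = ⊛-distribˡ , λ a b c n → trans (⊛-comm (b ⊕ c) a n)
            (trans (⊛-distribˡ a b c n) (cong₂ _+_ (⊛-comm a b n) (⊛-comm a c n)))
        }
      ; *-comm = ⊛-comm
      }
    }


  -- Gives the ring solver coefficients in ℤ, embedded as constant series, so that numerical
  -- coefficients are computed and not treated as atoms.
  const-hom : CommutativeRing.rawRing ℤₚ.+-*-commutativeRing -Raw-AlmostCommutative⟶ fromCommutativeRing seqRing
  const-hom = record
    { ⟦_⟧    = const
    ; +-homo = λ { a b zero → refl ; a b (suc n) → refl }
    ; *-homo = λ { a b zero → sym (const-⊛ a (const b) 0)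
                 ; a b (suc n) → sym (trans (const-⊛ a (const b) (suc n)) (ℤₚ.*-zeroʳ a)) }
    ; -‿homo = λ { a zero → refl ; a (suc n) → refl }
    ; 0-homo = λ { zero → refl ; (suc n) → refl }
    ; 1-homo = λ n → refl
    }

  const-≟ : ∀ a b → Maybe (const a ≈ const b)
  const-≟ a b = dec⇒maybe (map′ (λ { refl n → refl }) (λ p → p 0) (a ℤₚ.≟ b))

  module SeqSolver = RingSolver (CommutativeRing.rawRing ℤₚ.+-*-commutativeRing)
    (fromCommutativeRing seqRing) const-hom const-≟

  open CommutativeRing seqRing using (+-cong; *-cong; setoid)
    renaming (refl to ≈-refl; sym to ≈-sym; trans to ≈-trans)
  module ≈-Reasoning = SetoidReasoning setoid
  module ℤGroup = AbelianGroupProperties ℤₚ.+-0-abelianGroup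

  -- The algebra ℤ[x,u]

  -- Series are in a variable z marking the sides of a face; x is z².
  x : Seq
  x 2 = 1ℤ
  x _ = 0ℤ

  open SeqSolver

  x-⊛-0 : ∀ a → (x ⊛ a) 0 ≡ 0ℤ
  x-⊛-0 a = ∑-splits-one _

  x-⊛-1 : ∀ a → (x ⊛ a) 1 ≡ 0ℤ
  x-⊛-1 a = trans (∑-splits-suc 1 _) (trans (ℤₚ.+-identityˡ _) (∑-splits-one _))

  x-⊛-2+ : ∀ a n → (x ⊛ a) (suc (suc n)) ≡ a n
  x-⊛-2+ a n = begin
    (x ⊛ a) (suc (suc n))
      ≡⟨ trans (∑-splits-suc (suc (suc n)) _) (ℤₚ.+-identityˡ _) ⟩
    ∑ (splits (suc (suc n))) (λ (i , j) → x (suc i) * a j)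
      ≡⟨ trans (∑-splits-suc (suc n) _) (ℤₚ.+-identityˡ _) ⟩
    ∑ (splits (suc n)) (λ (i , j) → x (suc (suc i)) * a j)
      ≡⟨ ∑-splits-suc n _ ⟩
    1ℤ * a n + ∑ (splits n) (λ (i , j) → 0ℤ * a j)
      ≡⟨ cong₂ _+_ (ℤₚ.*-identityˡ (a n)) (∑-zero (splits n)) ⟩
    a n + 0ℤ
      ≡⟨ ℤₚ.+-identityʳ (a n) ⟩
    a n ∎
    where open ≡-Reasoning

  -- The factor `x` pays for the root and its partner: of p + 1 sides, p - 1 remain for the two
  -- arcs, which is what `splits p` distributes.
  x-⊛-suc : ∀ a b p → (x ⊛ (a ⊛ b)) (suc p) ≡ ∑ (splits p) (λ (i , j) → a i * b j)
  x-⊛-suc a b zero    = trans (x-⊛-1 (a ⊛ b)) (sym (∑-splits-zero _))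
  x-⊛-suc a b (suc p) = x-⊛-2+ (a ⊛ b) p

  -- Series defined by fixed-point equations

  Causal : (Seq → Seq) → Set
  Causal Φ = ∀ a b n → (∀ i → i ℕ.< n → a i ≡ b i) → Φ a n ≡ Φ b n

  -- `Φ` is a contraction in the z-adic sense: each application settles one more coefficient, so
  -- coefficient n can be read off from the (n + 1)-st iterate.
  module Fixpoint (Φ : Seq → Seq) (causal : Causal Φ) where

    approx : ℕ → Seq
    approx zero    = λ _ → 0ℤ
    approx (suc f) = Φ (approx f)

    approx-stable : ∀ f g n → n ℕ.< f → n ℕ.< g → approx f n ≡ approx g n
    approx-stable (suc f) (suc g) n n<f n<g = causal _ _ n (λ i i<n →
      approx-stable f g i (ℕₚ.<-≤-trans i<n (ℕ.s≤s⁻¹ n<f)) (ℕₚ.<-≤-trans i<n (ℕ.s≤s⁻¹ n<g)))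

    fix : Seq
    fix n = approx (suc n) n

    fix-eq : fix ≈ Φ fix
    fix-eq n = causal _ _ n (λ i i<n → approx-stable n (suc i) i i<n ℕₚ.≤-refl)

  ⊛-causal : ∀ a b c d n → (∀ i → i ℕ.≤ n → a i ≡ c i) → (∀ i → i ℕ.≤ n → b i ≡ d i) →
    (a ⊛ b) n ≡ (c ⊛ d) n
  ⊛-causal a b c d n p q = ∑-splits-cong (suc n) (λ i j e → cong₂ _*_
    (p i (ℕₚ.≤-trans (ℕₚ.m≤m+n i j) (ℕₚ.≤-reflexive (ℕₚ.suc-injective e))))
    (q j (ℕₚ.≤-trans (ℕₚ.m≤n+m j i) (ℕₚ.≤-reflexive (ℕₚ.suc-injective e)))))

  catalan-step : Seq → Seq
  catalan-step a = const 1ℤ ⊕ (x ⊛ (a ⊛ a))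

  catalan-causal : Causal catalan-step
  catalan-causal a b zero          p = cong (_+_ 1ℤ) (trans (x-⊛-0 (a ⊛ a)) (sym (x-⊛-0 (b ⊛ b))))
  catalan-causal a b (suc zero)    p = cong (_+_ 0ℤ) (trans (x-⊛-1 (a ⊛ a)) (sym (x-⊛-1 (b ⊛ b))))
  catalan-causal a b (suc (suc n)) p = cong (_+_ 0ℤ)
    (trans (x-⊛-2+ (a ⊛ a) n) (trans (⊛-causal a a b b n q q) (sym (x-⊛-2+ (b ⊛ b) n))))
    where
    q : ∀ i → i ℕ.≤ n → a i ≡ b i
    q i i≤n = p i (ℕ.s≤s (ℕₚ.m≤n⇒m≤1+n i≤n))

  abstract

    -- Planar gluings of a single face (aerated Catalan numbers).
    w : Seq
    w = Fixpoint.fix catalan-step catalan-causal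

    w-eq : w ≈ const 1ℤ ⊕ (x ⊛ (w ⊛ w))
    w-eq = Fixpoint.fix-eq catalan-step catalan-causal

  inverse-step : Seq → Seq
  inverse-step a = const 1ℤ ⊕ (x ⊛ ((w ⊕ w) ⊛ a))

  inverse-causal : Causal inverse-step
  inverse-causal a b zero          p = cong (_+_ 1ℤ) (trans (x-⊛-0 ((w ⊕ w) ⊛ a)) (sym (x-⊛-0 ((w ⊕ w) ⊛ b))))
  inverse-causal a b (suc zero)    p = cong (_+_ 0ℤ) (trans (x-⊛-1 ((w ⊕ w) ⊛ a)) (sym (x-⊛-1 ((w ⊕ w) ⊛ b))))
  inverse-causal a b (suc (suc n)) p = cong (_+_ 0ℤ)
    (trans (x-⊛-2+ ((w ⊕ w) ⊛ a) n)
      (trans (⊛-causal (w ⊕ w) a (w ⊕ w) b n (λ _ _ → refl) q) (sym (x-⊛-2+ ((w ⊕ w) ⊛ b) n))))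
    where
    q : ∀ i → i ℕ.≤ n → a i ≡ b i
    q i i≤n = p i (ℕ.s≤s (ℕₚ.m≤n⇒m≤1+n i≤n))

  abstract

    -- u = 1 / (1 - 2 x w) = (1 - 4 x)^(-1/2), which solves every linear loop equation.
    u : Seq
    u = Fixpoint.fix inverse-step inverse-causal

    u-eq : u ≈ const 1ℤ ⊕ (x ⊛ ((w ⊕ w) ⊛ u))
    u-eq = Fixpoint.fix-eq inverse-step inverse-causal

  -- This is `u-eq` multiplied by b. All linear loop equations share the kernel 2 x w; it is kept as
  -- two products because the connected part can sit on either arc of a split.
  solve-loop : ∀ {a} b → a ≈ u ⊛ b → a ≈ (x ⊛ ((w ⊛ a) ⊕ (a ⊛ w))) ⊕ b
  solve-loop {a} b p = ≈-trans p (≈-trans (*-cong {u} {_} {b} u-eq ≈-refl) (≈-trans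
    (solve 4 (λ x w u b → (con 1ℤ :+ x :* ((w :+ w) :* u)) :* b
                       := x :* (w :* (u :* b) :+ (u :* b) :* w) :+ b) ≈-refl x w u b)
    (+-cong {_} {_} {b} (*-cong {x} ≈-refl (+-cong (*-cong {w} ≈-refl (≈-sym p)) (*-cong {_} {_} {w} (≈-sym p) ≈-refl))) ≈-refl)))

  -- A linear-combination certificate: adding the multiple c of a known equation p ≈ q turns the
  -- goal into a pure ring identity, which the solver proves.
  modulo : ∀ {a b p q} c → p ≈ q → a ⊕ (c ⊛ p) ≈ b ⊕ (c ⊛ q) → a ≈ b
  modulo {a} {b} {p} {q} c p≈q eq n = ℤGroup.∙-cancelʳ ((c ⊛ p) n) (a n) (b n)
    (trans (eq n) (cong (_+_ (b n)) (sym (⊛-cong {c} {c} (λ _ → refl) p≈q n))))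

  const-cancel : ∀ k {a b} → const (+ suc k) ⊛ a ≈ const (+ suc k) ⊛ b → a ≈ b
  const-cancel k {a} {b} eq n = ℤₚ.*-cancelˡ-≡ (+ suc k) (a n) (b n)
    (trans (sym (const-⊛ (+ suc k) a n)) (trans (eq n) (const-⊛ (+ suc k) b n)))

  -- The square root of 1 - 4 x, hence the inverse of `u`; it carries information from `w` to `u`.
  r : Seq
  r = const 1ℤ ⊕ (⊖ (x ⊛ (w ⊕ w)))

  r-inverse : r ⊛ u ≈ const 1ℤ
  r-inverse = modulo (const 1ℤ) (≈-sym u-eq)
    (solve 3 (λ x w u → (con 1ℤ :+ :- (x :* (w :+ w))) :* u :+ con 1ℤ :* (con 1ℤ :+ x :* ((w :+ w) :* u))
                     := con 1ℤ :+ con 1ℤ :* u) ≈-refl x w u)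

  -- Completing the square in `w-eq`: 1 - 4 x w + 4 x² w² = 1 - 4 x (w - x w²).
  r-square : r ⊛ r ≈ const 1ℤ ⊕ (⊖ (const (+ 4) ⊛ x))
  r-square = modulo (const (+ 4) ⊛ x) w-eq
    (solve 2 (λ x w → (con 1ℤ :+ :- (x :* (w :+ w))) :* (con 1ℤ :+ :- (x :* (w :+ w))) :+ (con (+ 4) :* x) :* w
                   := (con 1ℤ :+ :- (con (+ 4) :* x)) :+ (con (+ 4) :* x) :* (con 1ℤ :+ x :* (w :* w))) ≈-refl x w)

  -- r² = 1 - 4 x times u², with (r u)² = 1; the multiplier `r ⊛ u ⊕ const 1ℤ` comes from (r u)² - 1
  -- = (r u + 1)(r u - 1). The shape "expression equal to 0" is that of `relation` below.
  u-square : const 1ℤ ⊕ (⊖ (u ⊛ u)) ⊕ (const (+ 4) ⊛ x ⊛ (u ⊛ u)) ≈ const 0ℤ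
  u-square = modulo (⊖ (u ⊛ u)) r-square (modulo (r ⊛ u ⊕ const 1ℤ) r-inverse
    (solve 3 (λ x u r → (con 1ℤ :+ :- (u :* u) :+ con (+ 4) :* x :* (u :* u) :+ :- (u :* u) :* (r :* r))
                           :+ (r :* u :+ con 1ℤ) :* (r :* u)
                     := (con 0ℤ :+ :- (u :* u) :* (con 1ℤ :+ :- (con (+ 4) :* x))) :+ (r :* u :+ con 1ℤ) :* con 1ℤ) ≈-refl x u r))

  -- The Euler operator on series and on polynomials

  θ : Seq → Seq
  θ a n = + n * a n

  θ-cong : ∀ {a b} → a ≈ b → θ a ≈ θ b
  θ-cong p n = cong (_*_ (+ n)) (p n)

  θ-⊕ : ∀ a b → θ (a ⊕ b) ≈ θ a ⊕ θ b
  θ-⊕ a b n = ℤₚ.*-distribˡ-+ (+ n) (a n) (b n)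

  θ-⊖ : ∀ a → θ (⊖ a) ≈ ⊖ θ a
  θ-⊖ a n = sym (ℤₚ.neg-distribʳ-* (+ n) (a n))

  θ-const : ∀ c → θ (const c) ≈ const 0ℤ
  θ-const c zero    = ℤₚ.*-zeroˡ c
  θ-const c (suc n) = ℤₚ.*-zeroʳ (+ suc n)

  θ-⊛ : ∀ a b → θ (a ⊛ b) ≈ (θ a ⊛ b) ⊕ (a ⊛ θ b)
  θ-⊛ a b n = begin
    + n * ∑ (splits (suc n)) (λ (i , j) → a i * b j)
      ≡⟨ sym (∑-*ˡ (+ n) (splits (suc n)) _) ⟩
    ∑ (splits (suc n)) (λ (i , j) → + n * (a i * b j))
      ≡⟨ ∑-splits-cong (suc n) (λ i j e → trans
           (cong (λ t → + t * (a i * b j)) (sym (ℕₚ.suc-injective e)))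
           (leibniz (+ i) (+ j) (a i) (b j))) ⟩
    ∑ (splits (suc n)) (λ (i , j) → + i * a i * b j + a i * (+ j * b j))
      ≡⟨ ∑-+ (splits (suc n)) _ _ ⟩
    ((θ a ⊛ b) ⊕ (a ⊛ θ b)) n ∎
    where
    open ≡-Reasoning
    leibniz : ∀ i j a b → (i + j) * (a * b) ≡ i * a * b + a * (j * b)
    leibniz = solve-∀

  θ-x : θ x ≈ const (+ 2) ⊛ x
  θ-x n = trans (lemma n) (sym (const-⊛ (+ 2) x n))
    where
    lemma : ∀ n → + n * x n ≡ + 2 * x n
    lemma 0 = refl
    lemma 1 = refl
    lemma 2 = refl
    lemma (suc (suc (suc n))) = trans (ℤₚ.*-zeroʳ (+ suc (suc (suc n)))) (sym (ℤₚ.*-zeroʳ (+ 2)))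

  -- Implicit differentiation of `r-square` gives 2 r θ r = - 8 x; multiply by u = 1/r and cancel 2.
  θ-r : θ r ≈ ⊖ (const (+ 4) ⊛ (x ⊛ u))
  θ-r = const-cancel 1 (modulo (const (+ 2) ⊛ θ r) r-inverse (modulo (⊖ u) two-r-θr
    (solve 4 (λ x u r t →
        (con (+ 2) :* t :+ (con (+ 2) :* t) :* (r :* u)) :+ :- u :* (t :* r :+ r :* t)
     := (con (+ 2) :* (:- (con (+ 4) :* (x :* u))) :+ (con (+ 2) :* t) :* con 1ℤ)
          :+ :- u :* (con 0ℤ :+ :- (con 0ℤ :* x :+ con (+ 4) :* (con (+ 2) :* x)))) ≈-refl x u r (θ r))))
    where
    two-r-θr : (θ r ⊛ r) ⊕ (r ⊛ θ r) ≈ const 0ℤ ⊕ (⊖ ((const 0ℤ ⊛ x) ⊕ (const (+ 4) ⊛ (const (+ 2) ⊛ x))))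
    two-r-θr = ≈-trans (≈-sym (θ-⊛ r r)) (≈-trans (θ-cong r-square)
      (≈-trans (θ-⊕ (const 1ℤ) _) (+-cong (θ-const 1ℤ) (≈-trans (θ-⊖ _)
        (λ n → cong -_ (trans (θ-⊛ (const (+ 4)) x n)
          (cong₂ _+_ (⊛-cong {_} {_} {x} (θ-const (+ 4)) ≈-refl n) (⊛-cong {const (+ 4)} ≈-refl θ-x n))))))))

  -- Differentiating r u = 1 gives θ u = - u² θ r.
  θ-u : θ u ≈ const (+ 4) ⊛ x ⊛ (u ⊛ (u ⊛ u))
  θ-u = modulo (⊖ u) d-inverse (modulo (u ⊛ u) θ-r (modulo (θ u) r-inverse
    (solve 5 (λ x u r t s →
        ((s :+ :- u :* (t :* u :+ r :* s)) :+ (u :* u) :* t) :+ s :* (r :* u)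
     := (((con (+ 4) :* x :* (u :* (u :* u))) :+ :- u :* con 0ℤ) :+ (u :* u) :* (:- (con (+ 4) :* (x :* u)))) :+ s :* con 1ℤ)
       ≈-refl x u r (θ r) (θ u))))
    where
    d-inverse : (θ r ⊛ u) ⊕ (r ⊛ θ u) ≈ const 0ℤ
    d-inverse = ≈-trans (≈-sym (θ-⊛ r u)) (≈-trans (θ-cong r-inverse) (θ-const 1ℤ))

  X V : Polynomial 2
  X = var zero
  V = var (suc zero)

  ρ : Vec Seq 2
  ρ = x ∷ u ∷ []

  ⟪_⟫ : Polynomial 2 → Seq
  ⟪ p ⟫ = ⟦ p ⟧ ρ

  -- By θ-x and θ-u the Euler operator θ = z d/dz acts on ℤ[x,u] as a derivation.
  ∂ : Polynomial 2 → Polynomial 2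
  ∂ (op [+] p q)       = ∂ p :+ ∂ q
  ∂ (op [*] p q)       = ∂ p :* q :+ p :* ∂ q
  ∂ (con c)            = con 0ℤ
  ∂ (var zero)         = con (+ 2) :* X
  ∂ (var (suc zero))   = con (+ 4) :* X :* (V :* (V :* V))
  ∂ (p :^ zero)        = con 0ℤ
  ∂ (p :^ suc n)       = ∂ p :* p :^ n :+ p :* ∂ (p :^ n)
  ∂ (:- p)             = :- ∂ p

  θ-⟪⟫ : ∀ p → θ ⟪ p ⟫ ≈ ⟪ ∂ p ⟫
  θ-⟪⟫ (op [+] p q)     = ≈-trans (θ-⊕ ⟪ p ⟫ ⟪ q ⟫) (+-cong (θ-⟪⟫ p) (θ-⟪⟫ q))
  θ-⟪⟫ (op [*] p q)     = ≈-trans (θ-⊛ ⟪ p ⟫ ⟪ q ⟫)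
    (+-cong (*-cong {_} {_} {⟪ q ⟫} (θ-⟪⟫ p) ≈-refl) (*-cong {⟪ p ⟫} ≈-refl (θ-⟪⟫ q)))
  θ-⟪⟫ (con c)          = θ-const c
  θ-⟪⟫ (var zero)       = θ-x
  θ-⟪⟫ (var (suc zero)) = θ-u
  θ-⟪⟫ (p :^ zero)      = θ-const 1ℤ
  θ-⟪⟫ (p :^ suc n)     = ≈-trans (θ-⊛ ⟪ p ⟫ ⟪ p :^ n ⟫)
    (+-cong (*-cong {_} {_} {⟪ p :^ n ⟫} (θ-⟪⟫ p) ≈-refl) (*-cong {⟪ p ⟫} ≈-refl (θ-⟪⟫ (p :^ n))))
  θ-⟪⟫ (:- p)           = ≈-trans (θ-⊖ ⟪ p ⟫) (λ n → cong -_ (θ-⟪⟫ p n))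

  relation : Polynomial 2
  relation = con 1ℤ :+ :- (V :* V) :+ con (+ 4) :* X :* (V :* V)

  equal-polynomials : ∀ p q → normalise p ≡ normalise q → ⟪ p ⟫ ≈ ⟪ q ⟫
  equal-polynomials p q eq = prove ρ p q (λ n → cong (λ t → ⟦ t ⟧N ρ n) eq)

  -- c is an ideal-membership certificate: p - q is c times `relation`, which evaluates to 0. An
  -- identity that holds only for the series `u` is thus checked by one normalisation of formal
  -- polynomials.
  modulo-relation : ∀ p q c → normalise p ≡ normalise (q :+ c :* relation) → ⟪ p ⟫ ≈ ⟪ q ⟫
  modulo-relation p q c eq n = trans (equal-polynomials p (q :+ c :* relation) eq n) (trans
    (cong (_+_ (⟪ q ⟫ n)) (trans (⊛-cong {⟪ c ⟫} (λ _ → refl) u-square n)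
      (trans (⊛-comm ⟪ c ⟫ (const 0ℤ) n) (const-⊛ 0ℤ ⟪ c ⟫ n))))
    (ℤₚ.+-identityʳ _))

  -- Sums over the sizes of a second face

  -- A face with p + 1 sides, its root glued to one of the l sides of another face, becomes
  -- a face with p + l - 1 sides.
  joins : Seq → ℕ → Seq
  joins a l zero    = 0ℤ
  joins a l (suc p) = + l * a (p ℕ.+ ℕ.pred l)

  -- Both size variables are set equal to z: coefficient n collects all pairs of faces with n sides
  -- in total.
  diag : (ℕ → Seq) → Seq
  diag G n = ∑ (splits (suc n)) (λ (m , k) → G k m)

  diag-cong : ∀ {G H} → (∀ k → G k ≈ H k) → diag G ≈ diag H
  diag-cong p n = ∑-cong (splits (suc n)) (λ (m , k) → p k m)

  diag-⊕ : ∀ G H → diag (λ k → G k ⊕ H k) ≈ diag G ⊕ diag H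
  diag-⊕ G H n = ∑-+ (splits (suc n)) _ _

  diag-⊛ : ∀ a G → diag (λ k → a ⊛ G k) ≈ a ⊛ diag G
  diag-⊛ a G n = trans (∑-splits-assoc n (λ i j k → a i * G k j))
    (∑-cong (splits (suc n)) (λ (i , m) → ∑-*ˡ (a i) (splits (suc m)) (λ (j , k) → G k j)))

  diag-⊛ʳ : ∀ a G → diag (λ k → G k ⊛ a) ≈ a ⊛ diag G
  diag-⊛ʳ a G = ≈-trans (diag-cong (λ k → ⊛-comm (G k) a)) (diag-⊛ a G)

  diag-diag : ∀ (G : ℕ → ℕ → Seq) → diag (λ k → diag (λ l → G l k)) ≈ diag (λ k → diag (λ l → G k l))
  diag-diag G n = begin
    ∑ (splits (suc n)) (λ (m , k) → ∑ (splits (suc m)) (λ (i , l) → G l k i))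
      ≡⟨ ∑-splits-assoc n (λ i l k → G l k i) ⟩
    ∑ (splits (suc n)) (λ (i , m) → ∑ (splits (suc m)) (λ (l , k) → G l k i))
      ≡⟨ ∑-cong (splits (suc n)) (λ (i , m) → ∑-splits-swap (suc m) (λ l k → G l k i)) ⟩
    ∑ (splits (suc n)) (λ (i , m) → ∑ (splits (suc m)) (λ (l , k) → G k l i))
      ≡⟨ sym (∑-splits-assoc n (λ i l k → G k l i)) ⟩
    ∑ (splits (suc n)) (λ (m , k) → ∑ (splits (suc m)) (λ (i , l) → G k l i)) ∎
    where open ≡-Reasoning

  -- `moment p q` is the sum of p m · k over m, k ≥ 1 with m + k = q + 2; by summation by parts its
  -- increments in q are values of `partial-sum`.
  partial-sum moment : (ℕ → ℤ) → ℕ → ℤ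
  partial-sum p q = ∑ (splits (suc q)) (λ (i , j) → p (suc i))
  moment p q = ∑ (splits (suc q)) (λ (i , j) → p (suc i) * + suc j)

  partial-sum-suc : ∀ p q → partial-sum p (suc q) ≡ partial-sum p q + p (suc (suc q))
  partial-sum-suc p q = ∑-splits-last (suc q) _

  moment-suc : ∀ p q → moment p (suc q) ≡ moment p q + partial-sum p (suc q)
  moment-suc p q = begin
    moment p (suc q)
      ≡⟨ ∑-splits-last (suc q) _ ⟩
    ∑ (splits (suc q)) (λ (i , j) → p (suc i) * + suc (suc j)) + p (suc (suc q)) * 1ℤ
      ≡⟨ cong₂ _+_ (trans (∑-cong (splits (suc q)) (λ (i , j) → step (p (suc i)) (+ suc j)))
                          (∑-+ (splits (suc q)) _ _))
                   (ℤₚ.*-identityʳ (p (suc (suc q)))) ⟩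
    moment p q + partial-sum p q + p (suc (suc q))
      ≡⟨ ℤₚ.+-assoc (moment p q) _ _ ⟩
    moment p q + (partial-sum p q + p (suc (suc q)))
      ≡⟨ cong (_+_ (moment p q)) (sym (partial-sum-suc p q)) ⟩
    moment p q + partial-sum p (suc q) ∎
    where
    open ≡-Reasoning
    step : ∀ a b → a * (1ℤ + b) ≡ a * b + a
    step = solve-∀

  diag-joins-0 : ∀ (p : ℕ → ℤ) a → diag (λ k m → p m * joins a k m) 0 ≡ 0ℤ
  diag-joins-0 p a = trans (∑-splits-one _) (ℤₚ.*-zeroʳ (p 0))

  diag-joins-1 : ∀ (p : ℕ → ℤ) a → diag (λ k m → p m * joins a k m) 1 ≡ 0ℤ
  diag-joins-1 p a = trans (∑-splits-suc 1 _)
    (cong₂ _+_ (ℤₚ.*-zeroʳ (p 0)) (trans (∑-splits-one _) (trans (cong (_*_ (p 1)) (ℤₚ.*-zeroˡ (a 0))) (ℤₚ.*-zeroʳ (p 1)))))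

  -- For m + k = q + 2 the joined face always has q sides, so a q factors out and a purely numerical
  -- sum remains.
  diag-joins-2+ : ∀ (p : ℕ → ℤ) a q → diag (λ k m → p m * joins a k m) (suc (suc q)) ≡ moment p q * a q
  diag-joins-2+ p a q = begin
    diag (λ k m → p m * joins a k m) (suc (suc q))
      ≡⟨ trans (∑-splits-suc (suc (suc q)) _)
           (trans (cong₂ _+_ (ℤₚ.*-zeroʳ (p 0)) refl) (ℤₚ.+-identityˡ _)) ⟩
    ∑ (splits (suc (suc q))) (λ (m , k) → p (suc m) * (+ k * a (m ℕ.+ ℕ.pred k)))
      -- The term m = 0 has just disappeared because `joins` has no constant coefficient; the term k
      -- = 0 disappears because a 0-gon offers 0 partners.
      ≡⟨ trans (∑-splits-last (suc q) _)
           (trans (cong (_+_ rest) (trans (cong (_*_ (p (suc (suc q)))) (ℤₚ.*-zeroˡ (a (suc q ℕ.+ 0)))) (ℤₚ.*-zeroʳ (p (suc (suc q))))))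
                  (ℤₚ.+-identityʳ rest)) ⟩
    ∑ (splits (suc q)) (λ (m , k) → p (suc m) * (+ suc k * a (m ℕ.+ k)))
      ≡⟨ ∑-splits-cong (suc q) (λ m k e → trans
           (cong (λ t → p (suc m) * (+ suc k * a t)) (ℕₚ.suc-injective e))
           (sym (ℤₚ.*-assoc (p (suc m)) (+ suc k) (a q)))) ⟩
    ∑ (splits (suc q)) (λ (m , k) → p (suc m) * + suc k * a q)
      ≡⟨ ∑-*ʳ (a q) (splits (suc q)) _ ⟩
    moment p q * a q ∎
    where
    open ≡-Reasoning
    rest : ℤ
    rest = ∑ (splits (suc q)) (λ (m , k) → p (suc m) * (+ suc k * a (m ℕ.+ k)))

  -- The moment, cleared of denominators by c, is a polynomial `P` in the total n = q + 2. Weighting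
  -- coefficient n by `P` n is the operator P(θ), and `x` supplies the two sides used up by the
  -- join.
  diag-joins : ∀ p a c (P : ℤ → ℤ) → (∀ q → c * moment p q ≡ P (+ suc (suc q))) →
    const c ⊛ diag (λ k m → p m * joins a k m) ≈ (λ n → P (+ n) * (x ⊛ a) n)
  diag-joins p a c P eq n = trans (const-⊛ c _ n) (lemma n)
    where
    lemma : ∀ n → c * diag (λ k m → p m * joins a k m) n ≡ P (+ n) * (x ⊛ a) n
    lemma 0 = trans (cong (_*_ c) (diag-joins-0 p a)) (trans (ℤₚ.*-zeroʳ c)
      (sym (trans (cong (_*_ (P (+ 0))) (x-⊛-0 a)) (ℤₚ.*-zeroʳ (P (+ 0))))))
    lemma 1 = trans (cong (_*_ c) (diag-joins-1 p a)) (trans (ℤₚ.*-zeroʳ c)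
      (sym (trans (cong (_*_ (P (+ 1))) (x-⊛-1 a)) (ℤₚ.*-zeroʳ (P (+ 1))))))
    lemma (suc (suc q)) = begin
      c * diag (λ k m → p m * joins a k m) (suc (suc q)) ≡⟨ cong (_*_ c) (diag-joins-2+ p a q) ⟩
      c * (moment p q * a q)                             ≡⟨ sym (ℤₚ.*-assoc c (moment p q) (a q)) ⟩
      c * moment p q * a q                               ≡⟨ cong₂ _*_ (eq q) (sym (x-⊛-2+ a q)) ⟩
      P (+ suc (suc q)) * (x ⊛ a) (suc (suc q))          ∎
      where open ≡-Reasoning

  -- A closed form is certified by its first value and its difference equation. `moment-closed`
  -- repeats this for the second summation, with d as the additional denominator.
  partial-sum-closed : ∀ p c (Q : ℤ → ℤ) → c * p 1 ≡ Q 0ℤ →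
    (∀ q → Q (+ q) + c * p (suc (suc q)) ≡ Q (+ suc q)) → ∀ q → c * partial-sum p q ≡ Q (+ q)
  partial-sum-closed p c Q base step zero    = trans (cong (_*_ c) (∑-splits-one _)) base
  partial-sum-closed p c Q base step (suc q) =
    trans (cong (_*_ c) (partial-sum-suc p q))
      (trans (ℤₚ.*-distribˡ-+ c (partial-sum p q) _)
        (trans (cong₂ _+_ (partial-sum-closed p c Q base step q) refl) (step q)))

  moment-closed : ∀ p c d (Q P : ℤ → ℤ) → (∀ q → c * partial-sum p q ≡ Q (+ q)) → d * c * p 1 ≡ P (+ 2) →
    (∀ q → P (+ suc (suc q)) + d * Q (+ suc q) ≡ P (+ suc (suc (suc q)))) →
    ∀ q → d * c * moment p q ≡ P (+ suc (suc q))
  moment-closed p c d Q P sums base step zero =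
    trans (cong (_*_ (d * c)) (trans (∑-splits-one _) (ℤₚ.*-identityʳ (p 1)))) base
  moment-closed p c d Q P sums base step (suc q) = begin
    d * c * moment p (suc q)
      ≡⟨ cong (_*_ (d * c)) (moment-suc p q) ⟩
    d * c * (moment p q + partial-sum p (suc q))
      ≡⟨ distrib d c (moment p q) _ ⟩
    d * c * moment p q + d * (c * partial-sum p (suc q))
      ≡⟨ cong₂ _+_ (moment-closed p c d Q P sums base step q) (cong (_*_ d) (sums (suc q))) ⟩
    P (+ suc (suc q)) + d * Q (+ suc q)
      ≡⟨ step q ⟩
    P (+ suc (suc (suc q))) ∎
    where
    open ≡-Reasoning
    distrib : ∀ d c m s → d * c * (m + s) ≡ d * c * m + d * (c * s)
    distrib = solve-∀

  -- The sums of k, m k and m² k over m + k = n are (n² - n)/2, (n³ - n)/6 and (n⁴ - n²)/12. This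
  -- statement and its two successors express them through θ; as every term contains a factor n, x ⊛
  -- a occurs only under θ.
  diag-joins-θ⁰ : ∀ a → const (+ 2) ⊛ diag (joins a) ≈ θ (θ (x ⊛ a)) ⊕ (⊖ θ (x ⊛ a))
  diag-joins-θ⁰ a n = trans
    (⊛-cong {const (+ 2)} (λ _ → refl) (diag-cong (λ k m → sym (ℤₚ.*-identityˡ (joins a k m)))) n)
    (trans
      (diag-joins (λ _ → 1ℤ) a (+ 2) (λ t → t * t + - t)
        (moment-closed (λ _ → 1ℤ) 1ℤ (+ 2) (λ t → 1ℤ + t) (λ t → t * t + - t)
          (partial-sum-closed (λ _ → 1ℤ) 1ℤ (λ t → 1ℤ + t) refl (λ q → s₀ (+ q))) refl (λ q → s₁ (+ q))) n)
      (s₂ (+ n) ((x ⊛ a) n)))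
    where
    s₀ : ∀ t → 1ℤ + t + 1ℤ * 1ℤ ≡ 1ℤ + (1ℤ + t)
    s₀ = solve-∀
    s₁ : ∀ t → (+ 2 + t) * (+ 2 + t) + - (+ 2 + t) + + 2 * (1ℤ + (1ℤ + t)) ≡ (+ 3 + t) * (+ 3 + t) + - (+ 3 + t)
    s₁ = solve-∀
    s₂ : ∀ n b → (n * n + - n) * b ≡ n * (n * b) + - (n * b)
    s₂ = solve-∀

  diag-joins-θ¹ : ∀ a → const (+ 6) ⊛ diag (θ ∘ joins a) ≈ θ (θ (θ (x ⊛ a))) ⊕ (⊖ θ (x ⊛ a))
  diag-joins-θ¹ a n = trans
      (diag-joins (λ m → + m) a (+ 6) (λ t → t * (t * t) + - t)
        (moment-closed (λ m → + m) (+ 2) (+ 3) (λ t → (1ℤ + t) * (+ 2 + t)) (λ t → t * (t * t) + - t)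
          (partial-sum-closed (λ m → + m) (+ 2) (λ t → (1ℤ + t) * (+ 2 + t)) refl (λ q → s₀ (+ q))) refl (λ q → s₁ (+ q))) n)
      (s₂ (+ n) ((x ⊛ a) n))
    where
    s₀ : ∀ t → (1ℤ + t) * (+ 2 + t) + + 2 * (+ 2 + t) ≡ (1ℤ + (1ℤ + t)) * (+ 2 + (1ℤ + t))
    s₀ = solve-∀
    s₁ : ∀ t → (+ 2 + t) * ((+ 2 + t) * (+ 2 + t)) + - (+ 2 + t) + + 3 * ((1ℤ + (1ℤ + t)) * (+ 2 + (1ℤ + t)))
             ≡ (+ 3 + t) * ((+ 3 + t) * (+ 3 + t)) + - (+ 3 + t)
    s₁ = solve-∀
    s₂ : ∀ n b → (n * (n * n) + - n) * b ≡ n * (n * (n * b)) + - (n * b)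
    s₂ = solve-∀

  diag-joins-θ² : ∀ a → const (+ 12) ⊛ diag (θ ∘ θ ∘ joins a) ≈ θ (θ (θ (θ (x ⊛ a)))) ⊕ (⊖ θ (θ (x ⊛ a)))
  diag-joins-θ² a n = trans
    (⊛-cong {const (+ 12)} (λ _ → refl) (diag-cong (λ k m → sym (ℤₚ.*-assoc (+ m) (+ m) (joins a k m)))) n)
    (trans
      (diag-joins (λ m → + m * + m) a (+ 12) (λ t → t * (t * (t * t)) + - (t * t))
        (moment-closed (λ m → + m * + m) (+ 6) (+ 2) (λ t → (1ℤ + t) * (+ 2 + t) * (+ 3 + + 2 * t)) (λ t → t * (t * (t * t)) + - (t * t))
          (partial-sum-closed (λ m → + m * + m) (+ 6) (λ t → (1ℤ + t) * (+ 2 + t) * (+ 3 + + 2 * t)) refl (λ q → s₀ (+ q))) refl (λ q → s₁ (+ q))) n)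
      (s₂ (+ n) ((x ⊛ a) n)))
    where
    s₀ : ∀ t → (1ℤ + t) * (+ 2 + t) * (+ 3 + + 2 * t) + + 6 * ((+ 2 + t) * (+ 2 + t))
             ≡ (1ℤ + (1ℤ + t)) * (+ 2 + (1ℤ + t)) * (+ 3 + + 2 * (1ℤ + t))
    s₀ = solve-∀
    s₁ : ∀ t → (+ 2 + t) * ((+ 2 + t) * ((+ 2 + t) * (+ 2 + t))) + - ((+ 2 + t) * (+ 2 + t))
                 + + 2 * ((1ℤ + (1ℤ + t)) * (+ 2 + (1ℤ + t)) * (+ 3 + + 2 * (1ℤ + t)))
             ≡ (+ 3 + t) * ((+ 3 + t) * ((+ 3 + t) * (+ 3 + t))) + - ((+ 3 + t) * (+ 3 + t))
    s₁ = solve-∀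
    s₂ : ∀ n b → (n * (n * (n * n)) + - (n * n)) * b ≡ n * (n * (n * (n * b))) + - (n * (n * b))
    s₂ = solve-∀

  -- Closed forms

  *-congˡ : ∀ a {b c} → b ≈ c → a ⊛ b ≈ a ⊛ c
  *-congˡ a = *-cong {a} ≈-refl

  *-congʳ : ∀ a {b c} → b ≈ c → b ⊛ a ≈ c ⊛ a
  *-congʳ a p = *-cong {_} {_} {a} p ≈-refl

  ⊖-cong : ∀ {a b} → a ≈ b → ⊖ a ≈ ⊖ b
  ⊖-cong p n = cong -_ (p n)

  θ-eval : ∀ {a} p → a ≈ ⟪ p ⟫ → θ a ≈ ⟪ ∂ p ⟫
  θ-eval p eq = ≈-trans (θ-cong eq) (θ-⟪⟫ p)

  -- Connected gluings of a face of varying size: w2 k in the plane with a face of size k, w1 on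
  -- the torus, w3 l k in the plane with faces of sizes l and k, w11 k on the torus with a face
  -- of size k. Each is u times the source term of its loop equation.
  w2 : ℕ → Seq
  w2 k = u ⊛ joins w k

  w1 : Seq
  w1 = u ⊛ (x ⊛ diag w2)

  w3-source w3 : ℕ → ℕ → Seq
  w3-source l k = (x ⊛ ((w2 k ⊛ w2 l) ⊕ (w2 l ⊛ w2 k))) ⊕ (joins (w2 k) l ⊕ joins (w2 l) k)
  w3 l k = u ⊛ w3-source l k

  w11-source w11 : ℕ → Seq
  w11-source k = ((x ⊛ diag (λ l → w3 l k)) ⊕ (x ⊛ ((w2 k ⊛ w1) ⊕ (w1 ⊛ w2 k)))) ⊕ joins w1 k
  w11 k = u ⊛ w11-source k

  -- Here `w` is eliminated: r = 1 - 2 x w gives 2 θ (x w) = - θ r = 4 x u.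
  θ-xw : θ (x ⊛ w) ≈ ⟪ con (+ 2) :* X :* V ⟫
  θ-xw = const-cancel 1 (begin
    const (+ 2) ⊛ θ (x ⊛ w)
      ≈⟨ solve 1 (λ t → con (+ 2) :* t := :- (con 0ℤ :+ :- (t :+ t))) ≈-refl (θ (x ⊛ w)) ⟩
    ⊖ (const 0ℤ ⊕ (⊖ (θ (x ⊛ w) ⊕ θ (x ⊛ w))))
      ≈⟨ ⊖-cong (+-cong (≈-sym (θ-const 1ℤ)) (⊖-cong (≈-trans (≈-sym (θ-⊕ (x ⊛ w) (x ⊛ w))) (θ-cong (≈-sym (⊛-distribˡ x w w)))))) ⟩
    ⊖ (θ (const 1ℤ) ⊕ (⊖ θ (x ⊛ (w ⊕ w))))
      ≈⟨ ⊖-cong (≈-trans (+-cong (≈-refl {θ (const 1ℤ)}) (≈-sym (θ-⊖ (x ⊛ (w ⊕ w))))) (≈-sym (θ-⊕ (const 1ℤ) _))) ⟩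
    ⊖ θ r
      ≈⟨ ⊖-cong θ-r ⟩
    ⊖ (⊖ (const (+ 4) ⊛ (x ⊛ u)))
      ≈⟨ solve 2 (λ x u → :- (:- (con (+ 4) :* (x :* u))) := con (+ 2) :* (con (+ 2) :* x :* u)) ≈-refl x u ⟩
    const (+ 2) ⊛ ⟪ con (+ 2) :* X :* V ⟫ ∎)
    where open ≈-Reasoning

  -- A certificate for the moment sums, which come with denominators: the multiplied identity is
  -- checked modulo `relation`, and the factor is cancelled coefficientwise in ℤ.
  by-relation : ∀ {a} k p q c → const (+ suc k) ⊛ a ≈ ⟪ p ⟫ →
    normalise p ≡ normalise (con (+ suc k) :* q :+ c :* relation) → a ≈ ⟪ q ⟫
  by-relation k p q c ap pq = const-cancel k (≈-trans ap (modulo-relation p (con (+ suc k) :* q) c pq))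

  e₁ : Polynomial 2
  e₁ = con (+ 2) :* X :* V

  diag-joins-w : diag (joins w) ≈ ⟪ X :* V :^ 3 ⟫
  diag-joins-w = by-relation 1 (∂ e₁ :+ :- e₁) (X :* V :^ 3)
    (con (+ 2) :* X :* V)
    (≈-trans (diag-joins-θ⁰ w) (+-cong (θ-eval e₁ θ-xw) (⊖-cong θ-xw)))
    refl

  diag-θ-joins-w : diag (θ ∘ joins w) ≈ ⟪ X :* V :^ 5 ⟫
  diag-θ-joins-w = by-relation 5 (∂ (∂ e₁) :+ :- e₁) (X :* V :^ 5)
    (con (+ 6) :* X :* V :+ con (+ 6) :* X :* V :^ 3 :+ con (+ 24) :* X :^ 2 :* V :^ 3)
    (≈-trans (diag-joins-θ¹ w) (+-cong (θ-eval (∂ e₁) (θ-eval e₁ θ-xw)) (⊖-cong θ-xw)))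
    refl

  diag-θθ-joins-w : diag (θ ∘ θ ∘ joins w) ≈ ⟪ X :* V :^ 7 :+ con (+ 6) :* X :^ 2 :* V :^ 7 ⟫
  diag-θθ-joins-w = by-relation 11 (∂ (∂ (∂ e₁)) :+ :- ∂ e₁) (X :* V :^ 7 :+ con (+ 6) :* X :^ 2 :* V :^ 7)
    (con (+ 12) :* X :* V :+ con (+ 12) :* X :* V :^ 3 :+ con (+ 12) :* X :* V :^ 5 :+ con (+ 168) :* X :^ 2 :* V :^ 3 :+ con (+ 120) :* X :^ 2 :* V :^ 5 :+ con (+ 480) :* X :^ 3 :* V :^ 5)
    (≈-trans (diag-joins-θ² w) (+-cong (θ-eval (∂ (∂ e₁)) (θ-eval (∂ e₁) (θ-eval e₁ θ-xw))) (⊖-cong (θ-eval e₁ θ-xw))))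
    refl

  e₂ e₃ xu xu′ xu″ : Polynomial 2
  e₂ = V :* (X :* V :^ 3)
  e₃ = V :* (X :* e₂)
  xu = X :* V
  xu′ = ∂ xu
  xu″ = ∂ xu′

  diag-w2 : diag w2 ≈ ⟪ e₂ ⟫
  diag-w2 = ≈-trans (diag-⊛ u (joins w)) (*-congˡ u diag-joins-w)

  w1-closed : w1 ≈ ⟪ e₃ ⟫
  w1-closed = *-congˡ u (*-congˡ x diag-w2)

  θ-leibniz : ∀ {a b c d} → θ a ≈ b → θ c ≈ d → θ (a ⊛ c) ≈ (b ⊛ c) ⊕ (a ⊛ d)
  θ-leibniz {a} {b} {c} p q = ≈-trans (θ-⊛ a c) (+-cong (*-congʳ c p) (*-congˡ a q))

  -- In the application a is `joins w k`, the only part depending on k. The Leibniz rule isolates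
  -- it, so that `diag` over k needs just the sums of `joins w` with weights 1, m and m².
  θ-xu⊛ : ∀ a → θ (θ (x ⊛ (u ⊛ a))) ⊕ (⊖ θ (x ⊛ (u ⊛ a))) ≈
    (⟪ xu″ :+ :- xu′ ⟫ ⊛ a) ⊕ ((⟪ con (+ 2) :* xu′ :+ :- xu ⟫ ⊛ θ a) ⊕ (⟪ xu ⟫ ⊛ θ (θ a)))
  θ-xu⊛ a = begin
    θ (θ (x ⊛ (u ⊛ a))) ⊕ (⊖ θ (x ⊛ (u ⊛ a)))
      ≈⟨ +-cong (≈-trans (θ-cong first) second) (⊖-cong first) ⟩
    (((⟪ xu″ ⟫ ⊛ a) ⊕ (⟪ xu′ ⟫ ⊛ θ a)) ⊕ ((⟪ xu′ ⟫ ⊛ θ a) ⊕ (⟪ xu ⟫ ⊛ θ (θ a)))) ⊕ (⊖ ((⟪ xu′ ⟫ ⊛ a) ⊕ (⟪ xu ⟫ ⊛ θ a)))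
      ≈⟨ solve 6 (λ a b c g h k → ((k :* a :+ h :* b) :+ (h :* b :+ g :* c)) :+ :- (h :* a :+ g :* b)
                    := (k :+ :- h) :* a :+ ((con (+ 2) :* h :+ :- g) :* b :+ g :* c)) ≈-refl
           a (θ a) (θ (θ a)) ⟪ xu ⟫ ⟪ xu′ ⟫ ⟪ xu″ ⟫ ⟩
    (⟪ xu″ :+ :- xu′ ⟫ ⊛ a) ⊕ ((⟪ con (+ 2) :* xu′ :+ :- xu ⟫ ⊛ θ a) ⊕ (⟪ xu ⟫ ⊛ θ (θ a))) ∎
    where
    open ≈-Reasoning
    first : θ (x ⊛ (u ⊛ a)) ≈ (⟪ xu′ ⟫ ⊛ a) ⊕ (⟪ xu ⟫ ⊛ θ a)
    first = ≈-trans (θ-cong (≈-sym (⊛-assoc x u a))) (θ-leibniz {⟪ xu ⟫} (θ-⟪⟫ xu) ≈-refl)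
    second : θ ((⟪ xu′ ⟫ ⊛ a) ⊕ (⟪ xu ⟫ ⊛ θ a)) ≈
      ((⟪ xu″ ⟫ ⊛ a) ⊕ (⟪ xu′ ⟫ ⊛ θ a)) ⊕ ((⟪ xu′ ⟫ ⊛ θ a) ⊕ (⟪ xu ⟫ ⊛ θ (θ a)))
    second = ≈-trans (θ-⊕ _ _) (+-cong (θ-leibniz {⟪ xu′ ⟫} (θ-⟪⟫ xu′) ≈-refl) (θ-leibniz {⟪ xu ⟫} (θ-⟪⟫ xu) ≈-refl))

  -- Two polygons are summed out: the inner one by `diag-joins-θ⁰`, the outer one through `θ-xu⊛`.
  -- The factor 2 stays, since `diag-w3` needs the sum twice.
  diag-joins-w2 : const (+ 2) ⊛ diag (λ k → diag (joins (w2 k))) ≈ ⟪ con (+ 6) :* X :^ 2 :* V :^ 8 :+ con (+ 6) :* X :^ 3 :* V :^ 8 ⟫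
  diag-joins-w2 = begin
    const (+ 2) ⊛ diag (λ k → diag (joins (w2 k)))
      ≈⟨ ≈-sym (diag-⊛ (const (+ 2)) _) ⟩
    diag (λ k → const (+ 2) ⊛ diag (joins (w2 k)))
      ≈⟨ diag-cong (λ k → ≈-trans (diag-joins-θ⁰ (w2 k)) (θ-xu⊛ (joins w k))) ⟩
    diag (λ k → (⟪ xu″ :+ :- xu′ ⟫ ⊛ joins w k) ⊕
      ((⟪ con (+ 2) :* xu′ :+ :- xu ⟫ ⊛ θ (joins w k)) ⊕ (⟪ xu ⟫ ⊛ θ (θ (joins w k)))))
      ≈⟨ ≈-trans (diag-⊕ _ _) (+-cong (diag-⊛ ⟪ xu″ :+ :- xu′ ⟫ (joins w)) (≈-trans (diag-⊕ _ _)
           (+-cong (diag-⊛ ⟪ con (+ 2) :* xu′ :+ :- xu ⟫ (θ ∘ joins w)) (diag-⊛ ⟪ xu ⟫ (θ ∘ θ ∘ joins w))))) ⟩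
    (⟪ xu″ :+ :- xu′ ⟫ ⊛ diag (joins w)) ⊕
      ((⟪ con (+ 2) :* xu′ :+ :- xu ⟫ ⊛ diag (θ ∘ joins w)) ⊕ (⟪ xu ⟫ ⊛ diag (θ ∘ θ ∘ joins w)))
      ≈⟨ +-cong (*-congˡ ⟪ xu″ :+ :- xu′ ⟫ diag-joins-w)
           (+-cong (*-congˡ ⟪ con (+ 2) :* xu′ :+ :- xu ⟫ diag-θ-joins-w) (*-congˡ ⟪ xu ⟫ diag-θθ-joins-w)) ⟩
    ⟪ p ⟫
      ≈⟨ modulo-relation p (con (+ 6) :* X :^ 2 :* V :^ 8 :+ con (+ 6) :* X :^ 3 :* V :^ 8)
           (con (+ 2) :* X :^ 2 :* V :^ 4 :+ con (+ 5) :* X :^ 2 :* V :^ 6 :+ con (+ 12) :* X :^ 3 :* V :^ 6)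
           refl ⟩
    ⟪ con (+ 6) :* X :^ 2 :* V :^ 8 :+ con (+ 6) :* X :^ 3 :* V :^ 8 ⟫ ∎
    where
    open ≈-Reasoning
    p : Polynomial 2
    p = (xu″ :+ :- xu′) :* (X :* V :^ 3) :+ ((con (+ 2) :* xu′ :+ :- xu) :* (X :* V :^ 5)
          :+ xu :* (X :* V :^ 7 :+ con (+ 6) :* X :^ 2 :* V :^ 7))

  e₄ : Polynomial 2
  e₄ = V :* (X :* (e₂ :* e₂ :+ e₂ :* e₂) :+ (con (+ 6) :* X :^ 2 :* V :^ 8 :+ con (+ 6) :* X :^ 3 :* V :^ 8))

  diag-w3 : diag (λ k → diag (λ l → w3 l k)) ≈ ⟪ e₄ ⟫
  diag-w3 = begin
    diag (λ k → diag (λ l → w3 l k))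
      ≈⟨ diag-cong (λ k → ≈-trans (diag-⊛ u _) (*-congˡ u (≈-trans (diag-⊕ _ _) (+-cong
           (≈-trans (diag-⊛ x _) (*-congˡ x (≈-trans (diag-⊕ _ _) (+-cong (diag-⊛ (w2 k) w2) (diag-⊛ʳ (w2 k) w2)))))
           (diag-⊕ _ _))))) ⟩
    diag (λ k → u ⊛ ((x ⊛ ((w2 k ⊛ diag w2) ⊕ (w2 k ⊛ diag w2))) ⊕ (diag (joins (w2 k)) ⊕ diag (λ l → joins (w2 l) k))))
      ≈⟨ ≈-trans (diag-⊛ u _) (*-congˡ u (≈-trans (diag-⊕ _ _) (+-cong
           (≈-trans (diag-⊛ x _) (*-congˡ x (≈-trans (diag-⊕ _ _) (+-cong (diag-⊛ʳ (diag w2) w2) (diag-⊛ʳ (diag w2) w2)))))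
           -- The two join terms of `w3-source` differ by exchanging k and l, so by `diag-diag` they
           -- have the same double sum.
           (≈-trans (diag-⊕ _ _) (+-cong (≈-refl {diag (λ k → diag (joins (w2 k)))}) (diag-diag (λ l k → joins (w2 l) k))))))) ⟩
    u ⊛ ((x ⊛ ((diag w2 ⊛ diag w2) ⊕ (diag w2 ⊛ diag w2))) ⊕
         (diag (λ k → diag (joins (w2 k))) ⊕ diag (λ k → diag (joins (w2 k)))))
      ≈⟨ *-congˡ u (+-cong (*-congˡ x (+-cong (*-cong diag-w2 diag-w2) (*-cong diag-w2 diag-w2)))
           (≈-trans (solve 1 (λ t → t :+ t := con (+ 2) :* t) ≈-refl _) diag-joins-w2)) ⟩
    ⟪ e₄ ⟫ ∎
    where open ≈-Reasoning

  diag-joins-w1 : diag (joins w1) ≈ ⟪ con (+ 15) :* X :^ 3 :* V :^ 9 :+ con (+ 10) :* X :^ 4 :* V :^ 9 ⟫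
  diag-joins-w1 = by-relation 1 (∂ (∂ (X :* e₃)) :+ :- ∂ (X :* e₃)) (con (+ 15) :* X :^ 3 :* V :^ 9 :+ con (+ 10) :* X :^ 4 :* V :^ 9)
    (con (+ 30) :* X :^ 3 :* V :^ 5 :+ con (+ 30) :* X :^ 3 :* V :^ 7 :+ con (+ 140) :* X :^ 4 :* V :^ 7)
    (≈-trans (diag-joins-θ⁰ w1) (+-cong (θ-eval (∂ (X :* e₃)) step) (⊖-cong step)))
    refl
    where
    step : θ (x ⊛ w1) ≈ ⟪ ∂ (X :* e₃) ⟫
    step = θ-eval (X :* e₃) (*-congˡ x w1-closed)

  diag-w11 : diag w11 ≈ ⟪ con (+ 21) :* X :^ 3 :* V :^ 10 :+ con (+ 20) :* X :^ 4 :* V :^ 10 ⟫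
  diag-w11 = begin
    diag w11
      ≈⟨ ≈-trans (diag-⊛ u _) (*-congˡ u (≈-trans (diag-⊕ _ _) (+-cong
           (≈-trans (diag-⊕ _ _) (+-cong (diag-⊛ x _)
             (≈-trans (diag-⊛ x _) (*-congˡ x (≈-trans (diag-⊕ _ _) (+-cong (diag-⊛ʳ w1 w2) (diag-⊛ w1 w2)))))))
           (≈-refl {diag (joins w1)})))) ⟩
    u ⊛ (((x ⊛ diag (λ k → diag (λ l → w3 l k))) ⊕ (x ⊛ ((w1 ⊛ diag w2) ⊕ (w1 ⊛ diag w2)))) ⊕ diag (joins w1))
      ≈⟨ *-congˡ u (+-cong (+-cong (*-congˡ x diag-w3)
           (*-congˡ x (+-cong (*-cong w1-closed diag-w2) (*-cong w1-closed diag-w2)))) diag-joins-w1) ⟩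
    ⟪ V :* ((X :* e₄ :+ X :* (e₃ :* e₂ :+ e₃ :* e₂)) :+ (con (+ 15) :* X :^ 3 :* V :^ 9 :+ con (+ 10) :* X :^ 4 :* V :^ 9)) ⟫
      ≈⟨ equal-polynomials (V :* ((X :* e₄ :+ X :* (e₃ :* e₂ :+ e₃ :* e₂)) :+ (con (+ 15) :* X :^ 3 :* V :^ 9 :+ con (+ 10) :* X :^ 4 :* V :^ 9)))
                 (con (+ 21) :* X :^ 3 :* V :^ 10 :+ con (+ 20) :* X :^ 4 :* V :^ 10) refl ⟩
    ⟪ con (+ 21) :* X :^ 3 :* V :^ 10 :+ con (+ 20) :* X :^ 4 :* V :^ 10 ⟫ ∎
    where open ≈-Reasoning

  -- Coefficients of the closed form

  f₁ f₂ f₃ : Polynomial 2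
  f₁ = con (+ 6) :* V :^ 2 :+ con (+ 104) :* X :* V :^ 4
  f₂ = con (- + 24) :* V :^ 2 :+ con (- + 160) :* X :* V :^ 4 :+ con (+ 1664) :* X :^ 2 :* V :^ 6
  f₃ = con (+ 48) :* V :^ 2 :+ con (- + 192) :* X :* V :^ 4 :+ con (+ 768) :* X :^ 2 :* V :^ 6 :+ con (+ 39936) :* X :^ 3 :* V :^ 8

  -- The operator c θ + d multiplies coefficient n by c n + d; s collects the factors already
  -- applied to u².
  θ-const-⊕ : ∀ c d p q {a} (s : ℕ → ℤ) → (∀ n → a n ≡ s n * (u ⊛ u) n) → a ≈ ⟪ p ⟫ → ⟪ con c :* ∂ p :+ con d :* p ⟫ ≈ ⟪ q ⟫ →
    (λ n → (c * + n + d) * s n * (u ⊛ u) n) ≈ ⟪ q ⟫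
  θ-const-⊕ c d p q {a} s eq ap pq = ≈-trans
    (λ n → trans (trans (regroup c (+ n) d (s n) _) (cong (λ t → c * (+ n * t) + d * t) (sym (eq n))))
                 (sym (cong₂ _+_ (const-⊛ c (θ a) n) (const-⊛ d a n))))
    (≈-trans (+-cong (*-congˡ (const c) (θ-eval p ap)) (*-congˡ (const d) ap)) pq)
    where
    regroup : ∀ c n d s v → (c * n + d) * s * v ≡ c * (n * (s * v)) + d * (s * v)
    regroup = solve-∀

  -- `f₁`, `f₂`, `f₃` are the images of u² under 13 θ + 6, then θ - 4, then θ - 2. Only the last
  -- factor θ requires `relation`, to raise all terms to the power u¹⁰.
  diag-w11-θ : ∀ n → (1ℤ * + n + 0ℤ) * ((1ℤ * + n + - + 2) * ((1ℤ * + n + - + 4) * ((+ 13 * + n + + 6) * 1ℤ))) * (u ⊛ u) n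
    ≡ + 12288 * diag w11 n
  diag-w11-θ n = trans
    (θ-const-⊕ 1ℤ 0ℤ f₃ f₄ s₃ (λ n → refl)
      (θ-const-⊕ 1ℤ (- + 2) f₂ f₃ s₂ (λ n → refl)
        (θ-const-⊕ 1ℤ (- + 4) f₁ f₂ s₁ (λ n → refl)
          (θ-const-⊕ (+ 13) (+ 6) (V :* V) f₁ (λ _ → 1ℤ) (λ n → sym (ℤₚ.*-identityˡ _)) ≈-refl
            (equal-polynomials (con (+ 13) :* ∂ (V :* V) :+ con (+ 6) :* (V :* V)) f₁ refl))
          (equal-polynomials (con 1ℤ :* ∂ f₁ :+ con (- + 4) :* f₁) f₂ refl))
        (equal-polynomials (con 1ℤ :* ∂ f₂ :+ con (- + 2) :* f₂) f₃ refl))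
      (modulo-relation (con 1ℤ :* ∂ f₃ :+ con 0ℤ :* f₃) f₄ (con (+ 258048) :* X :^ 3 :* V :^ 8) refl) n)
    (trans (sym (*-congˡ (const (+ 12288)) diag-w11 n)) (const-⊛ (+ 12288) (diag w11) n))
    where
    s₁ s₂ s₃ : ℕ → ℤ
    s₁ n = (+ 13 * + n + + 6) * 1ℤ
    s₂ n = (1ℤ * + n + - + 4) * s₁ n
    s₃ n = (1ℤ * + n + - + 2) * s₂ n
    f₄ : Polynomial 2
    f₄ = con (+ 12288) :* (con (+ 21) :* X :^ 3 :* V :^ 10 :+ con (+ 20) :* X :^ 4 :* V :^ 10)

  u²-eq : u ⊛ u ≈ const 1ℤ ⊕ (const (+ 4) ⊛ (x ⊛ (u ⊛ u)))
  u²-eq = modulo (⊖ const 1ℤ) (≈-sym u-square)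
    (solve 2 (λ x u → u :* u :+ :- con 1ℤ :* con 0ℤ := (con 1ℤ :+ con (+ 4) :* (x :* (u :* u)))
       :+ :- con 1ℤ :* (con 1ℤ :+ :- (u :* u) :+ con (+ 4) :* x :* (u :* u))) ≈-refl x u)

  u²-even : ∀ N → (u ⊛ u) (N ℕ.+ N) ≡ + (4 ℕ.^ N)
  u²-even zero    = trans (u²-eq 0) (cong (_+_ 1ℤ) (trans (const-⊛ (+ 4) _ 0) (cong (_*_ (+ 4)) (x-⊛-0 (u ⊛ u)))))
  u²-even (suc N) = begin
    (u ⊛ u) (suc N ℕ.+ suc N)
      ≡⟨ cong (λ t → (u ⊛ u) (suc t)) (ℕₚ.+-suc N N) ⟩
    (u ⊛ u) (suc (suc (N ℕ.+ N)))
      ≡⟨ trans (u²-eq (suc (suc (N ℕ.+ N)))) (ℤₚ.+-identityˡ _) ⟩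
    (const (+ 4) ⊛ (x ⊛ (u ⊛ u))) (suc (suc (N ℕ.+ N)))
      ≡⟨ trans (const-⊛ (+ 4) _ (suc (suc (N ℕ.+ N)))) (cong (_*_ (+ 4)) (x-⊛-2+ (u ⊛ u) (N ℕ.+ N))) ⟩
    + 4 * (u ⊛ u) (N ℕ.+ N)
      ≡⟨ cong (_*_ (+ 4)) (u²-even N) ⟩
    + 4 * + (4 ℕ.^ N)
      ≡⟨ sym (ℤₚ.pos-* 4 (4 ℕ.^ N)) ⟩
    + (4 ℕ.^ suc N) ∎
    where open ≡-Reasoning

  diag-w11-even : ∀ N → + 768 * diag w11 (N ℕ.+ N) ≡ + (4 ℕ.^ N) * (+ N * (+ N + - + 1) * (+ N + - + 2) * (+ 13 * + N + + 3))
  diag-w11-even N = ℤₚ.*-cancelˡ-≡ (+ 16) _ _ (begin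
    + 16 * (+ 768 * diag w11 (N ℕ.+ N))
      ≡⟨ sym (ℤₚ.*-assoc (+ 16) (+ 768) _) ⟩
    + 12288 * diag w11 (N ℕ.+ N)
      ≡⟨ sym (diag-w11-θ (N ℕ.+ N)) ⟩
    _
      ≡⟨ cong (_*_ (factor (+ (N ℕ.+ N)))) (u²-even N) ⟩
    factor (+ N + + N) * + (4 ℕ.^ N)
      ≡⟨ final (+ N) (+ (4 ℕ.^ N)) ⟩
    + 16 * (+ (4 ℕ.^ N) * (+ N * (+ N + - + 1) * (+ N + - + 2) * (+ 13 * + N + + 3))) ∎)
    where
    open ≡-Reasoning
    factor : ℤ → ℤ
    factor n = (1ℤ * n + 0ℤ) * ((1ℤ * n + - + 2) * ((1ℤ * n + - + 4) * ((+ 13 * n + + 6) * 1ℤ)))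
    final : ∀ N v → (1ℤ * (N + N) + 0ℤ) * ((1ℤ * (N + N) + - + 2) * ((1ℤ * (N + N) + - + 4) * ((+ 13 * (N + N) + + 6) * 1ℤ))) * v
      ≡ + 16 * (v * (N * (N + - + 1) * (N + - + 2) * (+ 13 * N + + 3)))
    final = solve-∀

  -- Loop equations

  picks : {A : Set} → List A → List (A × List A)
  picks []       = []
  picks (m ∷ ms) = (m , ms) ∷ map (map₂ (m ∷_)) (picks ms)

  ∑-picks-∷ : {A : Set} (m : A) (ms : List A) (f : A × List A → ℤ) →
    ∑ (picks (m ∷ ms)) f ≡ f (m , ms) + ∑ (picks ms) (λ (l , ls) → f (l , m ∷ ls))
  ∑-picks-∷ m ms f = cong (_+_ (f (m , ms))) (∑-map (map₂ (m ∷_)) (picks ms) f)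

  ∑-picks-cong : ∀ ms {f g : ℕ × List ℕ → ℤ} →
    (∀ l ls → l ℕ.+ sum ls ≡ sum ms → f (l , ls) ≡ g (l , ls)) → ∑ (picks ms) f ≡ ∑ (picks ms) g
  ∑-picks-cong []       eq = refl
  ∑-picks-cong (m ∷ ms) {f} {g} eq = cong₂ _+_ (eq m ms refl)
    (trans (∑-map (map₂ (m ∷_)) (picks ms) f)
      (trans (∑-picks-cong ms (λ l ls e → eq l (m ∷ ls) (trans (exchange l m (sum ls)) (cong (m ℕ.+_) e))))
             (sym (∑-map (map₂ (m ∷_)) (picks ms) g))))
    where
    exchange : ∀ l m s → l ℕ.+ (m ℕ.+ s) ≡ m ℕ.+ (l ℕ.+ s)
    exchange = ℕ-solve-∀

  -- Multiplication by the variable that marks joins.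
  shift : (ℕ → ℤ) → ℕ → ℤ
  shift f zero    = 0ℤ
  shift f (suc d) = f d

  [_≡0] : ℕ → ℤ
  [ zero ≡0]  = 1ℤ
  [ suc _ ≡0] = 0ℤ

  -- The numerical shadow of runs below: faces of sizes ms, second polygon of size k (0 once it
  -- is used up), d joins to go, and N at least the number of pairs of sides.
  count : ℕ → List ℕ → ℕ → ℕ → ℤ
  count N       []           zero    d = [ d ≡0]
  count N       []           (suc k) d = 0ℤ
  count N       (zero ∷ ms)  k       d = count N ms k d
  count zero    (suc p ∷ ms) k       d = 0ℤ
  count (suc N) (suc p ∷ ms) k       d =
    ∑ (splits p) (λ (i , j) → count N (i ∷ j ∷ ms) k d) +
    shift (λ e → ∑ (picks ms) (λ (l , ls) → + l * count N (p ℕ.+ pred l ∷ ls) k e) +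
                 + k * count N (p ℕ.+ pred k ∷ ms) 0 e) d

  x-⊛-⊕-suc : ∀ a b c d p → (x ⊛ ((a ⊛ b) ⊕ (c ⊛ d))) (suc p) ≡ ∑ (splits p) (λ (i , j) → a i * b j + c i * d j)
  x-⊛-⊕-suc a b c d p = trans (⊛-distribˡ x (a ⊛ b) (c ⊛ d) (suc p))
    (trans (cong₂ _+_ (x-⊛-suc a b p) (x-⊛-suc c d p)) (sym (∑-+ (splits p) _ _)))

  -- The arc j takes the part of the second face to which the arc i gets connected: a face split and
  -- joined to itself again acquires a handle.
  x-⊛-diag-suc : ∀ G p → (x ⊛ diag G) (suc p) ≡ ∑ (splits p) (λ (i , j) → G j i)
  x-⊛-diag-suc G zero    = trans (x-⊛-1 (diag G)) (sym (∑-splits-zero _))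
  x-⊛-diag-suc G (suc p) = x-⊛-2+ (diag G) p

  loop-0 : ∀ {a} b → a ≈ u ⊛ b → b 0 ≡ 0ℤ → a 0 ≡ 0ℤ
  loop-0 {a} b p b0 = trans (solve-loop b p 0) (cong₂ _+_ (x-⊛-0 _) b0)

  loop-suc : ∀ {a} b → a ≈ u ⊛ b → ∀ p → a (suc p) ≡ ∑ (splits p) (λ (i , j) → w i * a j + a i * w j) + b (suc p)
  loop-suc {a} b eq p = trans (solve-loop b eq (suc p)) (cong₂ _+_ (x-⊛-⊕-suc w a a w p) refl)

  merge : {A : Set} (ys : List A) {f g : A → ℤ} {a b c : ℤ} →
    a ≡ ∑ ys f + b → b ≡ ∑ ys g + c → a ≡ ∑ ys (λ y → f y + g y) + c
  merge ys {f} {g} p q = trans p (trans (cong (_+_ (∑ ys f)) q)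
    (trans (sym (ℤₚ.+-assoc (∑ ys f) (∑ ys g) _)) (cong₂ _+_ (sym (∑-+ ys f g)) refl)))

  -- Recurrences for the coefficients of the connected series

  w-0 : w 0 ≡ 1ℤ
  w-0 = trans (w-eq 0) (cong (_+_ 1ℤ) (x-⊛-0 (w ⊛ w)))

  w-suc : ∀ p → w (suc p) ≡ ∑ (splits p) (λ (i , j) → w i * w j)
  w-suc p = trans (w-eq (suc p)) (trans (ℤₚ.+-identityˡ _) (x-⊛-suc w w p))

  w2-0 : ∀ k → w2 k 0 ≡ 0ℤ
  w2-0 k = loop-0 (joins w k) ≈-refl refl

  w2-suc : ∀ k p → w2 k (suc p) ≡ ∑ (splits p) (λ (i , j) → w i * w2 k j + w2 k i * w j) + + k * w (p ℕ.+ pred k)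
  w2-suc k = loop-suc (joins w k) ≈-refl

  w1-0 : w1 0 ≡ 0ℤ
  w1-0 = loop-0 (x ⊛ diag w2) ≈-refl (x-⊛-0 (diag w2))

  w1-suc : ∀ p → w1 (suc p) ≡ ∑ (splits p) (λ (i , j) → w i * w1 j + w1 i * w j + w2 j i)
  w1-suc p = trans (merge (splits p) (loop-suc (x ⊛ diag w2) ≈-refl p)
    (trans (x-⊛-diag-suc w2 p) (sym (ℤₚ.+-identityʳ _)))) (ℤₚ.+-identityʳ _)

  w3-0 : ∀ l k → w3 l k 0 ≡ 0ℤ
  w3-0 l k = loop-0 (w3-source l k) ≈-refl (cong₂ _+_ (x-⊛-0 _) refl)

  -- After a split both other faces hang on one arc, or each arc carries one of them; otherwise the
  -- root itself joins l or k, and one face remains to be reached.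
  w3-suc : ∀ l k p → w3 l k (suc p) ≡
    ∑ (splits p) (λ (i , j) → (w i * w3 l k j + w3 l k i * w j) + (w2 k i * w2 l j + w2 l i * w2 k j)) +
    (+ l * w2 k (p ℕ.+ pred l) + + k * w2 l (p ℕ.+ pred k))
  w3-suc l k p = merge (splits p) (loop-suc (w3-source l k) ≈-refl p)
    (cong₂ _+_ (x-⊛-⊕-suc (w2 k) (w2 l) (w2 l) (w2 k) p) refl)

  w11-0 : ∀ k → w11 k 0 ≡ 0ℤ
  w11-0 k = loop-0 (w11-source k) ≈-refl (cong₂ _+_ (cong₂ _+_ (x-⊛-0 _) (x-⊛-0 _)) refl)

  -- After a split one arc may carry both polygon and handle, or the two arcs share them, or both
  -- arcs and the polygon form one planar component, which is the term `w3 j k i`. If the root joins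
  -- the polygon, the handle is still to come.
  w11-suc : ∀ k p → w11 k (suc p) ≡
    ∑ (splits p) (λ (i , j) → (w i * w11 k j + w11 k i * w j) + (w3 j k i + (w2 k i * w1 j + w1 i * w2 k j))) +
    + k * w1 (p ℕ.+ pred k)
  w11-suc k p = merge (splits p) (loop-suc (w11-source k) ≈-refl p)
    (cong₂ _+_ (trans (cong₂ _+_ (x-⊛-diag-suc (λ l → w3 l k) p) (x-⊛-⊕-suc (w2 k) w1 w1 (w2 k) p))
                      (sym (∑-+ (splits p) _ _)))
               refl)

  pull-∑ : {B : Set} (ys : List B) (f : B → ℤ) (g h : ℤ) →
    (∑ ys f + g) * h ≡ ∑ ys (λ y → f y * h) + g * h
  pull-∑ ys f g h = trans (ℤₚ.*-distribʳ-+ h (∑ ys f) g) (cong₂ _+_ (sym (∑-*ʳ h ys f)) refl)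

  pull-∑∑ : {A B : Set} (xs : List A) (ys : List B) (f : A → B → ℤ) (g h : A → ℤ) →
    ∑ xs (λ r → (∑ ys (f r) + g r) * h r) ≡ ∑ ys (λ y → ∑ xs (λ r → f r y * h r)) + ∑ xs (λ r → g r * h r)
  pull-∑∑ xs ys f g h = trans (∑-cong xs (λ r → pull-∑ ys (f r) (g r) (h r)))
    (trans (∑-+ xs _ _) (cong₂ _+_ (∑-comm xs ys (λ r y → f r y * h r)) refl))

  -- The values of count for d ≤ 2 joins: every face is glued to itself planarly except for the
  -- few faces involved in the joins.
  planar : List ℕ → ℤ
  planar []       = 1ℤ
  planar (m ∷ ms) = w m * planar ms

  one-join : List ℕ → ℤ
  one-join []       = 0ℤ
  one-join (m ∷ ms) =
    w1 m * planar ms + ∑ (picks ms) (λ (l , ls) → w2 l m * planar ls) + w m * one-join ms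

  linked₁ : ℕ → List ℕ → ℤ
  linked₁ k []       = 0ℤ
  linked₁ k (m ∷ ms) = w2 k m * planar ms + w m * linked₁ k ms

  -- The six terms classify the component of the head face m: polygon and handle; polygon alone;
  -- polygon and a further face l; handle alone; a further face l alone; nothing. The joins not
  -- spent there fall to the remaining faces.
  linked₂ : ℕ → List ℕ → ℤ
  linked₂ k []       = 0ℤ
  linked₂ k (m ∷ ms) =
    w11 k m * planar ms + w2 k m * one-join ms + ∑ (picks ms) (λ (l , ls) → w3 l k m * planar ls) +
    w1 m * linked₁ k ms + ∑ (picks ms) (λ (l , ls) → w2 l m * linked₁ k ls) + w m * linked₂ k ms

  -- Each gluing costs two sides and one unit of N; `fits-split`, `fits-join` and `fits-cross` apply
  -- this to the three kinds of moves.
  cancel-two : ∀ {a b N} → a ≡ suc (suc b) → a ≤ suc N ℕ.+ suc N → b ≤ N ℕ.+ N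
  cancel-two {b = b} {N} refl a≤ = ℕ.s≤s⁻¹ (subst (λ t → suc b ≤ t) (ℕₚ.+-suc N N) (ℕ.s≤s⁻¹ a≤))

  fits-split : ∀ {N p s k} i j → suc (i ℕ.+ j) ≡ p →
    suc p ℕ.+ s ℕ.+ k ≤ suc N ℕ.+ suc N → i ℕ.+ (j ℕ.+ s) ℕ.+ k ≤ N ℕ.+ N
  fits-split {s = s} {k} i j refl = cancel-two (lemma i j s k)
    where
    lemma : ∀ i j s k → 2 ℕ.+ (i ℕ.+ j) ℕ.+ s ℕ.+ k ≡ 2 ℕ.+ (i ℕ.+ (j ℕ.+ s) ℕ.+ k)
    lemma = ℕ-solve-∀

  fits-join : ∀ {N p s k} l t → suc l ℕ.+ t ≡ s →
    suc p ℕ.+ s ℕ.+ k ≤ suc N ℕ.+ suc N → (p ℕ.+ l) ℕ.+ t ℕ.+ k ≤ N ℕ.+ N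
  fits-join {p = p} {k = k} l t refl = cancel-two (lemma p l t k)
    where
    lemma : ∀ p l t k → 1 ℕ.+ p ℕ.+ (1 ℕ.+ l ℕ.+ t) ℕ.+ k ≡ 2 ℕ.+ (p ℕ.+ l ℕ.+ t ℕ.+ k)
    lemma = ℕ-solve-∀

  fits-cross : ∀ {N} p s k →
    suc p ℕ.+ s ℕ.+ suc k ≤ suc N ℕ.+ suc N → (p ℕ.+ k) ℕ.+ s ℕ.+ 0 ≤ N ℕ.+ N
  fits-cross p s k = cancel-two (lemma p s k)
    where
    lemma : ∀ p s k → 1 ℕ.+ p ℕ.+ s ℕ.+ (1 ℕ.+ k) ≡ 2 ℕ.+ (p ℕ.+ k ℕ.+ s ℕ.+ 0)
    lemma = ℕ-solve-∀

  -- For l = 0 the factor `+ l` neutralises the meaningless `pred`, so agreement is required for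
  -- nonempty faces only.
  join-cong : ∀ l (f g : ℕ → ℤ) → (∀ l′ → l ≡ suc l′ → f l′ ≡ g l′) → + l * f (pred l) ≡ + l * g (pred l)
  join-cong zero    f g eq = refl
  join-cong (suc l) f g eq = cong (_*_ (+ suc l)) (eq l refl)

  count-planar : ∀ N ms → sum ms ℕ.+ 0 ≤ N ℕ.+ N → count N ms 0 0 ≡ planar ms
  count-planar N       []           fits = refl
  count-planar N       (zero ∷ ms)  fits =
    trans (count-planar N ms fits) (sym (trans (cong (λ t → t * planar ms) w-0) (ℤₚ.*-identityˡ _)))
  count-planar (suc N) (suc p ∷ ms) fits = begin
    ∑ (splits p) (λ (i , j) → count N (i ∷ j ∷ ms) 0 0) + 0ℤ
      ≡⟨ ℤₚ.+-identityʳ _ ⟩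
    ∑ (splits p) (λ (i , j) → count N (i ∷ j ∷ ms) 0 0)
      ≡⟨ ∑-splits-cong p (λ i j e → trans (count-planar N (i ∷ j ∷ ms) (fits-split i j e fits))
           (sym (ℤₚ.*-assoc (w i) (w j) (planar ms)))) ⟩
    ∑ (splits p) (λ (i , j) → w i * w j * planar ms)
      ≡⟨ trans (∑-*ʳ (planar ms) (splits p) (λ (i , j) → w i * w j)) (cong (λ t → t * planar ms) (sym (w-suc p))) ⟩
    w (suc p) * planar ms ∎
    where open ≡-Reasoning

  regroup₃ : ∀ a b c d → a + (b + d) + c ≡ a + b + c + d
  regroup₃ = solve-∀

  -- The recurrences are substituted for the head face. The sums over `splits p` recombine to
  -- `one-join` of the two arcs, where `w2 j i` is the case that the arcs are joined to each other;
  -- the sources left over are the joins of the root with a face l.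
  one-join-suc : ∀ p ms → one-join (suc p ∷ ms) ≡
    ∑ (splits p) (λ (i , j) → one-join (i ∷ j ∷ ms)) +
    ∑ (picks ms) (λ (l , ls) → + l * planar (p ℕ.+ pred l ∷ ls))
  one-join-suc p ms = begin
    w1 (suc p) * planar ms + ∑ (picks ms) (λ (l , ls) → w2 l (suc p) * planar ls) + w (suc p) * one-join ms
      ≡⟨ cong₂ _+_ (cong₂ _+_
           (trans (cong (λ t → t * planar ms) (w1-suc p)) (sym (∑-*ʳ (planar ms) (splits p) _)))
           (trans (∑-cong (picks ms) (λ (l , ls) → cong (λ t → t * planar ls) (w2-suc l p)))
             (pull-∑∑ (picks ms) (splits p) (λ (l , ls) (i , j) → w i * w2 l j + w2 l i * w j)
                (λ (l , ls) → + l * w (p ℕ.+ pred l)) (λ (l , ls) → planar ls))))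
           (trans (cong (λ t → t * one-join ms) (w-suc p)) (sym (∑-*ʳ (one-join ms) (splits p) _))) ⟩
    ∑ (splits p) A + (∑ (splits p) B + D) + ∑ (splits p) C
      ≡⟨ regroup₃ (∑ (splits p) A) (∑ (splits p) B) (∑ (splits p) C) D ⟩
    ∑ (splits p) A + ∑ (splits p) B + ∑ (splits p) C + D
      ≡⟨ cong₂ _+_ (trans (cong₂ _+_ (sym (∑-+ (splits p) A B)) refl) (sym (∑-+ (splits p) (λ s → A s + B s) C)))
           (∑-cong (picks ms) (λ (l , ls) → ℤₚ.*-assoc (+ l) (w (p ℕ.+ pred l)) (planar ls))) ⟩
    ∑ (splits p) (λ s → A s + B s + C s) + ∑ (picks ms) (λ (l , ls) → + l * planar (p ℕ.+ pred l ∷ ls))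
      ≡⟨ cong₂ _+_ (∑-cong (splits p) (λ (i , j) → sym (expand i j))) refl ⟩
    ∑ (splits p) (λ (i , j) → one-join (i ∷ j ∷ ms)) + ∑ (picks ms) (λ (l , ls) → + l * planar (p ℕ.+ pred l ∷ ls)) ∎
    where
    open ≡-Reasoning
    A B C : ℕ × ℕ → ℤ
    A (i , j) = (w i * w1 j + w1 i * w j + w2 j i) * planar ms
    B (i , j) = ∑ (picks ms) (λ (l , ls) → (w i * w2 l j + w2 l i * w j) * planar ls)
    C (i , j) = w i * w j * one-join ms
    D : ℤ
    D = ∑ (picks ms) (λ (l , ls) → + l * w (p ℕ.+ pred l) * planar ls)
    arrange : ∀ wi wj w1i w1j w2ji Π S₁ S₂ O →
      w1i * (wj * Π) + (w2ji * Π + S₂) + wi * (w1j * Π + S₁ + wj * O) ≡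
      (wi * w1j + w1i * wj + w2ji) * Π + (wi * S₁ + S₂) + wi * wj * O
    arrange = solve-∀
    pointwise : ∀ a b c d e → (a * b + c * d) * e ≡ a * (b * e) + c * (d * e)
    pointwise = solve-∀
    expand : ∀ i j → one-join (i ∷ j ∷ ms) ≡ A (i , j) + B (i , j) + C (i , j)
    expand i j = begin
      one-join (i ∷ j ∷ ms)
        ≡⟨ cong (λ t → w1 i * planar (j ∷ ms) + t + w i * one-join (j ∷ ms)) (∑-picks-∷ j ms (λ (l , ls) → w2 l i * planar ls)) ⟩
      w1 i * (w j * planar ms) + (w2 j i * planar ms + ∑ (picks ms) (λ (l , ls) → w2 l i * (w j * planar ls))) +
        w i * (w1 j * planar ms + ∑ (picks ms) (λ (l , ls) → w2 l j * planar ls) + w j * one-join ms)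
        ≡⟨ arrange (w i) (w j) (w1 i) (w1 j) (w2 j i) (planar ms) _ _ (one-join ms) ⟩
      A (i , j) + (w i * ∑ (picks ms) (λ (l , ls) → w2 l j * planar ls) +
                   ∑ (picks ms) (λ (l , ls) → w2 l i * (w j * planar ls))) + C (i , j)
        ≡⟨ cong (λ t → A (i , j) + t + C (i , j)) (sym (trans
             (∑-cong (picks ms) (λ (l , ls) → pointwise (w i) (w2 l j) (w2 l i) (w j) (planar ls)))
             (trans (∑-+ (picks ms) _ _) (cong₂ _+_ (∑-*ˡ (w i) (picks ms) _) refl)))) ⟩
      A (i , j) + B (i , j) + C (i , j) ∎

  count-one-join : ∀ N ms → sum ms ℕ.+ 0 ≤ N ℕ.+ N → count N ms 0 1 ≡ one-join ms
  count-one-join N       []           fits = refl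
  count-one-join N       (zero ∷ ms)  fits = trans (count-one-join N ms fits) (sym (begin
    w1 0 * planar ms + ∑ (picks ms) (λ (l , ls) → w2 l 0 * planar ls) + w 0 * one-join ms
      ≡⟨ cong₂ _+_ (cong₂ _+_ (cong (λ t → t * planar ms) w1-0)
           (trans (∑-cong (picks ms) (λ (l , ls) → cong (λ t → t * planar ls) (w2-0 l))) (∑-zero (picks ms))))
           (cong (λ t → t * one-join ms) w-0) ⟩
    0ℤ + 1ℤ * one-join ms
      ≡⟨ trans (ℤₚ.+-identityˡ _) (ℤₚ.*-identityˡ _) ⟩
    one-join ms ∎))
    where open ≡-Reasoning
  count-one-join (suc N) (suc p ∷ ms) fits = trans
    (cong₂ _+_
      (∑-splits-cong p (λ i j e → count-one-join N (i ∷ j ∷ ms) (fits-split i j e fits)))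
      (trans (ℤₚ.+-identityʳ _) (∑-picks-cong ms (λ l ls e →
        join-cong l (λ l → count N (p ℕ.+ l ∷ ls) 0 0) (λ l → planar (p ℕ.+ l ∷ ls))
          (λ { l′ refl → count-planar N (p ℕ.+ l′ ∷ ls) (fits-join {p = p} {k = 0} l′ (sum ls) e fits) })))))
    (sym (one-join-suc p ms))

  count-unlinked : ∀ N ms k → count N ms (suc k) 0 ≡ 0ℤ
  count-unlinked N       []           k = refl
  count-unlinked N       (zero ∷ ms)  k = count-unlinked N ms k
  count-unlinked zero    (suc p ∷ ms) k = refl
  count-unlinked (suc N) (suc p ∷ ms) k =
    trans (ℤₚ.+-identityʳ _) (trans (∑-cong (splits p) (λ (i , j) → count-unlinked N (i ∷ j ∷ ms) k)) (∑-zero (splits p)))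

  linked₁-suc : ∀ k p ms → linked₁ k (suc p ∷ ms) ≡
    ∑ (splits p) (λ (i , j) → linked₁ k (i ∷ j ∷ ms)) + + k * planar (p ℕ.+ pred k ∷ ms)
  linked₁-suc k p ms = begin
    w2 k (suc p) * planar ms + w (suc p) * linked₁ k ms
      ≡⟨ cong₂ _+_ (trans (cong (λ t → t * planar ms) (w2-suc k p)) (pull-∑ (splits p) _ _ (planar ms)))
           (trans (cong (λ t → t * linked₁ k ms) (w-suc p)) (sym (∑-*ʳ (linked₁ k ms) (splits p) _))) ⟩
    ∑ (splits p) A + + k * w (p ℕ.+ pred k) * planar ms + ∑ (splits p) B
      ≡⟨ arrange (∑ (splits p) A) (+ k) (w (p ℕ.+ pred k)) (planar ms) (∑ (splits p) B) ⟩
    ∑ (splits p) A + ∑ (splits p) B + + k * planar (p ℕ.+ pred k ∷ ms)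
      ≡⟨ cong₂ _+_ (trans (sym (∑-+ (splits p) A B)) (∑-cong (splits p) (λ (i , j) →
           expand (w i) (w j) (w2 k i) (w2 k j) (planar ms) (linked₁ k ms)))) refl ⟩
    ∑ (splits p) (λ (i , j) → linked₁ k (i ∷ j ∷ ms)) + + k * planar (p ℕ.+ pred k ∷ ms) ∎
    where
    open ≡-Reasoning
    A B : ℕ × ℕ → ℤ
    A (i , j) = (w i * w2 k j + w2 k i * w j) * planar ms
    B (i , j) = w i * w j * linked₁ k ms
    arrange : ∀ a k v Π b → a + k * v * Π + b ≡ a + b + k * (v * Π)
    arrange = solve-∀
    expand : ∀ wi wj vi vj Π L → (wi * vj + vi * wj) * Π + wi * wj * L ≡ vi * (wj * Π) + wi * (vj * Π + wj * L)
    expand = solve-∀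

  count-linked₁ : ∀ N ms k → sum ms ℕ.+ suc k ≤ N ℕ.+ N → count N ms (suc k) 1 ≡ linked₁ (suc k) ms
  count-linked₁ N       []           k fits = refl
  count-linked₁ N       (zero ∷ ms)  k fits = trans (count-linked₁ N ms k fits) (sym (begin
    w2 (suc k) 0 * planar ms + w 0 * linked₁ (suc k) ms
      ≡⟨ cong₂ _+_ (cong (λ t → t * planar ms) (w2-0 (suc k))) (cong (λ t → t * linked₁ (suc k) ms) w-0) ⟩
    0ℤ + 1ℤ * linked₁ (suc k) ms
      ≡⟨ trans (ℤₚ.+-identityˡ _) (ℤₚ.*-identityˡ _) ⟩
    linked₁ (suc k) ms ∎))
    where open ≡-Reasoning
  count-linked₁ (suc N) (suc p ∷ ms) k fits = trans
    (cong₂ _+_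
      (∑-splits-cong p (λ i j e → count-linked₁ N (i ∷ j ∷ ms) k (fits-split i j e fits)))
      (trans (cong₂ _+_
        (trans (∑-cong (picks ms) (λ (l , ls) → trans (cong (_*_ (+ l)) (count-unlinked N (p ℕ.+ pred l ∷ ls) k)) (ℤₚ.*-zeroʳ (+ l))))
               (∑-zero (picks ms)))
        (cong (_*_ (+ suc k)) (count-planar N (p ℕ.+ k ∷ ms) (fits-cross p (sum ms) k fits))))
        (ℤₚ.+-identityˡ _)))
    (sym (linked₁-suc (suc k) p ms))

  ∑-+₆ : {A : Set} (xs : List A) (a b c d e f : A → ℤ) →
    ∑ xs (λ x → a x + b x + c x + d x + e x + f x) ≡ ∑ xs a + ∑ xs b + ∑ xs c + ∑ xs d + ∑ xs e + ∑ xs f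
  ∑-+₆ xs a b c d e f =
    trans (∑-+ xs _ f) (cong₂ _+_ (trans (∑-+ xs _ e) (cong₂ _+_ (trans (∑-+ xs _ d) (cong₂ _+_
      (trans (∑-+ xs _ c) (cong₂ _+_ (∑-+ xs a b) refl)) refl)) refl)) refl)

  ∑-+₅ : {A : Set} (xs : List A) (α β γ : ℤ) (a b c d e : A → ℤ) →
    ∑ xs (λ x → α * a x + β * b x + γ * c x + d x + e x) ≡ α * ∑ xs a + β * ∑ xs b + γ * ∑ xs c + ∑ xs d + ∑ xs e
  ∑-+₅ xs α β γ a b c d e = trans (∑-+ xs _ e) (cong₂ _+_ (trans (∑-+ xs _ d) (cong₂ _+_ (trans (∑-+ xs _ (λ x → γ * c x))
    (cong₂ _+_ (trans (∑-+ xs (λ x → α * a x) (λ x → β * b x)) (cong₂ _+_ (∑-*ˡ α xs a) (∑-*ˡ β xs b))) (∑-*ˡ γ xs c))) refl)) refl)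

  -- The scheme of `one-join-suc`, with A to F for the six terms of `linked₂`. C and E are matched
  -- together, because `linked₁ k (j ∷ ls)` mixes them. In J₁ the part with `+ l` belongs to the
  -- root joining l, and the part with `+ k` to the root joining the polygon, with l reached
  -- afterwards.
  linked₂-suc : ∀ k p ms → linked₂ k (suc p ∷ ms) ≡
    ∑ (splits p) (λ (i , j) → linked₂ k (i ∷ j ∷ ms)) +
    (∑ (picks ms) (λ (l , ls) → + l * linked₁ k (p ℕ.+ pred l ∷ ls)) + + k * one-join (p ℕ.+ pred k ∷ ms))
  linked₂-suc k p ms = begin
    linked₂ k (suc p ∷ ms)
      ≡⟨ cong₂ _+_ (cong₂ _+_ (cong₂ _+_ (cong₂ _+_ (cong₂ _+_
           (trans (cong (λ t → t * planar ms) (w11-suc k p)) (pull-∑ (splits p) _ _ (planar ms)))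
           (trans (cong (λ t → t * one-join ms) (w2-suc k p)) (pull-∑ (splits p) _ _ (one-join ms))))
           (trans (∑-cong (picks ms) (λ (l , ls) → cong (λ t → t * planar ls) (w3-suc l k p)))
             (pull-∑∑ (picks ms) (splits p)
               (λ (l , ls) (i , j) → (w i * w3 l k j + w3 l k i * w j) + (w2 k i * w2 l j + w2 l i * w2 k j))
               (λ (l , ls) → + l * w2 k (p ℕ.+ pred l) + + k * w2 l (p ℕ.+ pred k)) (λ (l , ls) → planar ls))))
           (trans (cong (λ t → t * linked₁ k ms) (w1-suc p)) (sym (∑-*ʳ (linked₁ k ms) (splits p) _))))
           (trans (∑-cong (picks ms) (λ (l , ls) → cong (λ t → t * linked₁ k ls) (w2-suc l p)))
             (pull-∑∑ (picks ms) (splits p) (λ (l , ls) (i , j) → w i * w2 l j + w2 l i * w j)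
               (λ (l , ls) → + l * w (p ℕ.+ pred l)) (λ (l , ls) → linked₁ k ls))))
           (trans (cong (λ t → t * linked₂ k ms) (w-suc p)) (sym (∑-*ʳ (linked₂ k ms) (splits p) _))) ⟩
    (∑ (splits p) A + + k * w1 q * planar ms) + (∑ (splits p) B + + k * w q * one-join ms) +
      (∑ (splits p) C + J₁) + ∑ (splits p) D + (∑ (splits p) E + J₂) + ∑ (splits p) F
      ≡⟨ arrange (∑ (splits p) A) (∑ (splits p) B) (∑ (splits p) C) (∑ (splits p) D) (∑ (splits p) E) (∑ (splits p) F)
           (+ k) (w1 q) (w q) (planar ms) (one-join ms) J₁ J₂ ⟩
    (∑ (splits p) A + ∑ (splits p) B + ∑ (splits p) C + ∑ (splits p) D + ∑ (splits p) E + ∑ (splits p) F) +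
      ((J₁ + J₂) + + k * (w1 q * planar ms + w q * one-join ms))
      ≡⟨ cong₂ _+_ (trans (sym (∑-+₆ (splits p) A B C D E F)) (∑-cong (splits p) (λ (i , j) → sym (expand i j)))) joins-eq ⟩
    ∑ (splits p) (λ (i , j) → linked₂ k (i ∷ j ∷ ms)) +
      (∑ (picks ms) (λ (l , ls) → + l * linked₁ k (p ℕ.+ pred l ∷ ls)) + + k * one-join (p ℕ.+ pred k ∷ ms)) ∎
    where
    open ≡-Reasoning
    q : ℕ
    q = p ℕ.+ pred k
    A B C D E F : ℕ × ℕ → ℤ
    A (i , j) = ((w i * w11 k j + w11 k i * w j) + (w3 j k i + (w2 k i * w1 j + w1 i * w2 k j))) * planar ms
    B (i , j) = (w i * w2 k j + w2 k i * w j) * one-join ms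
    C (i , j) = ∑ (picks ms) (λ (l , ls) →
      ((w i * w3 l k j + w3 l k i * w j) + (w2 k i * w2 l j + w2 l i * w2 k j)) * planar ls)
    D (i , j) = (w i * w1 j + w1 i * w j + w2 j i) * linked₁ k ms
    E (i , j) = ∑ (picks ms) (λ (l , ls) → (w i * w2 l j + w2 l i * w j) * linked₁ k ls)
    F (i , j) = w i * w j * linked₂ k ms
    J₁ J₂ : ℤ
    J₁ = ∑ (picks ms) (λ (l , ls) → (+ l * w2 k (p ℕ.+ pred l) + + k * w2 l q) * planar ls)
    J₂ = ∑ (picks ms) (λ (l , ls) → + l * w (p ℕ.+ pred l) * linked₁ k ls)
    arrange : ∀ a b c d e f k v₁ v Π O j₁ j₂ →
      (a + k * v₁ * Π) + (b + k * v * O) + (c + j₁) + d + (e + j₂) + f ≡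
      (a + b + c + d + e + f) + ((j₁ + j₂) + k * (v₁ * Π + v * O))
    arrange = solve-∀
    joins-pointwise : ∀ l a k b Π c L → (l * a + k * b) * Π + l * c * L ≡ l * (a * Π + c * L) + k * (b * Π)
    joins-pointwise = solve-∀
    joins-arrange : ∀ s k t a b → (s + k * t) + k * (a + b) ≡ s + k * (a + t + b)
    joins-arrange = solve-∀
    joins-eq : (J₁ + J₂) + + k * (w1 q * planar ms + w q * one-join ms) ≡
      ∑ (picks ms) (λ (l , ls) → + l * linked₁ k (p ℕ.+ pred l ∷ ls)) + + k * one-join (q ∷ ms)
    joins-eq = trans (cong₂ _+_ (trans (sym (∑-+ (picks ms) _ _)) (trans
        (∑-cong (picks ms) (λ (l , ls) → joins-pointwise (+ l) (w2 k (p ℕ.+ pred l)) (+ k) (w2 l q) (planar ls) (w (p ℕ.+ pred l)) (linked₁ k ls)))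
        (trans (∑-+ (picks ms) P₁ (λ s → + k * P₂ s)) (cong (_+_ (∑ (picks ms) P₁)) (∑-*ˡ (+ k) (picks ms) P₂))))) refl)
      (joins-arrange (∑ (picks ms) P₁) (+ k) (∑ (picks ms) P₂) (w1 q * planar ms) (w q * one-join ms))
      where
      P₁ P₂ : ℕ × List ℕ → ℤ
      P₁ (l , ls) = + l * linked₁ k (p ℕ.+ pred l ∷ ls)
      P₂ (l , ls) = w2 l q * planar ls
    S₁ S₂ S₃ S₄ S₅ : ℕ × ℕ → ℤ
    S₁ (i , j) = ∑ (picks ms) (λ (l , ls) → w3 l k j * planar ls)
    S₂ (i , j) = ∑ (picks ms) (λ (l , ls) → w3 l k i * (w j * planar ls))
    S₃ (i , j) = ∑ (picks ms) (λ (l , ls) → w2 l j * planar ls)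
    S₄ (i , j) = ∑ (picks ms) (λ (l , ls) → w2 l i * (w2 k j * planar ls + w j * linked₁ k ls))
    S₅ (i , j) = ∑ (picks ms) (λ (l , ls) → w2 l j * linked₁ k ls)
    regroup : ∀ wi wj w1i w1j vi vj w11i w11j w3ji w2ji Π O L L₂ s₁ s₂ s₃ s₄ s₅ →
      w11i * (wj * Π) + vi * (w1j * Π + s₃ + wj * O) + (w3ji * Π + s₂) + w1i * (vj * Π + wj * L) +
        (w2ji * L + s₄) + wi * (w11j * Π + vj * O + s₁ + w1j * L + s₅ + wj * L₂) ≡
      ((wi * w11j + w11i * wj) + (w3ji + (vi * w1j + w1i * vj))) * Π + (wi * vj + vi * wj) * O +
        (wi * s₁ + vi * s₃ + wi * s₅ + s₂ + s₄) + (wi * w1j + w1i * wj + w2ji) * L + wi * wj * L₂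
    regroup = solve-∀
    pointwise : ∀ wi wj vi vj a b c d Π L →
      ((wi * a + b * wj) + (vi * c + d * vj)) * Π + (wi * c + d * wj) * L ≡
      wi * (a * Π) + vi * (c * Π) + wi * (c * L) + b * (wj * Π) + d * (vj * Π + wj * L)
    pointwise = solve-∀
    swap-last : ∀ a b c e d f → a + b + (c + e) + d + f ≡ a + b + c + d + e + f
    swap-last = solve-∀
    sums : ∀ i j → w i * S₁ (i , j) + w2 k i * S₃ (i , j) + w i * S₅ (i , j) + S₂ (i , j) + S₄ (i , j) ≡ C (i , j) + E (i , j)
    sums i j = sym (trans (sym (∑-+ (picks ms) _ _)) (trans
      (∑-cong (picks ms) (λ (l , ls) → pointwise (w i) (w j) (w2 k i) (w2 k j) (w3 l k j) (w3 l k i) (w2 l j) (w2 l i) (planar ls) (linked₁ k ls)))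
      (∑-+₅ (picks ms) (w i) (w2 k i) (w i) _ _ _ _ _)))
    expand : ∀ i j → linked₂ k (i ∷ j ∷ ms) ≡ A (i , j) + B (i , j) + C (i , j) + D (i , j) + E (i , j) + F (i , j)
    expand i j = begin
      linked₂ k (i ∷ j ∷ ms)
        ≡⟨ cong₂ (λ s t → w11 k i * planar (j ∷ ms) + w2 k i * one-join (j ∷ ms) + s + w1 i * linked₁ k (j ∷ ms) + t + w i * linked₂ k (j ∷ ms))
             (∑-picks-∷ j ms (λ (l , ls) → w3 l k i * planar ls)) (∑-picks-∷ j ms (λ (l , ls) → w2 l i * linked₁ k ls)) ⟩
      w11 k i * (w j * planar ms) + w2 k i * (w1 j * planar ms + S₃ (i , j) + w j * one-join ms) +
        (w3 j k i * planar ms + S₂ (i , j)) + w1 i * (w2 k j * planar ms + w j * linked₁ k ms) +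
        (w2 j i * linked₁ k ms + S₄ (i , j)) +
        w i * (w11 k j * planar ms + w2 k j * one-join ms + S₁ (i , j) + w1 j * linked₁ k ms + S₅ (i , j) + w j * linked₂ k ms)
        ≡⟨ regroup (w i) (w j) (w1 i) (w1 j) (w2 k i) (w2 k j) (w11 k i) (w11 k j) (w3 j k i) (w2 j i) (planar ms)
             (one-join ms) (linked₁ k ms) (linked₂ k ms) (S₁ (i , j)) (S₂ (i , j)) (S₃ (i , j)) (S₄ (i , j)) (S₅ (i , j)) ⟩
      A (i , j) + B (i , j) +
        (w i * S₁ (i , j) + w2 k i * S₃ (i , j) + w i * S₅ (i , j) + S₂ (i , j) + S₄ (i , j)) + D (i , j) + F (i , j)
        ≡⟨ cong (λ t → A (i , j) + B (i , j) + t + D (i , j) + F (i , j)) (sums i j) ⟩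
      A (i , j) + B (i , j) + (C (i , j) + E (i , j)) + D (i , j) + F (i , j)
        ≡⟨ swap-last (A (i , j)) (B (i , j)) (C (i , j)) (E (i , j)) (D (i , j)) (F (i , j)) ⟩
      A (i , j) + B (i , j) + C (i , j) + D (i , j) + E (i , j) + F (i , j) ∎

  count-linked₂ : ∀ N ms k → sum ms ℕ.+ suc k ≤ N ℕ.+ N → count N ms (suc k) 2 ≡ linked₂ (suc k) ms
  count-linked₂ N       []           k fits = refl
  count-linked₂ N       (zero ∷ ms)  k fits = trans (count-linked₂ N ms k fits) (sym (begin
    linked₂ (suc k) (0 ∷ ms)
      ≡⟨ cong₂ _+_ (cong₂ _+_ (cong₂ _+_ (cong₂ _+_ (cong₂ _+_
           (cong (λ t → t * planar ms) (w11-0 (suc k))) (cong (λ t → t * one-join ms) (w2-0 (suc k))))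
           (trans (∑-cong (picks ms) (λ (l , ls) → cong (λ t → t * planar ls) (w3-0 l (suc k)))) (∑-zero (picks ms))))
           (cong (λ t → t * linked₁ (suc k) ms) w1-0))
           (trans (∑-cong (picks ms) (λ (l , ls) → cong (λ t → t * linked₁ (suc k) ls) (w2-0 l))) (∑-zero (picks ms))))
           (cong (λ t → t * linked₂ (suc k) ms) w-0) ⟩
    0ℤ + 1ℤ * linked₂ (suc k) ms
      ≡⟨ trans (ℤₚ.+-identityˡ _) (ℤₚ.*-identityˡ _) ⟩
    linked₂ (suc k) ms ∎))
    where open ≡-Reasoning
  count-linked₂ (suc N) (suc p ∷ ms) k fits = trans
    (cong₂ _+_
      (∑-splits-cong p (λ i j e → count-linked₂ N (i ∷ j ∷ ms) k (fits-split i j e fits)))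
      (cong₂ _+_ (∑-picks-cong ms (λ l ls e →
        join-cong l (λ l → count N (p ℕ.+ l ∷ ls) (suc k) 1) (λ l → linked₁ (suc k) (p ℕ.+ l ∷ ls))
          (λ { l′ refl → count-linked₁ N (p ℕ.+ l′ ∷ ls) k (fits-join {p = p} {k = suc k} l′ (sum ls) e fits) })))
        (cong (_*_ (+ suc k)) (count-one-join N (p ℕ.+ k ∷ ms) (fits-cross p (sum ms) k fits)))))
    (sym (linked₂-suc (suc k) p ms))

  linked₂-[] : ∀ k m → linked₂ k (m ∷ []) ≡ w11 k m
  linked₂-[] k m = lemma (w11 k m) (w2 k m) (w1 m) (w m)
    where
    lemma : ∀ a b c d → a * 1ℤ + b * 0ℤ + 0ℤ + c * 0ℤ + 0ℤ + d * 0ℤ ≡ a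
    lemma = solve-∀

  -- Gluing one pair of sides at a time

  module ↭Solver = CommutativeMonoidSolver (Permₚ.++-commutativeMonoid {A = ℕ})
  open ↭Solver using () renaming (solve to label-solve; _⊕_ to _⊙_; _⊜_ to _≜_; id to ε)

  ⟨_⟩ : Bool → ℤ
  ⟨ true ⟩  = 1ℤ
  ⟨ false ⟩ = 0ℤ

  ≡ᵇ-refl : ∀ m → (m ≡ᵇ m) ≡ true
  ≡ᵇ-refl zero    = refl
  ≡ᵇ-refl (suc m) = ≡ᵇ-refl m

  ≡ᵇ-≢ : ∀ {m n} → m ≢ n → (m ≡ᵇ n) ≡ false
  ≡ᵇ-≢ {zero}  {zero}  m≢n = ⊥-elim (m≢n refl)
  ≡ᵇ-≢ {zero}  {suc n} m≢n = refl
  ≡ᵇ-≢ {suc m} {zero}  m≢n = refl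
  ≡ᵇ-≢ {suc m} {suc n} m≢n = ≡ᵇ-≢ (m≢n ∘ cong suc)

  ∑-cong-∈ : {A : Set} (xs : List A) {f g : A → ℤ} → (∀ {x} → x ∈ xs → f x ≡ g x) → ∑ xs f ≡ ∑ xs g
  ∑-cong-∈ []       eq = refl
  ∑-cong-∈ (x ∷ xs) eq = cong₂ _+_ (eq (here refl)) (∑-cong-∈ xs (eq ∘ there))

  ∑-absent : {A : Set} (key : A → ℕ) (xs : List A) (g : A → ℤ) {k : ℕ} →
    All (λ y → k ≢ y) (map key xs) → ∑ xs (λ x → ⟨ k ≡ᵇ key x ⟩ * g x) ≡ 0ℤ
  ∑-absent key []       g []          = refl
  ∑-absent key (x ∷ xs) g (k≢ ∷ rest) rewrite ≡ᵇ-≢ k≢ =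
    trans (ℤₚ.+-identityˡ _) (∑-absent key xs g rest)

  ∑-single : {A : Set} (key : A → ℕ) (xs : List A) (g : A → ℤ) {y : A} → y ∈ xs → Unique (map key xs) →
    ∑ xs (λ x → ⟨ key y ≡ᵇ key x ⟩ * g x) ≡ g y
  ∑-single key (x ∷ xs) g (here refl) (x∉ ∷ unique) rewrite ≡ᵇ-refl (key x) =
    trans (cong₂ _+_ (ℤₚ.*-identityˡ (g x)) (∑-absent key xs g x∉)) (ℤₚ.+-identityʳ (g x))
  ∑-single key (x ∷ xs) g {y} (there y∈) (x∉ ∷ unique)
    rewrite ≡ᵇ-≢ {key y} {key x} (λ e → All.lookup x∉ (∈-map⁺ key y∈) (sym e)) =
    trans (ℤₚ.+-identityˡ _) (∑-single key xs g y∈ unique)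

  cuts : List ℕ → List (List ℕ × ℕ × List ℕ)
  cuts []       = []
  cuts (x ∷ xs) = ([] , x , xs) ∷ map (map₁ (x ∷_)) (cuts xs)

  Move : Set
  Move = ℕ × Bool × List (List ℕ) × List ℕ

  -- The current face is a ∷ P, the other faces reached so far are S, and K is the second polygon
  -- as long as it is not glued to the first one ([] afterwards).
  -- A move glues a to b, and is flagged if it joins two faces.
  moves : List ℕ → List (List ℕ) → List ℕ → List Move
  moves P S K =
    map (λ (X , b , Y) → b , false , X ∷ Y ∷ S , K) (cuts P) ++
    concatMap (λ (F , R) → map (λ (X , b , Y) → b , true , (P ++ Y ++ X) ∷ R , K) (cuts F)) (picks S) ++
    map (λ (X , b , Y) → b , true , (P ++ Y ++ X) ∷ S , []) (cuts K)

  delay : Bool → (ℕ → ℤ) → ℕ → ℤ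
  delay false f = f
  delay true  f = shift f

  -- 1 if gluing along the involution f starting from the faces S and K joins faces exactly d
  -- times and uses up K, otherwise 0.
  runs : ℕ → List (List ℕ) → List ℕ → (ℕ → ℕ) → ℕ → ℤ
  runs N       []            []      f d = [ d ≡0]
  runs N       []            (_ ∷ _) f d = 0ℤ
  runs N       ([] ∷ S)      K       f d = runs N S K f d
  runs zero    ((a ∷ P) ∷ S) K       f d = 0ℤ
  runs (suc N) ((a ∷ P) ∷ S) K       f d =
    ∑ (moves P S K) (λ (b , c , S′ , K′) → ⟨ f a ≡ᵇ b ⟩ * (⟨ f b ≡ᵇ a ⟩ * delay c (runs N S′ K′ f) d))

  -- The other face is opened at b: its sides following b cyclically are Y ++ X, and they are
  -- inserted where a was. For `join` a permutation of S suffices, as the order of the faces affects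
  -- neither labels nor boundaries as multisets.
  data IsMove (P : List ℕ) (S : List (List ℕ)) (K : List ℕ) : Move → Set where
    split : ∀ X b Y → P ≡ X ++ b ∷ Y → IsMove P S K (b , false , X ∷ Y ∷ S , K)
    join  : ∀ X b Y R → S ↭ (X ++ b ∷ Y) ∷ R → IsMove P S K (b , true , (P ++ Y ++ X) ∷ R , K)
    cross : ∀ X b Y → K ≡ X ++ b ∷ Y → IsMove P S K (b , true , (P ++ Y ++ X) ∷ S , [])

  ∈-cuts : ∀ {X b Y} P → (X , b , Y) ∈ cuts P → P ≡ X ++ b ∷ Y
  ∈-cuts (x ∷ P) (here refl) = refl
  ∈-cuts (x ∷ P) (there i) with ∈-map⁻ (map₁ (x ∷_)) i
  ... | (X , b , Y) , j , refl = cong (x ∷_) (∈-cuts P j)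

  ∈-picks : {A : Set} {F : A} {R : List A} (S : List A) → (F , R) ∈ picks S → S ↭ F ∷ R
  ∈-picks (x ∷ S) (here refl) = ↭-refl
  ∈-picks (x ∷ S) (there i) with ∈-map⁻ (map₂ (x ∷_)) i
  ... | (F , R) , j , refl = ↭-trans (↭-prep x (∈-picks S j)) (↭-swap x F ↭-refl)

  ∈-moves : ∀ P S K {y} → y ∈ moves P S K → IsMove P S K y
  ∈-moves P S K i with ∈-++⁻ (map (λ (X , b , Y) → b , false , X ∷ Y ∷ S , K) (cuts P)) i
  ... | inj₁ i₁ with ∈-map⁻ _ i₁
  ...   | (X , b , Y) , j , refl = split X b Y (∈-cuts P j)
  ∈-moves P S K i | inj₂ i₂
    with ∈-++⁻ (concatMap (λ (F , R) → map (λ (X , b , Y) → b , true , (P ++ Y ++ X) ∷ R , K) (cuts F)) (picks S)) i₂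
  ... | inj₂ i₄ with ∈-map⁻ _ i₄
  ...   | (X , b , Y) , j , refl = cross X b Y (∈-cuts K j)
  ∈-moves P S K i | inj₂ i₂ | inj₁ i₃
    with find (∈-concatMap⁻ (λ (F , R) → map (λ (X , b , Y) → b , true , (P ++ Y ++ X) ∷ R , K) (cuts F)) {xs = picks S} i₃)
  ... | (F , R) , j , k with ∈-map⁻ _ k
  ...   | (X , b , Y) , l , refl with ∈-cuts F l
  ...     | refl = join X b Y R (∈-picks S j)

  concat-↭ : {A : Set} {S R : List (List A)} → S ↭ R → concat S ↭ concat R
  concat-↭ Perm.refl         = ↭-refl
  concat-↭ (Perm.prep x p)   = Permₚ.++⁺ˡ x (concat-↭ p)
  concat-↭ (Perm.swap x y p) = ↭-trans (Permₚ.++⁺ˡ x (Permₚ.++⁺ˡ y (concat-↭ p))) (Permₚ.shifts x y)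
  concat-↭ (Perm.trans p q)  = ↭-trans (concat-↭ p) (concat-↭ q)

  move-labels : ∀ {P S K b c S′ K′} → IsMove P S K (b , c , S′ , K′) →
    P ++ concat S ++ K ↭ b ∷ concat S′ ++ K′
  move-labels {S = S} {K} (split X b Y refl) =
    label-solve 5 (λ x b y s k → (x ⊙ b ⊙ y) ⊙ s ⊙ k ≜ b ⊙ (x ⊙ y ⊙ s) ⊙ k) ↭-refl X (b ∷ []) Y (concat S) K
  move-labels {P} {S} {K} (join X b Y R p) = ↭-trans (Permₚ.++⁺ˡ P (Permₚ.++⁺ʳ K (concat-↭ p)))
    (label-solve 6 (λ p x b y r k → p ⊙ ((x ⊙ b ⊙ y) ⊙ r) ⊙ k ≜ b ⊙ ((p ⊙ y ⊙ x) ⊙ r) ⊙ k) ↭-refl P X (b ∷ []) Y (concat R) K)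
  move-labels {P} {S} {K} (cross X b Y refl) =
    label-solve 5 (λ p x b y s → p ⊙ s ⊙ (x ⊙ b ⊙ y) ≜ b ⊙ ((p ⊙ y ⊙ x) ⊙ s) ⊙ ε) ↭-refl P X (b ∷ []) Y (concat S)

  ∑-cuts : ∀ P (g : ℕ → ℕ → ℤ) →
    ∑ (cuts P) (λ (X , b , Y) → g (length X) (length Y)) ≡ ∑ (splits (length P)) (λ (i , j) → g i j)
  ∑-cuts []      g = sym (∑-splits-zero _)
  ∑-cuts (x ∷ P) g = trans
    (cong (_+_ (g 0 (length P))) (trans (∑-map (map₁ (x ∷_)) (cuts P) _) (∑-cuts P (g ∘ suc))))
    (sym (∑-splits-suc (length P) _))

  ∑-splits-const : ∀ n c → ∑ (splits n) (λ _ → c) ≡ + n * c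
  ∑-splits-const zero    c = ∑-splits-zero _
  ∑-splits-const (suc n) c = trans (∑-splits-suc n _)
    (trans (cong (_+_ c) (∑-splits-const n c)) (sym (ℤₚ.suc-* (+ n) c)))

  -- The size of the joined face does not depend on the partner b, so every side of F contributes
  -- equally.
  ∑-cuts-join : ∀ P F (h : ℕ → ℤ) →
    ∑ (cuts F) (λ (X , b , Y) → h (length (P ++ Y ++ X))) ≡ + length F * h (length P ℕ.+ pred (length F))
  ∑-cuts-join P F h = begin
    ∑ (cuts F) (λ (X , b , Y) → h (length (P ++ Y ++ X)))
      ≡⟨ ∑-cong (cuts F) (λ (X , b , Y) → cong h (trans (Listₚ.length-++ P) (cong (length P ℕ.+_) (Listₚ.length-++ Y)))) ⟩
    ∑ (cuts F) (λ (X , b , Y) → h (length P ℕ.+ (length Y ℕ.+ length X)))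
      ≡⟨ ∑-cuts F (λ i j → h (length P ℕ.+ (j ℕ.+ i))) ⟩
    ∑ (splits (length F)) (λ (i , j) → h (length P ℕ.+ (j ℕ.+ i)))
      ≡⟨ ∑-splits-cong (length F) (λ i j e → cong (λ t → h (length P ℕ.+ t)) (trans (ℕₚ.+-comm j i) (cong pred e))) ⟩
    ∑ (splits (length F)) (λ _ → h (length P ℕ.+ pred (length F)))
      ≡⟨ ∑-splits-const (length F) _ ⟩
    + length F * h (length P ℕ.+ pred (length F)) ∎
    where open ≡-Reasoning

  ∑-picks-map : {A B : Set} (f : A → B) (S : List A) (g : B × List B → ℤ) →
    ∑ (picks (map f S)) g ≡ ∑ (picks S) (λ (F , R) → g (f F , map f R))
  ∑-picks-map f []      g = refl
  ∑-picks-map f (F ∷ S) g = cong (_+_ (g (f F , map f S))) (trans (∑-map (map₂ (f F ∷_)) (picks (map f S)) g)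
    (trans (∑-picks-map f S (g ∘ map₂ (f F ∷_))) (sym (∑-map (map₂ (F ∷_)) (picks S) _))))

  ∑-moves : ∀ P S K (H : Bool → List ℕ → ℕ → ℤ) →
    ∑ (moves P S K) (λ (b , c , S′ , K′) → H c (map length S′) (length K′)) ≡
    ∑ (splits (length P)) (λ (i , j) → H false (i ∷ j ∷ map length S) (length K)) +
    (∑ (picks (map length S)) (λ (l , ls) → + l * H true (length P ℕ.+ pred l ∷ ls) (length K)) +
     + length K * H true (length P ℕ.+ pred (length K) ∷ map length S) 0)
  ∑-moves P S K H = trans (∑-++ (map splitting (cuts P)) _ h) (cong₂ _+_
    (trans (∑-map splitting (cuts P) h) (∑-cuts P (λ i j → H false (i ∷ j ∷ map length S) (length K))))
    (trans (∑-++ (concatMap joinings (picks S)) _ h) (cong₂ _+_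
      (trans (∑-concatMap joinings (picks S) h) (trans
        (∑-cong (picks S) (λ (F , R) → trans (∑-map (joining F R) (cuts F) h)
          (∑-cuts-join P F (λ l → H true (l ∷ map length R) (length K)))))
        (sym (∑-picks-map length S _))))
      (trans (∑-map crossing (cuts K) h) (∑-cuts-join P K (λ l → H true (l ∷ map length S) 0))))))
    where
    h : Move → ℤ
    h (b , c , S′ , K′) = H c (map length S′) (length K′)
    splitting crossing : List ℕ × ℕ × List ℕ → Move
    splitting (X , b , Y) = b , false , X ∷ Y ∷ S , K
    crossing (X , b , Y) = b , true , (P ++ Y ++ X) ∷ S , []
    joining : List ℕ → List (List ℕ) → List ℕ × ℕ × List ℕ → Move
    joining F R (X , b , Y) = b , true , (P ++ Y ++ X) ∷ R , K
    joinings : List ℕ × List (List ℕ) → List Move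
    joinings (F , R) = map (joining F R) (cuts F)

  -- Summing runs over all vectors

  agree : (ℕ → ℕ) → List (ℕ × ℕ) → ℤ
  agree f []            = 1ℤ
  agree f ((i , j) ∷ Π) = ⟨ f i ≡ᵇ j ⟩ * agree f Π

  agree-↭ : ∀ f {Π Π′} → Π ↭ Π′ → agree f Π ≡ agree f Π′
  agree-↭ f Perm.refl                     = refl
  agree-↭ f (Perm.prep (i , j) p)         = cong (_*_ ⟨ f i ≡ᵇ j ⟩) (agree-↭ f p)
  agree-↭ f (Perm.swap (i , j) (k , l) p) =
    trans (cong (λ t → ⟨ f i ≡ᵇ j ⟩ * (⟨ f k ≡ᵇ l ⟩ * t)) (agree-↭ f p)) (lemma ⟨ f i ≡ᵇ j ⟩ ⟨ f k ≡ᵇ l ⟩ _)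
    where
    lemma : ∀ a b c → a * (b * c) ≡ b * (a * c)
    lemma = solve-∀
  agree-↭ f (Perm.trans p q)              = trans (agree-↭ f p) (agree-↭ f q)

  -- `app` exists for square vectors only, while the induction over `allVecs n k` passes through
  -- every length k.
  at : ∀ {n k} → Vec (Fin n) k → ℕ → ℕ
  at []      i       = 0
  at (x ∷ v) zero    = toℕ x
  at (x ∷ v) (suc i) = at v i

  at-lookup : ∀ {n k} (v : Vec (Fin n) k) {i} (i<k : i < k) → toℕ (Vec.lookup v (fromℕ< i<k)) ≡ at v i
  at-lookup (x ∷ v) {zero}  i<k = refl
  at-lookup (x ∷ v) {suc i} i<k = at-lookup v (ℕ.s<s⁻¹ i<k)

  app-at : ∀ {n} (v : Vec (Fin n) n) {i} → i < n → app v i ≡ at v i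
  app-at {n} v {i} i<n with i <? n
  ... | yes p = at-lookup v p
  ... | no ¬p = ⊥-elim (¬p i<n)

  agree-cong : ∀ {f g} Π → All (λ i → f i ≡ g i) (map proj₁ Π) → agree f Π ≡ agree g Π
  agree-cong []            []       = refl
  agree-cong ((i , j) ∷ Π) (e ∷ es) = cong₂ (λ s t → ⟨ s ≡ᵇ j ⟩ * t) e (agree-cong Π es)

  agree-suc : ∀ {n k} f m Π →
    map proj₁ Π ≡ applyUpTo (suc ∘ f) m →
    ∃ λ Π′ → map proj₁ Π′ ≡ applyUpTo f m × map proj₂ Π′ ≡ map proj₂ Π × (∀ (x : Fin n) (v : Vec (Fin n) k) → agree (at (x ∷ v)) Π ≡ agree (at v) Π′)
  agree-suc f zero    []            eq = [] , refl , refl , λ x v → refl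
  agree-suc f (suc m) ((i , j) ∷ Π) eq
    with refl ← Listₚ.∷-injectiveˡ eq
    with Π′ , keys , values , agrees ← agree-suc (f ∘ suc) m Π (Listₚ.∷-injectiveʳ eq) =
    (f 0 , j) ∷ Π′ , cong (f 0 ∷_) keys , cong (j ∷_) values , λ x v → cong (_*_ ⟨ at v (f 0) ≡ᵇ j ⟩) (agrees x v)

  ∑-allFin : ∀ n {j} → j < n → ∑ (allFin n) (λ x → ⟨ toℕ x ≡ᵇ j ⟩) ≡ 1ℤ
  ∑-allFin n {j} j<n = begin
    ∑ (allFin n) (λ x → ⟨ toℕ x ≡ᵇ j ⟩)
      ≡⟨ ∑-cong (allFin n) (λ x → trans (cong ⟨_⟩ (≡ᵇ-sym (toℕ x) j)) (sym (ℤₚ.*-identityʳ ⟨ j ≡ᵇ toℕ x ⟩))) ⟩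
    ∑ (allFin n) (λ x → ⟨ j ≡ᵇ toℕ x ⟩ * 1ℤ)
      ≡⟨ cong (λ t → ∑ (allFin n) (λ x → ⟨ t ≡ᵇ toℕ x ⟩ * 1ℤ)) (sym (Finₚ.toℕ-fromℕ< j<n)) ⟩
    ∑ (allFin n) (λ x → ⟨ toℕ (fromℕ< j<n) ≡ᵇ toℕ x ⟩ * 1ℤ)
      ≡⟨ ∑-single toℕ (allFin n) (λ _ → 1ℤ) (∈-allFin (fromℕ< j<n)) (Uniqueₚ.map⁺ Finₚ.toℕ-injective (Uniqueₚ.allFin⁺ n)) ⟩
    1ℤ ∎
    where
    open ≡-Reasoning
    ≡ᵇ-sym : ∀ m n → (m ≡ᵇ n) ≡ (n ≡ᵇ m)
    ≡ᵇ-sym zero    zero    = refl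
    ≡ᵇ-sym zero    (suc n) = refl
    ≡ᵇ-sym (suc m) zero    = refl
    ≡ᵇ-sym (suc m) (suc n) = ≡ᵇ-sym m n

  -- With every entry prescribed exactly one vector survives; the sum factors into one sum over
  -- `allFin n` per entry.
  ∑-allVecs-agree : ∀ n k Π → map proj₁ Π ≡ upTo k → All (_< n) (map proj₂ Π) →
    ∑ (allVecs n k) (λ v → agree (at v) Π) ≡ 1ℤ
  ∑-allVecs-agree n zero    []            eq bounds = refl
  ∑-allVecs-agree n (suc k) ((i , j) ∷ Π) eq (j<n ∷ bounds)
    with refl ← Listₚ.∷-injectiveˡ eq
    with n in n-eq
  ... | zero  = ⊥-elim (ℕₚ.n≮0 j<n)
  ... | suc m
    with Π′ , keys , values , agrees ← agree-suc {suc m} {k} (λ i → i) k Π (Listₚ.∷-injectiveʳ eq) = begin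
    ∑ (allVecs (suc m) (suc k)) (λ v → agree (at v) ((0 , j) ∷ Π))
      ≡⟨ ∑-concatMap (λ x → map (x ∷_) (allVecs (suc m) k)) (allFin (suc m)) _ ⟩
    ∑ (allFin (suc m)) (λ x → ∑ (map (x ∷_) (allVecs (suc m) k)) (λ v → agree (at v) ((0 , j) ∷ Π)))
      ≡⟨ ∑-cong (allFin (suc m)) (λ x → trans (∑-map (x ∷_) (allVecs (suc m) k) _)
           (trans (∑-cong (allVecs (suc m) k) (λ v → cong (_*_ ⟨ toℕ x ≡ᵇ j ⟩) (agrees x v)))
           (trans (∑-*ˡ ⟨ toℕ x ≡ᵇ j ⟩ (allVecs (suc m) k) (λ v → agree (at v) Π′))
           (trans (cong (_*_ ⟨ toℕ x ≡ᵇ j ⟩) (∑-allVecs-agree (suc m) k Π′ keys (subst (All (_< suc m)) (sym values) bounds)))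
                  (ℤₚ.*-identityʳ ⟨ toℕ x ≡ᵇ j ⟩))))) ⟩
    ∑ (allFin (suc m)) (λ x → ⟨ toℕ x ≡ᵇ j ⟩)
      ≡⟨ ∑-allFin (suc m) j<n ⟩
    1ℤ ∎
    where open ≡-Reasoning

  ∑-agree : ∀ n Π → map proj₁ Π ↭ upTo n → All (_< n) (map proj₂ Π) →
    ∑ (allVecs n n) (λ v → agree (app v) Π) ≡ 1ℤ
  ∑-agree n Π keys bounds
    with Π′ , eq , perm ← Permₚ.↭-map-inv proj₁ keys = trans
    (∑-cong (allVecs n n) (λ v → trans (agree-↭ (app v) perm)
      (agree-cong Π′ (subst (All (λ i → app v i ≡ at v i)) eq (All.tabulate (λ i∈ → app-at v (∈-upTo⁻ i∈)))))))
    (∑-allVecs-agree n n Π′ (sym eq) (Permₚ.All-resp-↭ (Permₚ.map⁺ proj₂ perm) bounds))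

  -- Π records the values of the involution that are already prescribed.
  ∑-runs : ∀ N S K n Π d → map proj₁ Π ++ concat S ++ K ↭ upTo n → All (_< n) (map proj₂ Π) →
    ∑ (allVecs n n) (λ v → agree (app v) Π * runs N S K (app v) d) ≡ count N (map length S) (length K) d
  ∑-runs N [] [] n Π d keys bounds =
    trans (∑-*ʳ [ d ≡0] (allVecs n n) (λ v → agree (app v) Π))
      (trans (cong (λ t → t * [ d ≡0]) (∑-agree n Π (subst (_↭ upTo n) (Listₚ.++-identityʳ _) keys) bounds))
             (ℤₚ.*-identityˡ [ d ≡0]))
  ∑-runs N [] (_ ∷ _) n Π d keys bounds = trans (∑-cong (allVecs n n) (λ v → ℤₚ.*-zeroʳ (agree (app v) Π))) (∑-zero (allVecs n n))
  ∑-runs N ([] ∷ S) K n Π d keys bounds = ∑-runs N S K n Π d keys bounds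
  ∑-runs zero ((a ∷ P) ∷ S) K n Π d keys bounds = trans (∑-cong (allVecs n n) (λ v → ℤₚ.*-zeroʳ (agree (app v) Π))) (∑-zero (allVecs n n))
  ∑-runs (suc N) ((a ∷ P) ∷ S) K n Π d keys bounds = begin
    ∑ (allVecs n n) (λ v → agree (app v) Π * ∑ (moves P S K) (λ (b , c , S′ , K′) →
        ⟨ app v a ≡ᵇ b ⟩ * (⟨ app v b ≡ᵇ a ⟩ * delay c (runs N S′ K′ (app v)) d)))
      ≡⟨ ∑-cong (allVecs n n) (λ v → trans (sym (∑-*ˡ (agree (app v) Π) (moves P S K) _))
           (∑-cong (moves P S K) (λ (b , c , S′ , K′) → regroup (agree (app v) Π) ⟨ app v a ≡ᵇ b ⟩ ⟨ app v b ≡ᵇ a ⟩ _))) ⟩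
    ∑ (allVecs n n) (λ v → ∑ (moves P S K) (λ (b , c , S′ , K′) →
        agree (app v) ((a , b) ∷ (b , a) ∷ Π) * delay c (runs N S′ K′ (app v)) d))
      -- With the move outermost, its two indicators become two further prescribed values, and the
      -- induction hypothesis counts the vectors extending them.
      ≡⟨ ∑-comm (allVecs n n) (moves P S K) _ ⟩
    ∑ (moves P S K) (λ (b , c , S′ , K′) → ∑ (allVecs n n) (λ v →
        agree (app v) ((a , b) ∷ (b , a) ∷ Π) * delay c (runs N S′ K′ (app v)) d))
      ≡⟨ ∑-cong-∈ (moves P S K) (λ {(b , c , S′ , K′)} y∈ → step b c S′ K′ d (∈-moves P S K y∈)) ⟩
    ∑ (moves P S K) (λ (b , c , S′ , K′) → delay c (count N (map length S′) (length K′)) d)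
      ≡⟨ ∑-moves P S K (λ c ms k → delay c (count N ms k) d) ⟩
    ∑ (splits (length P)) (λ (i , j) → count N (i ∷ j ∷ map length S) (length K) d) +
      (∑ (picks (map length S)) (λ (l , ls) → + l * shift (count N (length P ℕ.+ pred l ∷ ls) (length K)) d) +
       + length K * shift (count N (length P ℕ.+ pred (length K) ∷ map length S) 0) d)
      ≡⟨ cong (_+_ (∑ (splits (length P)) (λ (i , j) → count N (i ∷ j ∷ map length S) (length K) d))) (shift-out d) ⟩
    count (suc N) (map length ((a ∷ P) ∷ S)) (length K) d ∎
    where
    open ≡-Reasoning
    regroup : ∀ g a b c → g * (a * (b * c)) ≡ a * (b * g) * c
    regroup = solve-∀
    shift-out : ∀ d →
      ∑ (picks (map length S)) (λ (l , ls) → + l * shift (count N (length P ℕ.+ pred l ∷ ls) (length K)) d) +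
       + length K * shift (count N (length P ℕ.+ pred (length K) ∷ map length S) 0) d ≡
      shift (λ e → ∑ (picks (map length S)) (λ (l , ls) → + l * count N (length P ℕ.+ pred l ∷ ls) (length K) e) +
                   + length K * count N (length P ℕ.+ pred (length K) ∷ map length S) 0 e) d
    shift-out zero    = cong₂ _+_
      (trans (∑-cong (picks (map length S)) (λ (l , ls) → ℤₚ.*-zeroʳ (+ l))) (∑-zero (picks (map length S))))
      (ℤₚ.*-zeroʳ (+ length K))
    shift-out (suc d) = refl
    labels-bounded : All (_< n) (map proj₁ Π ++ concat ((a ∷ P) ∷ S) ++ K)
    labels-bounded = Permₚ.All-resp-↭ (↭-sym keys) (All.tabulate ∈-upTo⁻)
    sides-bounded : All (_< n) (a ∷ (P ++ concat S) ++ K)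
    sides-bounded = Allₚ.++⁻ʳ (map proj₁ Π) labels-bounded
    module _ (b : ℕ) (c : Bool) (S′ : List (List ℕ)) (K′ : List ℕ) (move : IsMove P S K (b , c , S′ , K′)) where
      labels : (P ++ concat S) ++ K ↭ b ∷ concat S′ ++ K′
      labels = ↭-trans (↭-reflexive (Listₚ.++-assoc P (concat S) K)) (move-labels move)
      keys′ : a ∷ b ∷ map proj₁ Π ++ concat S′ ++ K′ ↭ upTo n
      keys′ = ↭-trans (↭-prep a (↭-sym (Permₚ.shift b (map proj₁ Π) (concat S′ ++ K′))))
        (↭-trans (↭-sym (Permₚ.shift a (map proj₁ Π) (b ∷ concat S′ ++ K′)))
          (↭-trans (Permₚ.++⁺ˡ (map proj₁ Π) (↭-prep a (↭-sym labels))) keys))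
      bounds′ : All (_< n) (b ∷ a ∷ map proj₂ Π)
      bounds′ = All.head (Permₚ.All-resp-↭ labels (All.tail sides-bounded)) ∷ All.head sides-bounded ∷ bounds
    step : ∀ b c S′ K′ d → IsMove P S K (b , c , S′ , K′) →
      ∑ (allVecs n n) (λ v → agree (app v) ((a , b) ∷ (b , a) ∷ Π) * delay c (runs N S′ K′ (app v)) d) ≡
      delay c (count N (map length S′) (length K′)) d
    step b false S′ K′ d       move = ∑-runs N S′ K′ n ((a , b) ∷ (b , a) ∷ Π) d (keys′ b false S′ K′ move) (bounds′ b false S′ K′ move)
    step b true  S′ K′ zero    move = trans (∑-cong (allVecs n n) (λ v → ℤₚ.*-zeroʳ (agree (app v) ((a , b) ∷ (b , a) ∷ Π)))) (∑-zero (allVecs n n))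
    step b true  S′ K′ (suc d) move = ∑-runs N S′ K′ n ((a , b) ∷ (b , a) ∷ Π) d (keys′ b true S′ K′ move) (bounds′ b true S′ K′ move)

  -- Cycles of τ ∘ f along a run

  Edge : Set
  Edge = ℕ × ℕ

  module EdgeSolver = CommutativeMonoidSolver (Permₚ.++-commutativeMonoid {A = Edge})
  open EdgeSolver using () renaming (solve to edge-solve; _⊕_ to _⊡_; _⊜_ to _≐_)

  -- The pairs (f x , y) with y following x on a face; for σ = τ ∘ f and f an involution these
  -- are exactly the pairs (x , σ x).
  path : (ℕ → ℕ) → ℕ → List ℕ → ℕ → List Edge
  path f s []      t = (s , t) ∷ []
  path f s (p ∷ P) t = (s , p) ∷ path f (f p) P t

  boundary : (ℕ → ℕ) → List ℕ → List Edge
  boundary f []      = []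
  boundary f (p ∷ P) = path f (f p) P p

  boundaries : (ℕ → ℕ) → List (List ℕ) → List Edge
  boundaries f S = concat (map (boundary f) S)

  Cycle : Set
  Cycle = ℕ × List ℕ

  cycle-edges : List Cycle → List Edge
  cycle-edges cs = concat (map (λ (q , Q) → path (λ x → x) q Q q) cs)

  path-++ : ∀ f s X b Y t → path f s (X ++ b ∷ Y) t ≡ path f s X b ++ path f (f b) Y t
  path-++ f s []      b Y t = refl
  path-++ f s (x ∷ X) b Y t = cong ((s , x) ∷_) (path-++ f (f x) X b Y t)

  boundary-rotate : ∀ f X b Y → boundary f (X ++ b ∷ Y) ↭ boundary f (b ∷ Y ++ X)
  boundary-rotate f []      b Y = ↭-reflexive (cong (λ Z → path f (f b) Z b) (sym (Listₚ.++-identityʳ Y)))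
  boundary-rotate f (x ∷ X) b Y = ↭-trans (↭-reflexive (path-++ f (f x) X b Y x))
    (↭-trans (Permₚ.++-comm (path f (f x) X b) (path f (f b) Y x)) (↭-reflexive (sym (path-++ f (f b) Y x X b))))

  path-first : ∀ f P t → ∃ λ q → ∃ λ E → ∀ s → path f s P t ≡ (s , q) ∷ E
  path-first f []      t = t , [] , λ s → refl
  path-first f (p ∷ P) t = p , path f (f p) P t , λ s → refl

  path-last : ∀ f s P → ∃ λ y → ∃ λ E → ∀ t → path f s P t ↭ (y , t) ∷ E
  path-last f s []      = s , [] , λ t → ↭-refl
  path-last f s (p ∷ P) with y , E , eq ← path-last f (f p) P =
    y , (s , p) ∷ E , λ t → ↭-trans (↭-prep (s , p) (eq t)) (↭-swap (s , p) (y , t) ↭-refl)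

  -- (y , q) is the edge across the seam between P and Z. Splicing a into it cuts the path into one
  -- that ends in a and one that starts from a.
  path-junction : ∀ f s P Z t → ∃ λ y → ∃ λ q → ∃ λ E →
    path f s (P ++ Z) t ↭ (y , q) ∷ E × (∀ a → path f s P a ++ path f a Z t ↭ (y , a) ∷ (a , q) ∷ E)
  path-junction f s []      Z t with q , E , eq ← path-first f Z t =
    s , q , E , ↭-reflexive (eq s) , λ a → ↭-reflexive (cong ((s , a) ∷_) (eq a))
  path-junction f s (p ∷ P) Z t with y , q , E , eq , eq′ ← path-junction f (f p) P Z t =
    y , q , (s , p) ∷ E ,
    ↭-trans (↭-prep (s , p) eq) (↭-swap (s , p) (y , q) ↭-refl) ,
    λ a → ↭-trans (↭-prep (s , p) (eq′ a)) (Permₚ.shifts ((s , p) ∷ []) ((y , a) ∷ (a , q) ∷ []))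

  insert-path : ∀ b s Q t {y p} → (y , p) ∈ path (λ x → x) s Q t → ∃ λ Q′ → ∃ λ E →
    path (λ x → x) s Q t ↭ (y , p) ∷ E × path (λ x → x) s Q′ t ↭ (y , b) ∷ (b , p) ∷ E
  insert-path b s []      t (here refl) = b ∷ [] , [] , ↭-refl , ↭-refl
  insert-path b s (q ∷ Q) t (here refl) = b ∷ q ∷ Q , path (λ x → x) q Q t , ↭-refl , ↭-refl
  insert-path b s (q ∷ Q) t {y} {p} (there i) with Q′ , E , eq , eq′ ← insert-path b q Q t i =
    q ∷ Q′ , (s , q) ∷ E ,
    ↭-trans (↭-prep (s , q) eq) (↭-swap (s , q) (y , p) ↭-refl) ,
    ↭-trans (↭-prep (s , q) eq′) (Permₚ.shifts ((s , q) ∷ []) ((y , b) ∷ (b , p) ∷ []))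

  insert-∈ : ∀ b cs {y p} → (y , p) ∈ cycle-edges cs → ∃ λ cs′ → ∃ λ E →
    length cs′ ≡ length cs × cycle-edges cs ↭ (y , p) ∷ E × cycle-edges cs′ ↭ (y , b) ∷ (b , p) ∷ E
  insert-∈ b ((q , Q) ∷ cs) {y} {p} i with ∈-++⁻ (path (λ x → x) q Q q) i
  ... | inj₁ j with Q′ , E , eq , eq′ ← insert-path b q Q q j =
    (q , Q′) ∷ cs , E ++ cycle-edges cs , refl , Permₚ.++⁺ʳ (cycle-edges cs) eq , Permₚ.++⁺ʳ (cycle-edges cs) eq′
  ... | inj₂ j with cs′ , E , len , eq , eq′ ← insert-∈ b cs j =
    (q , Q) ∷ cs′ , path (λ x → x) q Q q ++ E , cong suc len ,
    ↭-trans (Permₚ.++⁺ˡ (path (λ x → x) q Q q) eq) (Permₚ.shifts (path (λ x → x) q Q q) ((y , p) ∷ [])) ,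
    ↭-trans (Permₚ.++⁺ˡ (path (λ x → x) q Q q) eq′) (Permₚ.shifts (path (λ x → x) q Q q) ((y , b) ∷ (b , p) ∷ []))

  -- Subdividing an edge lengthens one cycle and leaves the number of cycles unchanged. Edges are
  -- known only up to order, so the edge is located first.
  insert : ∀ b cs {y p E} → cycle-edges cs ↭ (y , p) ∷ E →
    ∃ λ cs′ → length cs′ ≡ length cs × cycle-edges cs′ ↭ (y , b) ∷ (b , p) ∷ E
  insert b cs {y} {p} perm
    with cs′ , E′ , len , eq , eq′ ← insert-∈ b cs (Permₚ.∈-resp-↭ (↭-sym perm) (here refl)) =
    cs′ , len , ↭-trans eq′ (↭-prep (y , b) (↭-prep (b , p) (Permₚ.drop-∷ (↭-trans (↭-sym eq) perm))))

  nonempty : List ℕ → ℕ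
  nonempty []      = 0
  nonempty (_ ∷ _) = 1

  -- Inserting the removed side b before the first element of P in the cycles of τ′ ∘ f′ undoes
  -- the contraction of the segment P to a face.
  open-face : ∀ f b P cs R → cycle-edges cs ↭ boundary f P ++ R →
    ∃ λ cs′ → length cs′ ℕ.+ nonempty P ≡ suc (length cs) × cycle-edges cs′ ↭ path f b P b ++ R
  open-face f b []      cs R perm = (b , []) ∷ cs , ℕₚ.+-identityʳ _ , ↭-prep (b , b) perm
  open-face f b (p ∷ P) cs R perm
    with y , E , eq ← path-last f (f p) P
    with cs′ , len , perm′ ← insert b cs (↭-trans perm (Permₚ.++⁺ʳ R (eq p))) =
    cs′ , trans (ℕₚ.+-comm (length cs′) 1) (cong suc len) ,
    ↭-trans perm′ (↭-trans (↭-swap (y , b) (b , p) ↭-refl) (↭-prep (b , p) (Permₚ.++⁺ʳ R (↭-sym (eq b)))))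

  cut-path : ∀ f a s P Z t cs R → cycle-edges cs ↭ path f s (P ++ Z) t ++ R →
    ∃ λ cs′ → length cs′ ≡ length cs × cycle-edges cs′ ↭ (path f s P a ++ path f a Z t) ++ R
  cut-path f a s P Z t cs R perm
    with y , q , E , eq , eq′ ← path-junction f s P Z t
    with cs′ , len , perm′ ← insert a cs (↭-trans perm (Permₚ.++⁺ʳ R eq)) =
    cs′ , len , ↭-trans perm′ (Permₚ.++⁺ʳ R (↭-sym (eq′ a)))

  -- Undoes a join by two insertions: b opens the merged face, with a new cycle exactly if that face
  -- is a 0-gon, and a goes into the seam of P and Z.
  open-merged : ∀ f a b P Z cs R → cycle-edges cs ↭ boundary f (P ++ Z) ++ R →
    ∃ λ cs′ → length cs′ ℕ.+ nonempty (P ++ Z) ≡ suc (length cs) ×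
              cycle-edges cs′ ↭ (path f b P a ++ path f a Z b) ++ R
  open-merged f a b P Z cs R perm
    with cs₁ , len₁ , perm₁ ← open-face f b (P ++ Z) cs R perm
    with cs₂ , len₂ , perm₂ ← cut-path f a b P Z b cs₁ R perm₁ =
    cs₂ , trans (cong (ℕ._+ nonempty (P ++ Z)) len₂) len₁ , perm₂

  faces : List (List ℕ) → List ℕ → ℕ
  faces S K = sum (map nonempty S) ℕ.+ nonempty K

  cost : Bool → ℕ
  cost c = if c then 1 else 0

  rotated-path : ∀ {f a b} X Y → f b ≡ a → boundary f (X ++ b ∷ Y) ↭ path f a (Y ++ X) b
  rotated-path {f} {b = b} X Y fb = ↭-trans (boundary-rotate f X b Y) (↭-reflexive (cong (λ s → path f s (Y ++ X) b) fb))

  sum-↭ : ∀ {ms ns : List ℕ} → ms ↭ ns → sum ms ≡ sum ns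
  sum-↭ Perm.refl         = refl
  sum-↭ (Perm.prep x p)   = cong (x ℕ.+_) (sum-↭ p)
  sum-↭ (Perm.swap x y p) = trans (cong (λ t → x ℕ.+ (y ℕ.+ t)) (sum-↭ p)) (lemma x y _)
    where
    lemma : ∀ x y t → x ℕ.+ (y ℕ.+ t) ≡ y ℕ.+ (x ℕ.+ t)
    lemma = ℕ-solve-∀
  sum-↭ (Perm.trans p q)  = trans (sum-↭ p) (sum-↭ q)

  nonempty-∷ : ∀ X b Y → nonempty (X ++ b ∷ Y) ≡ 1
  nonempty-∷ []      b Y = refl
  nonempty-∷ (x ∷ X) b Y = refl

  -- Reads a gluing backwards: cs are the cycles after the move, and the removed sides a and b are
  -- put back into them. The length equation is one step of Euler's relation: a pair of sides counts
  -- 1, a join 2.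
  move-cycles : ∀ {f a P S K b c S′ K′} cs → IsMove P S K (b , c , S′ , K′) → f a ≡ b → f b ≡ a →
    cycle-edges cs ↭ boundaries f S′ ++ boundary f K′ →
    ∃ λ cs′ → cycle-edges cs′ ↭ boundaries f ((a ∷ P) ∷ S) ++ boundary f K ×
              length cs′ ℕ.+ faces S′ K′ ℕ.+ (cost c ℕ.+ cost c) ≡ length cs ℕ.+ faces ((a ∷ P) ∷ S) K ℕ.+ 1
  move-cycles {f} {a} {S = S} {K} cs (split X b Y refl) fa fb perm
    with cs₁ , len₁ , perm₁ ← open-face f b X cs ((boundary f Y ++ boundaries f S) ++ boundary f K)
           (↭-trans perm (↭-reflexive (Listₚ.++-assoc (boundary f X) (boundary f Y ++ boundaries f S) (boundary f K))))
    with cs₂ , len₂ , perm₂ ← open-face f a Y cs₁ (path f b X b ++ boundaries f S ++ boundary f K)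
           (↭-trans perm₁ (edge-solve 4 (λ x y s k → x ⊡ ((y ⊡ s) ⊡ k) ≐ y ⊡ (x ⊡ (s ⊡ k))) ↭-refl
             (path f b X b) (boundary f Y) (boundaries f S) (boundary f K))) =
    cs₂ ,
    ↭-trans perm₂ (↭-trans
      (edge-solve 4 (λ x y s k → y ⊡ (x ⊡ (s ⊡ k)) ≐ ((x ⊡ y) ⊡ s) ⊡ k) ↭-refl
         (path f b X b) (path f a Y a) (boundaries f S) (boundary f K))
      (↭-reflexive (cong (λ E → (E ++ boundaries f S) ++ boundary f K)
        (sym (trans (path-++ f (f a) X b Y a) (cong₂ (λ s t → path f s X b ++ path f t Y a) fa fb)))))) ,
    arrange (length cs₂) (length cs₁) (length cs) (nonempty X) (nonempty Y) (sum (map nonempty S)) (nonempty K) len₂ len₁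
    where
    arrange : ∀ l₂ l₁ l x y s k → l₂ ℕ.+ y ≡ suc l₁ → l₁ ℕ.+ x ≡ suc l →
      l₂ ℕ.+ (x ℕ.+ (y ℕ.+ s) ℕ.+ k) ℕ.+ 0 ≡ l ℕ.+ (1 ℕ.+ s ℕ.+ k) ℕ.+ 1
    arrange l₂ l₁ l x y s k e₂ e₁ = begin
      l₂ ℕ.+ (x ℕ.+ (y ℕ.+ s) ℕ.+ k) ℕ.+ 0  ≡⟨ shuffle₁ l₂ x y s k ⟩
      (l₂ ℕ.+ y) ℕ.+ (x ℕ.+ s ℕ.+ k)        ≡⟨ cong (ℕ._+ (x ℕ.+ s ℕ.+ k)) e₂ ⟩
      suc l₁ ℕ.+ (x ℕ.+ s ℕ.+ k)            ≡⟨ shuffle₂ l₁ x s k ⟩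
      (l₁ ℕ.+ x) ℕ.+ (1 ℕ.+ s ℕ.+ k)        ≡⟨ cong (ℕ._+ (1 ℕ.+ s ℕ.+ k)) e₁ ⟩
      suc l ℕ.+ (1 ℕ.+ s ℕ.+ k)             ≡⟨ ℕₚ.+-comm 1 _ ⟩
      l ℕ.+ (1 ℕ.+ s ℕ.+ k) ℕ.+ 1           ∎
      where
      open ≡-Reasoning
      shuffle₁ : ∀ l x y s k → l ℕ.+ (x ℕ.+ (y ℕ.+ s) ℕ.+ k) ℕ.+ 0 ≡ (l ℕ.+ y) ℕ.+ (x ℕ.+ s ℕ.+ k)
      shuffle₁ = ℕ-solve-∀
      shuffle₂ : ∀ l x s k → 1 ℕ.+ l ℕ.+ (x ℕ.+ s ℕ.+ k) ≡ (l ℕ.+ x) ℕ.+ (1 ℕ.+ s ℕ.+ k)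
      shuffle₂ = ℕ-solve-∀
  move-cycles {f} {a} {P} {S} {K} cs (join X b Y R p) fa fb perm
    with cs₁ , len₁ , perm₁ ← open-merged f a b P (Y ++ X) cs (boundaries f R ++ boundary f K)
           (↭-trans perm (↭-reflexive (Listₚ.++-assoc (boundary f (P ++ Y ++ X)) (boundaries f R) (boundary f K)))) =
    cs₁ ,
    ↭-trans perm₁ (↭-trans
      (edge-solve 4 (λ p z r k → (p ⊡ z) ⊡ (r ⊡ k) ≐ (p ⊡ (z ⊡ r)) ⊡ k) ↭-refl
         (path f b P a) (path f a (Y ++ X) b) (boundaries f R) (boundary f K))
      (Permₚ.++⁺ʳ (boundary f K) (Permₚ.++⁺ (↭-reflexive (cong (λ s → path f s P a) (sym fa)))
        (↭-sym (↭-trans (concat-↭ (Permₚ.map⁺ (boundary f) p)) (Permₚ.++⁺ʳ (boundaries f R) (rotated-path X Y fb))))))) ,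
    arrange (length cs₁) (length cs) (nonempty (P ++ Y ++ X)) (sum (map nonempty R)) (nonempty K) (sum (map nonempty S)) len₁
      (trans (sum-↭ (Permₚ.map⁺ nonempty p)) (cong (ℕ._+ sum (map nonempty R)) (nonempty-∷ X b Y)))
    where
    arrange : ∀ l₁ l m r k s → l₁ ℕ.+ m ≡ suc l → s ≡ 1 ℕ.+ r →
      l₁ ℕ.+ (m ℕ.+ r ℕ.+ k) ℕ.+ 2 ≡ l ℕ.+ (1 ℕ.+ s ℕ.+ k) ℕ.+ 1
    arrange l₁ l m r k _ e refl = begin
      l₁ ℕ.+ (m ℕ.+ r ℕ.+ k) ℕ.+ 2 ≡⟨ shuffle₁ l₁ m r k ⟩
      (l₁ ℕ.+ m) ℕ.+ (2 ℕ.+ r ℕ.+ k) ≡⟨ cong (ℕ._+ (2 ℕ.+ r ℕ.+ k)) e ⟩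
      suc l ℕ.+ (2 ℕ.+ r ℕ.+ k) ≡⟨ ℕₚ.+-comm 1 _ ⟩
      l ℕ.+ (1 ℕ.+ (1 ℕ.+ r) ℕ.+ k) ℕ.+ 1 ∎
      where
      open ≡-Reasoning
      shuffle₁ : ∀ l m r k → l ℕ.+ (m ℕ.+ r ℕ.+ k) ℕ.+ 2 ≡ (l ℕ.+ m) ℕ.+ (2 ℕ.+ r ℕ.+ k)
      shuffle₁ = ℕ-solve-∀
  move-cycles {f} {a} {P} {S} cs (cross X b Y refl) fa fb perm
    with cs₁ , len₁ , perm₁ ← open-merged f a b P (Y ++ X) cs (boundaries f S)
           (↭-trans perm (↭-reflexive (Listₚ.++-identityʳ _))) =
    cs₁ ,
    ↭-trans perm₁ (↭-trans
      (edge-solve 3 (λ p z s → (p ⊡ z) ⊡ s ≐ (p ⊡ s) ⊡ z) ↭-refl (path f b P a) (path f a (Y ++ X) b) (boundaries f S))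
      (Permₚ.++⁺ (Permₚ.++⁺ʳ (boundaries f S) (↭-reflexive (cong (λ s → path f s P a) (sym fa)))) (↭-sym (rotated-path X Y fb)))) ,
    trans (arrange (length cs₁) (length cs) (nonempty (P ++ Y ++ X)) (sum (map nonempty S)) len₁)
      (cong (λ t → length cs ℕ.+ (1 ℕ.+ sum (map nonempty S) ℕ.+ t) ℕ.+ 1) (sym (nonempty-∷ X b Y)))
    where
    arrange : ∀ l₁ l m s → l₁ ℕ.+ m ≡ suc l → l₁ ℕ.+ (m ℕ.+ s ℕ.+ 0) ℕ.+ 2 ≡ l ℕ.+ (1 ℕ.+ s ℕ.+ 1) ℕ.+ 1
    arrange l₁ l m s e = begin
      l₁ ℕ.+ (m ℕ.+ s ℕ.+ 0) ℕ.+ 2 ≡⟨ shuffle₁ l₁ m s ⟩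
      (l₁ ℕ.+ m) ℕ.+ (2 ℕ.+ s) ≡⟨ cong (ℕ._+ (2 ℕ.+ s)) e ⟩
      suc l ℕ.+ (2 ℕ.+ s) ≡⟨ shuffle₂ l s ⟩
      l ℕ.+ (1 ℕ.+ s ℕ.+ 1) ℕ.+ 1 ∎
      where
      open ≡-Reasoning
      shuffle₁ : ∀ l m s → l ℕ.+ (m ℕ.+ s ℕ.+ 0) ℕ.+ 2 ≡ (l ℕ.+ m) ℕ.+ (2 ℕ.+ s)
      shuffle₁ = ℕ-solve-∀
      shuffle₂ : ∀ l s → 1 ℕ.+ l ℕ.+ (2 ℕ.+ s) ≡ l ℕ.+ (1 ℕ.+ s ℕ.+ 1) ℕ.+ 1
      shuffle₂ = ℕ-solve-∀

  -- Runs follow exactly one branch for each fixed-point-free involution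

  Unique-resp-↭ : {xs ys : List ℕ} → xs ↭ ys → Unique xs → Unique ys
  Unique-resp-↭ p = SetoidPermₚ.Unique-resp-↭ (≡-setoid ℕ) (↭⇒↭ₛ p)

  labels : List (List ℕ) → List ℕ → List ℕ
  labels S K = concat S ++ K

  labels-move : ∀ {a P S K b c S′ K′} → IsMove P S K (b , c , S′ , K′) → labels ((a ∷ P) ∷ S) K ↭ a ∷ b ∷ labels S′ K′
  labels-move {a} {P} {S} {K} move = ↭-prep a (↭-trans (↭-reflexive (Listₚ.++-assoc P (concat S) K)) (move-labels move))

  map-cuts : {B : Set} (f : ℕ → B) (P : List ℕ) → map (λ (X , b , Y) → f b) (cuts P) ≡ map f P
  map-cuts f []      = refl
  map-cuts f (x ∷ P) = cong (f x ∷_) (trans (sym (Listₚ.map-∘ (cuts P))) (map-cuts f P))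

  concatMap-picks : {B : Set} (f : List ℕ → List B) (S : List (List ℕ)) → concatMap (λ (F , R) → f F) (picks S) ≡ concatMap f S
  concatMap-picks f []      = refl
  concatMap-picks f (F ∷ S) = cong (f F ++_) (trans (cong concat (sym (Listₚ.map-∘ (picks S)))) (concatMap-picks f S))

  -- Each remaining label is the target of exactly one move, so the value f a selects a single
  -- summand of `runs`.
  targets-moves : ∀ P S K → map proj₁ (moves P S K) ≡ P ++ concat S ++ K
  targets-moves P S K = trans (Listₚ.map-++ proj₁ (map _ (cuts P)) _) (cong₂ _++_
    (trans (sym (Listₚ.map-∘ (cuts P))) (identity P))
    (trans (Listₚ.map-++ proj₁ (concatMap _ (picks S)) _) (cong₂ _++_
      (trans (Listₚ.map-concatMap proj₁ _ (picks S)) (trans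
        (Listₚ.concatMap-cong (λ (F , R) → trans (sym (Listₚ.map-∘ (cuts F))) (identity F)) (picks S))
        (trans (concatMap-picks (λ F → F) S) (cong concat (Listₚ.map-id S)))))
      (trans (sym (Listₚ.map-∘ (cuts K))) (identity K)))))
    where
    identity : ∀ P → map (λ (X , b , Y) → b) (cuts P) ≡ P
    identity P = trans (map-cuts (λ b → b) P) (Listₚ.map-id P)

  ∑-nonzero : {A : Set} (xs : List A) (g : A → ℤ) → ∑ xs g ≢ 0ℤ → ∃ λ x → x ∈ xs × g x ≢ 0ℤ
  ∑-nonzero []       g ≢0 = ⊥-elim (≢0 refl)
  ∑-nonzero (x ∷ xs) g ≢0 with g x ℤₚ.≟ 0ℤ
  ... | no  gx≢0 = x , here refl , gx≢0
  ... | yes gx≡0 with y , y∈ , gy≢0 ← ∑-nonzero xs g (λ e → ≢0 (cong₂ _+_ gx≡0 e)) = y , there y∈ , gy≢0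

  indicator-nonzero : ∀ {m n z} → ⟨ m ≡ᵇ n ⟩ * z ≢ 0ℤ → m ≡ n × z ≢ 0ℤ
  indicator-nonzero {m} {n} {z} ≢0 with m ≡ᵇ n in eq
  ... | true  = ℕₚ.≡ᵇ⇒≡ m n (subst T (sym eq) tt) , λ e → ≢0 (cong (_*_ 1ℤ) e)
  ... | false = ⊥-elim (≢0 refl)

  delay-nonzero : ∀ c {r d} → delay c r d ≢ 0ℤ → ∃ λ e → r e ≢ 0ℤ
  delay-nonzero false {d = d}     ≢0 = d , ≢0
  delay-nonzero true  {d = zero}  ≢0 = ⊥-elim (≢0 refl)
  delay-nonzero true  {d = suc d} ≢0 = d , ≢0

  -- On a nonzero branch every label is used once, as root or as partner, and the two indicators
  -- make f exchange these; they differ because labels are distinct.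
  runs-involutive : ∀ N S K f d → Unique (labels S K) → runs N S K f d ≢ 0ℤ →
    ∀ {x} → x ∈ labels S K → f x ≢ x × f (f x) ≡ x
  runs-involutive N       []            (_ ∷ _) f d unique ≢0 i = ⊥-elim (≢0 refl)
  runs-involutive N       ([] ∷ S)      K       f d unique ≢0 i = runs-involutive N S K f d unique ≢0 i
  runs-involutive zero    ((a ∷ P) ∷ S) K       f d unique ≢0 i = ⊥-elim (≢0 refl)
  runs-involutive (suc N) ((a ∷ P) ∷ S) K       f d unique ≢0 i
    with (b , c , S′ , K′) , y∈ , y≢0 ← ∑-nonzero (moves P S K) _ ≢0
    with fa , y≢0 ← indicator-nonzero {f a} {b} y≢0
    with fb , y≢0 ← indicator-nonzero {f b} {a} y≢0
    with e , r≢0 ← delay-nonzero c {runs N S′ K′ f} {d} y≢0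
    with (a≢b ∷ a∉) ∷ (b∉ ∷ unique′) ← Unique-resp-↭ (labels-move (∈-moves P S K y∈)) unique
    with Permₚ.∈-resp-↭ (labels-move (∈-moves P S K y∈)) i
  ... | here refl         = (λ e → a≢b (trans (sym e) fa)) , trans (cong f fa) fb
  ... | there (here refl) = (λ e → a≢b (trans (sym fb) e)) , trans (cong f fb) fa
  ... | there (there j)   = runs-involutive N S′ K′ f e unique′ r≢0 j

  record Pairing (f : ℕ → ℕ) (L : List ℕ) : Set where
    field
      unique     : Unique L
      closed     : ∀ {x} → x ∈ L → f x ∈ L
      fixed-free : ∀ {x} → x ∈ L → f x ≢ x
      involutive : ∀ {x} → x ∈ L → f (f x) ≡ x

  open Pairing

  pairing-step : ∀ {f a b L L′} → L ↭ a ∷ b ∷ L′ → f a ≡ b → Pairing f L → Pairing f L′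
  pairing-step {f} {a} {b} {L} {L′} perm fa H with (a≢b ∷ a∉) ∷ (b∉ ∷ unique′) ← Unique-resp-↭ perm (unique H) = record
    { unique     = unique′
    ; closed     = closed′
    ; fixed-free = λ i → fixed-free H (back i)
    ; involutive = λ i → involutive H (back i)
    }
    where
    back : ∀ {x} → x ∈ L′ → x ∈ L
    back i = Permₚ.∈-resp-↭ (↭-sym perm) (there (there i))
    fb : f b ≡ a
    fb = trans (cong f (sym fa)) (involutive H (Permₚ.∈-resp-↭ (↭-sym perm) (here refl)))
    closed′ : ∀ {x} → x ∈ L′ → f x ∈ L′
    closed′ {x} i with Permₚ.∈-resp-↭ perm (closed H (back i))
    ... | here e          = ⊥-elim (All.lookup b∉ i (trans (sym fa) (trans (cong f (sym e)) (involutive H (back i)))))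
    ... | there (here e)  = ⊥-elim (All.lookup a∉ i (trans (sym fb) (trans (cong f (sym e)) (involutive H (back i)))))
    ... | there (there j) = j

  -- Outcome of a run whose polygon K gets used up, or was used up before: its number of joins, and
  -- the cycles rebuilt along it, from which the genus is read.
  record Linked (N : ℕ) (S : List (List ℕ)) (K : List ℕ) (f : ℕ → ℕ) : Set where
    field
      joined    : ℕ
      cycles    : List Cycle
      runs-eq   : ∀ d → runs N S K f d ≡ ⟨ joined ≡ᵇ d ⟩
      edges     : cycle-edges cycles ↭ boundaries f S ++ boundary f K
      euler     : length cycles ℕ.+ (joined ℕ.+ joined) ≡ N ℕ.+ faces S K
      crossing  : K ≢ [] → ∃ λ x → x ∈ concat S × f x ∈ K

  -- Outcome of a run that closes up without touching K: the labels of S are then stable under f,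
  -- which refutes connectedness.
  record Unlinked (N : ℕ) (S : List (List ℕ)) (K : List ℕ) (f : ℕ → ℕ) : Set where
    field
      K-nonempty : K ≢ []
      runs-eq   : ∀ d → runs N S K f d ≡ 0ℤ
      preserved : ∀ {x} → x ∈ concat S → f x ∈ concat S

  delay-indicator : ∀ c {r j} → (∀ d → r d ≡ ⟨ j ≡ᵇ d ⟩) → ∀ d → delay c r d ≡ ⟨ cost c ℕ.+ j ≡ᵇ d ⟩
  delay-indicator false eq d       = eq d
  delay-indicator true  eq zero    = refl
  delay-indicator true  eq (suc d) = eq d

  delay-zero : ∀ c {r} → (∀ d → r d ≡ 0ℤ) → ∀ d → delay c r d ≡ 0ℤ
  delay-zero false eq d       = eq d
  delay-zero true  eq zero    = refl
  delay-zero true  eq (suc d) = eq d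

  move-inside : ∀ {a P S K b c S′ K′} → IsMove P S K (b , c , S′ , K′) →
    (K′ ≡ K × concat ((a ∷ P) ∷ S) ↭ a ∷ b ∷ concat S′) ⊎ (K′ ≡ [] × b ∈ K)
  move-inside {a} {S = S} {K} (split X b Y refl) = inj₁ (refl , ↭-prep a (↭-trans
    (↭-reflexive (Listₚ.++-assoc X (b ∷ Y) (concat S))) (↭-trans (Permₚ.shift b X (Y ++ concat S)) ↭-refl)))
  move-inside {a} {P} {S} {K} (join X b Y R p) = inj₁ (refl , ↭-prep a (↭-trans (Permₚ.++⁺ˡ P (concat-↭ p))
    (label-solve 5 (λ p x b y r → p ⊙ ((x ⊙ b ⊙ y) ⊙ r) ≜ b ⊙ ((p ⊙ y ⊙ x) ⊙ r)) ↭-refl P X (b ∷ []) Y (concat R))))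
  move-inside (cross X b Y refl) = inj₂ (refl , ∈-++⁺ʳ X (here refl))

  runs-move : ∀ N a P S K f {y} → Unique (labels ((a ∷ P) ∷ S) K) → y ∈ moves P S K → f a ≡ proj₁ y → f (proj₁ y) ≡ a → ∀ d →
    runs (suc N) ((a ∷ P) ∷ S) K f d ≡ delay (proj₁ (proj₂ y)) (runs N (proj₁ (proj₂ (proj₂ y))) (proj₂ (proj₂ (proj₂ y))) f) d
  runs-move N a P S K f {y} (a∉ ∷ unique) y∈ fa fb d = begin
    runs (suc N) ((a ∷ P) ∷ S) K f d
      ≡⟨ cong (λ t → ∑ (moves P S K) (λ z → ⟨ t ≡ᵇ proj₁ z ⟩ * g z)) fa ⟩
    ∑ (moves P S K) (λ z → ⟨ proj₁ y ≡ᵇ proj₁ z ⟩ * g z)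
      ≡⟨ ∑-single proj₁ (moves P S K) g y∈ (subst Unique (sym (trans (targets-moves P S K) (sym (Listₚ.++-assoc P (concat S) K)))) unique) ⟩
    ⟨ f (proj₁ y) ≡ᵇ a ⟩ * delay (proj₁ (proj₂ y)) (runs N (proj₁ (proj₂ (proj₂ y))) (proj₂ (proj₂ (proj₂ y))) f) d
      ≡⟨ cong (λ t → ⟨ t ⟩ * delay (proj₁ (proj₂ y)) (runs N (proj₁ (proj₂ (proj₂ y))) (proj₂ (proj₂ (proj₂ y))) f) d)
           (trans (cong (_≡ᵇ a) fb) (≡ᵇ-refl a)) ⟩
    1ℤ * delay (proj₁ (proj₂ y)) (runs N (proj₁ (proj₂ (proj₂ y))) (proj₂ (proj₂ (proj₂ y))) f) d
      ≡⟨ ℤₚ.*-identityˡ _ ⟩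
    delay (proj₁ (proj₂ y)) (runs N (proj₁ (proj₂ (proj₂ y))) (proj₂ (proj₂ (proj₂ y))) f) d ∎
    where
    open ≡-Reasoning
    g : Move → ℤ
    g (b , c , S′ , K′) = ⟨ f b ≡ᵇ a ⟩ * delay c (runs N S′ K′ f) d

  euler-step : ∀ l′ l F F′ c j N → l′ ℕ.+ F′ ℕ.+ (c ℕ.+ c) ≡ l ℕ.+ F ℕ.+ 1 → l ℕ.+ (j ℕ.+ j) ≡ N ℕ.+ F′ →
    l′ ℕ.+ ((c ℕ.+ j) ℕ.+ (c ℕ.+ j)) ≡ suc N ℕ.+ F
  euler-step l′ l F F′ c j N e₁ e₂ = ℕₚ.+-cancelʳ-≡ (F′ ℕ.+ l) _ _ (begin
    l′ ℕ.+ ((c ℕ.+ j) ℕ.+ (c ℕ.+ j)) ℕ.+ (F′ ℕ.+ l)     ≡⟨ shuffle₁ l′ l F′ c j ⟩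
    (l′ ℕ.+ F′ ℕ.+ (c ℕ.+ c)) ℕ.+ (l ℕ.+ (j ℕ.+ j))     ≡⟨ cong₂ ℕ._+_ e₁ e₂ ⟩
    (l ℕ.+ F ℕ.+ 1) ℕ.+ (N ℕ.+ F′)                      ≡⟨ shuffle₂ l F F′ N ⟩
    suc N ℕ.+ F ℕ.+ (F′ ℕ.+ l)                          ∎)
    where
    open ≡-Reasoning
    shuffle₁ : ∀ l′ l F′ c j → l′ ℕ.+ ((c ℕ.+ j) ℕ.+ (c ℕ.+ j)) ℕ.+ (F′ ℕ.+ l) ≡ (l′ ℕ.+ F′ ℕ.+ (c ℕ.+ c)) ℕ.+ (l ℕ.+ (j ℕ.+ j))
    shuffle₁ = ℕ-solve-∀
    shuffle₂ : ∀ l F F′ N → (l ℕ.+ F ℕ.+ 1) ℕ.+ (N ℕ.+ F′) ≡ 1 ℕ.+ N ℕ.+ F ℕ.+ (F′ ℕ.+ l)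
    shuffle₂ = ℕ-solve-∀

  -- Induction along the branch selected by f. Unlike in `count-linked₂`, where N is only a bound,
  -- here 2N must be the exact number of sides, because N enters Euler's relation.
  runs-outcome : ∀ N S K f → Pairing f (labels S K) → length (labels S K) ≡ N ℕ.+ N → Unlinked N S K f ⊎ Linked N S K f
  runs-outcome zero [] [] f H size = inj₂ (record
    { joined = 0 ; cycles = [] ; runs-eq = λ { zero → refl ; (suc d) → refl } ; edges = ↭-refl ; euler = refl
    ; crossing = λ K≢[] → ⊥-elim (K≢[] refl) })
  runs-outcome N [] (_ ∷ _) f H size = inj₁ (record { K-nonempty = λ () ; runs-eq = λ d → refl ; preserved = λ () })
  runs-outcome N ([] ∷ S) K f H size with runs-outcome N S K f H size
  ... | inj₁ O = inj₁ (record { K-nonempty = Unlinked.K-nonempty O ; runs-eq = Unlinked.runs-eq O ; preserved = Unlinked.preserved O })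
  ... | inj₂ O = inj₂ (record
    { joined = Linked.joined O ; cycles = Linked.cycles O ; runs-eq = Linked.runs-eq O ; edges = Linked.edges O
    ; euler = Linked.euler O ; crossing = Linked.crossing O })
  runs-outcome (suc N) ((a ∷ P) ∷ S) K f H size with closed H (here refl)
  ... | here fa≡a = ⊥-elim (fixed-free H (here refl) fa≡a)
  ... | there i
    with (b , c , S′ , K′) , y∈ , fa ← ∈-map⁻ proj₁
           (subst (f a ∈_) (trans (Listₚ.++-assoc P (concat S) K) (sym (targets-moves P S K))) i) = result
    where
    move : IsMove P S K (b , c , S′ , K′)
    move = ∈-moves P S K y∈
    fb : f b ≡ a
    fb = trans (cong f (sym fa)) (involutive H (here refl))
    smaller : length (labels S′ K′) ≡ N ℕ.+ N
    smaller = ℕₚ.suc-injective (ℕₚ.suc-injective (trans (sym (Permₚ.↭-length (labels-move {a} move)))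
      (trans size (cong suc (ℕₚ.+-suc N N)))))
    result : Unlinked (suc N) ((a ∷ P) ∷ S) K f ⊎ Linked (suc N) ((a ∷ P) ∷ S) K f
    result with runs-outcome N S′ K′ f (pairing-step (labels-move move) fa H) smaller
    ... | inj₂ O with cs , edges , count ← move-cycles (Linked.cycles O) move fa fb (Linked.edges O) = inj₂ (record
      { joined   = cost c ℕ.+ Linked.joined O
      ; cycles   = cs
      ; runs-eq  = λ d → trans (runs-move N a P S K f (unique H) y∈ fa fb d) (delay-indicator c (Linked.runs-eq O) d)
      ; edges    = edges
      ; euler    = euler-step (length cs) (length (Linked.cycles O)) (faces ((a ∷ P) ∷ S) K) (faces S′ K′) (cost c) (Linked.joined O) N
                     count (Linked.euler O)
      ; crossing = crossing
      })
      where
      crossing : K ≢ [] → ∃ λ x → x ∈ concat ((a ∷ P) ∷ S) × f x ∈ K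
      crossing K≢[] with move-inside {a} move
      ... | inj₂ (_ , b∈K) = a , here refl , subst (_∈ K) (sym fa) b∈K
      ... | inj₁ (refl , perm) with x , x∈ , fx∈ ← Linked.crossing O K≢[] =
        x , Permₚ.∈-resp-↭ (↭-sym perm) (there (there x∈)) , fx∈
    ... | inj₁ O with move-inside {a} move
    -- A crossing has emptied K, so the remaining run cannot be unlinked.
    ...   | inj₂ (refl , b∈K) = ⊥-elim (Unlinked.K-nonempty O refl)
    ...   | inj₁ (refl , perm) = inj₁ (record
      { K-nonempty = Unlinked.K-nonempty O
      ; runs-eq   = λ d → trans (runs-move N a P S K f (unique H) y∈ fa fb d) (delay-zero c (Unlinked.runs-eq O) d)
      ; preserved = preserved
      })
      where
      preserved : ∀ {x} → x ∈ concat ((a ∷ P) ∷ S) → f x ∈ concat ((a ∷ P) ∷ S)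
      preserved x∈ with Permₚ.∈-resp-↭ perm x∈
      ... | here refl         = Permₚ.∈-resp-↭ (↭-sym perm) (there (here fa))
      ... | there (here refl) = Permₚ.∈-resp-↭ (↭-sym perm) (here fb)
      ... | there (there j)   = Permₚ.∈-resp-↭ (↭-sym perm) (there (there (Unlinked.preserved O j)))

  -- numCycles, reach and tau

  T⇒≡true : ∀ {b} → T b → b ≡ true
  T⇒≡true {true} _ = refl

  ≡true⇒T : ∀ {b} → b ≡ true → T b
  ≡true⇒T refl = tt

  ¬T⇒≡false : ∀ {b} → ¬ T b → b ≡ false
  ¬T⇒≡false {true}  ¬t = ⊥-elim (¬t tt)
  ¬T⇒≡false {false} ¬t = refl

  ∑-filterᵇ : {A : Set} (p : A → Bool) (xs : List A) → + length (filterᵇ p xs) ≡ ∑ xs (λ x → ⟨ p x ⟩)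
  ∑-filterᵇ p []       = refl
  ∑-filterᵇ p (x ∷ xs) with p x
  ... | true  = cong (_+_ 1ℤ) (∑-filterᵇ p xs)
  ... | false = trans (∑-filterᵇ p xs) (sym (ℤₚ.+-identityˡ _))

  -- Counting cycles by their minima

  iter-suc : ∀ σ k s → iter σ k (σ s) ≡ iter σ (suc k) s
  iter-suc σ zero    s = refl
  iter-suc σ (suc k) s = cong σ (iter-suc σ k s)

  Follows : (ℕ → ℕ) → Edge → Set
  Follows σ (x , y) = y ≡ σ x

  follow-path : ∀ {σ} s Q t → All (Follows σ) (path (λ x → x) s Q t) → ∀ {y} → y ∈ Q ++ t ∷ [] →
    ∃ λ k → k ≤ length Q × iter σ (suc k) s ≡ y
  follow-path s []      t (e ∷ []) (here refl) = 0 , z≤n , sym e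
  follow-path s (q ∷ Q) t (e ∷ es) (here refl) = 0 , z≤n , sym e
  follow-path {σ} s (q ∷ Q) t (e ∷ es) (there i) with k , k≤ , eq ← follow-path q Q t es i =
    suc k , s≤s k≤ , trans (sym (iter-suc σ (suc k) s)) (trans (cong (iter σ (suc k)) (sym e)) eq)

  sources-path : ∀ s Q t → map proj₁ (path (λ x → x) s Q t) ≡ s ∷ Q
  sources-path s []      t = refl
  sources-path s (q ∷ Q) t = cong (s ∷_) (sources-path q Q t)

  targets-path : ∀ s Q t → map proj₂ (path (λ x → x) s Q t) ≡ Q ++ t ∷ []
  targets-path s []      t = refl
  targets-path s (q ∷ Q) t = cong (q ∷_) (targets-path q Q t)

  minimum : ∀ q Q → ∃ λ m → m ∈ q ∷ Q × All (m ≤_) (q ∷ Q)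
  minimum q []      = q , here refl , ℕₚ.≤-refl ∷ []
  minimum q (r ∷ Q) with m , m∈ , m≤ ← minimum r Q | ℕₚ.≤-total q m
  ... | inj₁ q≤m = q , here refl , ℕₚ.≤-refl ∷ All.map (ℕₚ.≤-trans q≤m) m≤
  ... | inj₂ m≤q = m , there m∈ , m≤q ∷ m≤

  isMinimum : ℕ → (ℕ → ℕ) → ℕ → Bool
  isMinimum n σ i = all (λ k → i ≤ᵇ iter σ (suc k) i) (upTo n)

  unique-++⁻ : {xs ys : List ℕ} → Unique (xs ++ ys) → Unique xs × Unique ys
  unique-++⁻ {[]}     unique        = [] , unique
  unique-++⁻ {x ∷ xs} (x∉ ∷ unique) with uxs , uys ← unique-++⁻ {xs} unique = Allₚ.++⁻ˡ xs x∉ ∷ uxs , uys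

  module OneCycle (n : ℕ) (σ : ℕ → ℕ) (q : ℕ) (Q : List ℕ) (follows : All (Follows σ) (path (λ x → x) q Q q))
                  (unique : Unique (q ∷ Q)) (short : length (q ∷ Q) ≤ n) where

    C : List ℕ
    C = q ∷ Q

    -- Rotate the cycle to start at x: y is met within one turn (y = x at its end), and `short` fits
    -- the turn into the n iterates that the minimum test inspects.
    reaches : ∀ {x y} → x ∈ C → y ∈ C → ∃ λ k → k < n × iter σ (suc k) x ≡ y
    reaches {x} {y} x∈ y∈
      with X , Y , eq ← ∈-∃++ x∈
      with k , k≤ , e ← follow-path x (Y ++ X) x
             (Permₚ.All-resp-↭ (boundary-rotate (λ x → x) X x Y) (subst (λ L → All (Follows σ) (boundary (λ x → x) L)) eq follows))
             (Permₚ.∈-resp-↭ (↭-trans (↭-reflexive eq) (↭-trans (Permₚ.++-comm X (x ∷ Y)) (Permₚ.∷↭∷ʳ x (Y ++ X)))) y∈) =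
      k , ℕₚ.<-≤-trans (s≤s k≤) (ℕₚ.≤-trans (ℕₚ.≤-reflexive size) short) , e
      where
      size : suc (length (Y ++ X)) ≡ length C
      size = trans (sym (Permₚ.↭-length (Permₚ.++-comm X (x ∷ Y)))) (cong length (sym eq))

    closed-σ : ∀ {x} → x ∈ C → σ x ∈ C
    closed-σ {x} x∈ with (x , y) , e∈ , refl ← ∈-map⁻ proj₁ (subst (x ∈_) (sym (sources-path q Q q)) x∈) =
      Permₚ.∈-resp-↭ (↭-sym (Permₚ.∷↭∷ʳ q Q))
        (subst (_∈ Q ++ q ∷ []) (All.lookup follows e∈) (subst (y ∈_) (targets-path q Q q) (∈-map⁺ proj₂ e∈)))

    closed-iter : ∀ k {x} → x ∈ C → iter σ k x ∈ C
    closed-iter zero    x∈ = x∈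
    closed-iter (suc k) x∈ = closed-σ (closed-iter k x∈)

    isMinimum-indicator : ∀ {m} → m ∈ C → All (m ≤_) C → ∀ {x} → x ∈ C → isMinimum n σ x ≡ (m ≡ᵇ x)
    isMinimum-indicator {m} m∈ m≤ {x} x∈ with m ℕ.≟ x
    ... | yes refl = trans (T⇒≡true (Allₚ.all⁻ _ (All.tabulate {xs = upTo n} (λ {k} _ →
            ℕₚ.≤⇒≤ᵇ (All.lookup m≤ (closed-iter (suc k) x∈)))))) (sym (≡ᵇ-refl m))
    ... | no  m≢x  = trans (¬T⇒≡false not-minimum) (sym (≡ᵇ-≢ m≢x))
      where
      not-minimum : ¬ T (isMinimum n σ x)
      not-minimum t with k , k<n , e ← reaches x∈ m∈ =
        m≢x (ℕₚ.≤-antisym (All.lookup m≤ x∈)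
          (subst (x ≤_) e (ℕₚ.≤ᵇ⇒≤ x _ (All.lookup (Allₚ.all⁺ _ (upTo n) t) (∈-upTo⁺ k<n)))))

    ∑-isMinimum : ∑ C (λ x → ⟨ isMinimum n σ x ⟩) ≡ 1ℤ
    ∑-isMinimum with m , m∈ , m≤ ← minimum q Q = trans
      (∑-cong-∈ C (λ x∈ → trans (cong ⟨_⟩ (isMinimum-indicator m∈ m≤ x∈)) (sym (ℤₚ.*-identityʳ _))))
      (∑-single (λ x → x) C (λ _ → 1ℤ) m∈ (subst Unique (sym (Listₚ.map-id C)) unique))

  elements : List Cycle → List ℕ
  elements cs = concat (map (λ (q , Q) → q ∷ Q) cs)

  sources-cycles : ∀ cs → map proj₁ (cycle-edges cs) ≡ elements cs
  sources-cycles []             = refl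
  sources-cycles ((q , Q) ∷ cs) = trans (Listₚ.map-++ proj₁ (path (λ x → x) q Q q) (cycle-edges cs))
    (cong₂ _++_ (sources-path q Q q) (sources-cycles cs))

  ∑-elements : ∀ n σ cs → All (Follows σ) (cycle-edges cs) → Unique (elements cs) → length (elements cs) ≤ n →
    ∑ (elements cs) (λ x → ⟨ isMinimum n σ x ⟩) ≡ + length cs
  ∑-elements n σ []             follows unique short = refl
  ∑-elements n σ ((q , Q) ∷ cs) follows unique short = trans (∑-++ (q ∷ Q) (elements cs) (λ x → ⟨ isMinimum n σ x ⟩)) (cong₂ _+_
    (OneCycle.∑-isMinimum n σ q Q (Allₚ.++⁻ˡ (path (λ x → x) q Q q) follows) (proj₁ (unique-++⁻ {q ∷ Q} unique))
      (ℕₚ.≤-trans (ℕₚ.m≤m+n _ _) sizes))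
    (∑-elements n σ cs (Allₚ.++⁻ʳ (path (λ x → x) q Q q) follows) (proj₂ (unique-++⁻ {q ∷ Q} unique))
      (ℕₚ.≤-trans (ℕₚ.m≤n+m _ _) sizes)))
    where
    sizes : length (q ∷ Q) ℕ.+ length (elements cs) ≤ n
    sizes = ℕₚ.≤-trans (ℕₚ.≤-reflexive (sym (Listₚ.length-++ (q ∷ Q)))) short

  elements-↭ : ∀ n (σ : ℕ → ℕ) cs → cycle-edges cs ↭ map (λ i → i , σ i) (upTo n) → elements cs ↭ upTo n
  elements-↭ n σ cs perm = ↭-trans (↭-reflexive (sym (sources-cycles cs))) (↭-trans (Permₚ.map⁺ proj₁ perm)
    (↭-reflexive (trans (sym (Listₚ.map-∘ (upTo n))) (Listₚ.map-id (upTo n)))))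

  -- If the edges form the graph of σ, their sources list 0, ..., n - 1 without repetition, and each
  -- listed cycle contains exactly one point passing the minimum test.
  numCycles-length : ∀ n σ cs → cycle-edges cs ↭ map (λ i → i , σ i) (upTo n) → numCycles n σ ≡ length cs
  numCycles-length n σ cs perm = ℤₚ.+-injective (trans (∑-filterᵇ (isMinimum n σ) (upTo n))
    (trans (sym (∑-↭ _ (elements-↭ n σ cs perm)))
      (∑-elements n σ cs
        (Permₚ.All-resp-↭ (↭-sym perm) (Allₚ.map⁺ (All.universal {P = λ i → Follows σ (i , σ i)} (λ i → refl) (upTo n))))
        (Unique-resp-↭ (↭-sym (elements-↭ n σ cs perm)) (Uniqueₚ.upTo⁺ n))
        (ℕₚ.≤-reflexive (trans (Permₚ.↭-length (elements-↭ n σ cs perm)) (Listₚ.length-upTo n))))))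

  -- The two initial faces and their boundary edges

  interval : ℕ → ℕ → List ℕ
  interval s zero    = []
  interval s (suc k) = s ∷ interval (suc s) k

  length-interval : ∀ s k → length (interval s k) ≡ k
  length-interval s zero    = refl
  length-interval s (suc k) = cong suc (length-interval (suc s) k)

  interval-++ : ∀ s k l → interval s (k ℕ.+ l) ≡ interval s k ++ interval (s ℕ.+ k) l
  interval-++ s zero    l = cong (λ t → interval t l) (sym (ℕₚ.+-identityʳ s))
  interval-++ s (suc k) l = cong (s ∷_) (trans (interval-++ (suc s) k l)
    (cong (λ t → interval (suc s) k ++ interval t l) (sym (ℕₚ.+-suc s k))))

  applyUpTo-interval : ∀ s k → applyUpTo (s ℕ.+_) k ≡ interval s k
  applyUpTo-interval s zero    = refl
  applyUpTo-interval s (suc k) = cong₂ _∷_ (ℕₚ.+-identityʳ s) (trans (applyUpTo-cong k (ℕₚ.+-suc s)) (applyUpTo-interval (suc s) k))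
    where
    applyUpTo-cong : ∀ k {f g : ℕ → ℕ} → (∀ i → f i ≡ g i) → applyUpTo f k ≡ applyUpTo g k
    applyUpTo-cong zero    eq = refl
    applyUpTo-cong (suc k) eq = cong₂ _∷_ (eq 0) (applyUpTo-cong k (λ i → eq (suc i)))

  ∈-interval⁻ : ∀ s k {x} → x ∈ interval s k → s ≤ x × x < s ℕ.+ k
  ∈-interval⁻ s (suc k) (here refl) = ℕₚ.≤-refl , ℕₚ.m<m+n s (s≤s z≤n)
  ∈-interval⁻ s (suc k) {x} (there i) with s<x , x< ← ∈-interval⁻ (suc s) k i =
    ℕₚ.<⇒≤ s<x , subst (x <_) (sym (ℕₚ.+-suc s k)) x<

  path-interval : ∀ f τ s k t → (∀ i → s ≤ i → i < s ℕ.+ k → τ i ≡ suc i) → τ (s ℕ.+ k) ≡ t →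
    path f (f s) (interval (suc s) k) t ≡ map (λ i → f i , τ i) (interval s (suc k))
  path-interval f τ s zero    t next last = cong (λ t → (f s , t) ∷ []) (trans (sym last) (cong τ (ℕₚ.+-identityʳ s)))
  path-interval f τ s (suc k) t next last = cong₂ _∷_
    (cong (f s ,_) (sym (next s ℕₚ.≤-refl (ℕₚ.m<m+n s (s≤s z≤n)))))
    (path-interval f τ (suc s) k t (λ i s<i i< → next i (ℕₚ.<⇒≤ s<i) (subst (i <_) (sym (ℕₚ.+-suc s k)) i<))
      (trans (cong τ (sym (ℕₚ.+-suc s k))) last))

  <ᵇ-true : ∀ {i m} → i < m → (i <ᵇ m) ≡ true
  <ᵇ-true i<m = T⇒≡true (ℕₚ.<⇒<ᵇ i<m)

  <ᵇ-false : ∀ {i m} → m ≤ i → (i <ᵇ m) ≡ false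
  <ᵇ-false {i} {m} m≤i = ¬T⇒≡false (λ t → ℕₚ.<⇒≱ (ℕₚ.<ᵇ⇒< i m t) m≤i)

  module Tau (m n : ℕ) where

    tau-first : ∀ {i} → suc i < m → tau m n i ≡ suc i
    tau-first {i} i< rewrite <ᵇ-true (ℕₚ.<-trans (ℕₚ.n<1+n i) i<) | ≡ᵇ-≢ (ℕₚ.<⇒≢ i<) = refl

    tau-first-last : ∀ {i} → suc i ≡ m → tau m n i ≡ 0
    tau-first-last {i} refl rewrite <ᵇ-true (ℕₚ.n<1+n i) | ≡ᵇ-refl i = refl

    tau-second : ∀ {i} → m ≤ i → suc i < n → tau m n i ≡ suc i
    tau-second m≤i i< rewrite <ᵇ-false m≤i | ≡ᵇ-≢ (ℕₚ.<⇒≢ i<) = refl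

    tau-second-last : ∀ {i} → m ≤ i → suc i ≡ n → tau m n i ≡ m
    tau-second-last {i} m≤i refl rewrite <ᵇ-false m≤i | ≡ᵇ-refl i = refl

    tau-preserves : ∀ {i} → i < m → tau m n i < m
    tau-preserves {i} i<m with suc i ℕ.≟ m
    ... | yes e  = subst (_< m) (sym (tau-first-last e)) (ℕₚ.≤-<-trans z≤n i<m)
    ... | no  ne = subst (_< m) (sym (tau-first (ℕₚ.≤∧≢⇒< i<m ne))) (ℕₚ.≤∧≢⇒< i<m ne)

  boundary-tau : ∀ f a b →
    boundaries f (interval 0 (suc a) ∷ []) ++ boundary f (interval (suc a) (suc b)) ≡
    map (λ i → f i , tau (suc a) (suc a ℕ.+ suc b) i) (interval 0 (suc a ℕ.+ suc b))
  boundary-tau f a b = begin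
    (boundary f (interval 0 (suc a)) ++ []) ++ boundary f (interval (suc a) (suc b))
      ≡⟨ cong (_++ boundary f (interval (suc a) (suc b))) (Listₚ.++-identityʳ (boundary f (interval 0 (suc a)))) ⟩
    boundary f (interval 0 (suc a)) ++ boundary f (interval (suc a) (suc b))
      ≡⟨ cong₂ _++_
           (path-interval f (tau m n) 0 a 0 (λ i _ i<a → tau-first (s≤s i<a)) (tau-first-last refl))
           (path-interval f (tau m n) m b m (λ i m≤i i< → tau-second m≤i (subst (suc i <_) (sym (ℕₚ.+-suc m b)) (s≤s i<)))
              (tau-second-last (ℕₚ.m≤m+n m b) (sym (ℕₚ.+-suc m b)))) ⟩
    map (λ i → f i , tau m n i) (interval 0 m) ++ map (λ i → f i , tau m n i) (interval m (suc b))
      ≡⟨ sym (Listₚ.map-++ _ (interval 0 m) (interval m (suc b))) ⟩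
    map (λ i → f i , tau m n i) (interval 0 m ++ interval m (suc b))
      ≡⟨ cong (map (λ i → f i , tau m n i)) (sym (interval-++ 0 m (suc b))) ⟩
    map (λ i → f i , tau m n i) (interval 0 n) ∎
    where
    open ≡-Reasoning
    m n : ℕ
    m = suc a
    n = suc a ℕ.+ suc b
    open Tau m n

  pairing-↭ : ∀ {f L} → Pairing f L → map f L ↭ L
  pairing-↭ {f} {L} H = ∼bag⇒↭ (unique∧set⇒bag unique-map (unique H) (mk⇔ to from))
    where
    twice : ∀ {L′} → (∀ {x} → x ∈ L′ → f (f x) ≡ x) → map f (map f L′) ≡ L′
    twice {[]}     inv = refl
    twice {x ∷ L′} inv = cong₂ _∷_ (inv (here refl)) (twice (inv ∘ there))
    unique-map : Unique (map f L)
    unique-map = Uniqueₚ.map⁻ (subst Unique (sym (twice (involutive H))) (unique H))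
    to : ∀ {x} → x ∈ map f L → x ∈ L
    to i with y , y∈ , refl ← ∈-map⁻ f i = closed H y∈
    from : ∀ {x} → x ∈ L → x ∈ map f L
    from i = subst (_∈ map f L) (involutive H i) (∈-map⁺ f (closed H i))

  -- Reindexing by f, which permutes L, turns the face edges (f i , τ i) into the graph of τ ∘ f.
  pairing-edges : ∀ {f L} (τ : ℕ → ℕ) → Pairing f L → map (λ i → f i , τ i) L ↭ map (λ i → i , τ (f i)) L
  pairing-edges {f} {L} τ H = ↭-trans (Permₚ.map⁺ (λ i → f i , τ i) (↭-sym (pairing-↭ H)))
    (↭-reflexive (trans (sym (Listₚ.map-∘ L)) (lemma (involutive H))))
    where
    lemma : ∀ {L′} → (∀ {x} → x ∈ L′ → f (f x) ≡ x) → map (λ i → f (f i) , τ (f i)) L′ ≡ map (λ i → i , τ (f i)) L′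
    lemma {[]}     inv = refl
    lemma {x ∷ L′} inv = cong₂ _∷_ (cong (_, τ (f x)) (inv (here refl))) (lemma (inv ∘ there))

  -- Transitivity and crossing pairs

  module Reach (n : ℕ) (f g : ℕ → ℕ) where

    reach-weaken : ∀ k {i} → T (reach n f g k i) → T (reach n f g (suc k) i)
    reach-weaken k {i} t rewrite T⇒≡true t = tt

    reach-mono : ∀ {k l i} → k ≤ l → T (reach n f g k i) → T (reach n f g l i)
    reach-mono {k} {l} k≤l t with l ∸ k | ℕₚ.m∸n+n≡m k≤l
    ... | d | refl = go d
      where
      go : ∀ d → T (reach n f g (d ℕ.+ k) _)
      go zero    = t
      go (suc d) = reach-weaken (d ℕ.+ k) (go d)

    reach-step : ∀ k {j i} → j < n → T (reach n f g k j) → f j ≡ i ⊎ g j ≡ i → T (reach n f g (suc k) i)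
    reach-step k {j} {i} j<n t e = ≡true⇒T (trans (cong (reach n f g k i ∨_) (T⇒≡true
      (Anyₚ.any⁺ _ (lose (∈-upTo⁺ j<n) (≡true⇒T (cong₂ _∧_ (T⇒≡true t) (edge e))))))) (Boolₚ.∨-zeroʳ _))
      where
      edge : f j ≡ i ⊎ g j ≡ i → ((f j ≡ᵇ i) ∨ (g j ≡ᵇ i)) ≡ true
      edge (inj₁ refl) = cong (_∨ (g j ≡ᵇ i)) (≡ᵇ-refl i)
      edge (inj₂ refl) = trans (cong ((f j ≡ᵇ i) ∨_) (≡ᵇ-refl i)) (Boolₚ.∨-zeroʳ _)

    reach-invariant : (I : ℕ → Set) → I 0 → (∀ {j} → j < n → I j → I (f j)) → (∀ {j} → j < n → I j → I (g j)) →
      ∀ k {i} → T (reach n f g k i) → I i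
    reach-invariant I I0 If Ig zero    {i} t = subst I (sym (ℕₚ.≡ᵇ⇒≡ i 0 t)) I0
    reach-invariant I I0 If Ig (suc k) {i} t with Equivalence.to Boolₚ.T-∨ t
    ... | inj₁ t₁ = reach-invariant I I0 If Ig k t₁
    ... | inj₂ t₂ with j , j∈ , t₃ ← find (Anyₚ.any⁻ _ (upTo n) t₂)
        with r , e ← Equivalence.to Boolₚ.T-∧ t₃
        with Equivalence.to Boolₚ.T-∨ e
    ...   | inj₁ ef = subst I (ℕₚ.≡ᵇ⇒≡ (f j) i ef) (If (∈-upTo⁻ j∈) (reach-invariant I I0 If Ig k r))
    ...   | inj₂ eg = subst I (ℕₚ.≡ᵇ⇒≡ (g j) i eg) (Ig (∈-upTo⁻ j∈) (reach-invariant I I0 If Ig k r))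

  module Transitivity (a b : ℕ) (f : ℕ → ℕ) where

    m n : ℕ
    m = suc a
    n = suc a ℕ.+ suc b

    open Tau m n
    open Reach n f (tau m n)

    m<n : m < n
    m<n = ℕₚ.m<m+n m (s≤s z≤n)

    preserved⇒¬transitive : (∀ {x} → x < m → f x < m) → isTransitive n f (tau m n) ≡ false
    preserved⇒¬transitive preserved = ¬T⇒≡false (λ t → ℕₚ.<-irrefl refl
      (reach-invariant (_< m) (s≤s z≤n) (λ _ → preserved) (λ _ → tau-preserves) n
        (All.lookup (Allₚ.all⁺ _ (upTo n) t) (∈-upTo⁺ m<n))))

    reach-first : ∀ i → i < m → T (reach n f (tau m n) i i)
    reach-first zero    i<m = tt
    reach-first (suc i) i<m = reach-step i (ℕₚ.<-trans (ℕₚ.<-trans (ℕₚ.n<1+n i) i<m) m<n)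
      (reach-first i (ℕₚ.<-trans (ℕₚ.n<1+n i) i<m)) (inj₂ (tau-first i<m))

    reach-second : ∀ k y d → m ≤ y → y ℕ.+ d < n → T (reach n f (tau m n) k y) → T (reach n f (tau m n) (k ℕ.+ d) (y ℕ.+ d))
    reach-second k y zero    m≤y y<n t = subst (λ i → T (reach n f (tau m n) i (y ℕ.+ 0))) (sym (ℕₚ.+-identityʳ k))
      (subst (λ i → T (reach n f (tau m n) k i)) (sym (ℕₚ.+-identityʳ y)) t)
    reach-second k y (suc d) m≤y y<n t = subst (λ i → T (reach n f (tau m n) i (y ℕ.+ suc d))) (sym (ℕₚ.+-suc k d))
      (reach-step (k ℕ.+ d) (ℕₚ.<-trans (ℕₚ.n<1+n _) bound) (reach-second k y d m≤y (ℕₚ.<-trans (ℕₚ.n<1+n _) bound) t)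
        (inj₂ (trans (tau-second (ℕₚ.≤-trans m≤y (ℕₚ.m≤m+n y d)) bound) (sym (ℕₚ.+-suc y d)))))
      where
      bound : suc (y ℕ.+ d) < n
      bound = subst (_< n) (ℕₚ.+-suc y d) y<n

    module _ {x : ℕ} (x<m : x < m) (m≤fx : m ≤ f x) (fx<n : f x < n) where

      reach-fx : T (reach n f (tau m n) (suc x) (f x))
      reach-fx = reach-step x (ℕₚ.<-trans x<m m<n) (reach-first x x<m) (inj₁ refl)

      reach-m : T (reach n f (tau m n) (suc (suc x ℕ.+ (pred n ∸ f x))) m)
      reach-m = reach-step (suc x ℕ.+ (pred n ∸ f x)) (ℕₚ.≤-reflexive (cong suc last))
        (reach-second (suc x) (f x) (pred n ∸ f x) m≤fx (ℕₚ.≤-reflexive (cong suc last)) reach-fx)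
        (inj₂ (tau-second-last (ℕₚ.≤-trans m≤fx (ℕₚ.m≤m+n (f x) _)) (cong suc last)))
        where
        last : f x ℕ.+ (pred n ∸ f x) ≡ pred n
        last = ℕₚ.m+[n∸m]≡n (ℕₚ.<⇒≤pred fx<n)

      -- The route must fit into n steps: along the first face to x, across to f x, then along the
      -- second face. Points before f x are reached only after wrapping round to m; then x < m and z
      -- < f x keep the total within n.
      reach-all : ∀ {z} → z < n → T (reach n f (tau m n) n z)
      reach-all {z} z<n with z <? m | f x ℕ.≤? z
      ... | yes z<m | _         = reach-mono (ℕₚ.<⇒≤ z<n) (reach-first z z<m)
      ... | no  z≮m | yes fx≤z = reach-mono steps
        (subst (λ i → T (reach n f (tau m n) (suc x ℕ.+ (z ∸ f x)) i)) (ℕₚ.m+[n∸m]≡n fx≤z)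
          (reach-second (suc x) (f x) (z ∸ f x) m≤fx (subst (_< n) (sym (ℕₚ.m+[n∸m]≡n fx≤z)) z<n) reach-fx))
        where
        steps : suc x ℕ.+ (z ∸ f x) ≤ n
        steps = ℕₚ.≤-trans (ℕₚ.+-monoˡ-≤ (z ∸ f x) (ℕₚ.≤-trans x<m m≤fx))
          (ℕₚ.≤-trans (ℕₚ.≤-reflexive (ℕₚ.m+[n∸m]≡n fx≤z)) (ℕₚ.<⇒≤ z<n))
      ... | no  z≮m | no  fx≰z = reach-mono steps
        (subst (λ i → T (reach n f (tau m n) (suc (suc x ℕ.+ (pred n ∸ f x)) ℕ.+ (z ∸ m)) i)) (ℕₚ.m+[n∸m]≡n m≤z)
          (reach-second (suc (suc x ℕ.+ (pred n ∸ f x))) m (z ∸ m) ℕₚ.≤-refl (subst (_< n) (sym (ℕₚ.m+[n∸m]≡n m≤z)) z<n) reach-m))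
        where
        m≤z : m ≤ z
        m≤z = ℕₚ.≮⇒≥ z≮m
        z<fx : z < f x
        z<fx = ℕₚ.≰⇒> fx≰z
        regroup : ∀ x p z → suc (suc x ℕ.+ p) ℕ.+ z ≡ suc ((suc x ℕ.+ z) ℕ.+ p)
        regroup = ℕ-solve-∀
        steps : suc (suc x ℕ.+ (pred n ∸ f x)) ℕ.+ (z ∸ m) ≤ n
        steps = begin
          suc (suc x ℕ.+ (pred n ∸ f x)) ℕ.+ (z ∸ m)   ≡⟨ regroup x (pred n ∸ f x) (z ∸ m) ⟩
          suc ((suc x ℕ.+ (z ∸ m)) ℕ.+ (pred n ∸ f x)) ≤⟨ s≤s (ℕₚ.+-monoˡ-≤ (pred n ∸ f x) (ℕₚ.+-monoˡ-≤ (z ∸ m) x<m)) ⟩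
          suc ((m ℕ.+ (z ∸ m)) ℕ.+ (pred n ∸ f x))     ≡⟨ cong (λ t → suc (t ℕ.+ (pred n ∸ f x))) (ℕₚ.m+[n∸m]≡n m≤z) ⟩
          suc (z ℕ.+ (pred n ∸ f x))                   ≤⟨ s≤s (ℕₚ.+-monoˡ-≤ (pred n ∸ f x) (ℕₚ.<⇒≤ z<fx)) ⟩
          suc (f x ℕ.+ (pred n ∸ f x))                 ≡⟨ cong suc (ℕₚ.m+[n∸m]≡n (ℕₚ.<⇒≤pred fx<n)) ⟩
          n                                            ∎
          where open ℕₚ.≤-Reasoning

      crossing⇒transitive : isTransitive n f (tau m n) ≡ true
      crossing⇒transitive = T⇒≡true (Allₚ.all⁻ _ (All.tabulate {xs = upTo n} (λ z∈ → reach-all (∈-upTo⁻ z∈))))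

  -- From gluing data to runs

  fpf⇒pairing : ∀ {n} (v : Vec (Fin n) n) → isFPFInvolution v ≡ true → Pairing (app v) (upTo n)
  fpf⇒pairing {n} v fpf = record
    { unique     = Uniqueₚ.upTo⁺ n
    ; closed     = λ x∈ → ∈-upTo⁺ (app< (∈-upTo⁻ x∈))
    ; fixed-free = λ {x} x∈ e → subst (T ∘ not) (trans (cong (_≡ᵇ x) e) (≡ᵇ-refl x)) (proj₁ (conditions x∈))
    ; involutive = λ {x} x∈ → ℕₚ.≡ᵇ⇒≡ _ x (proj₂ (conditions x∈))
    }
    where
    app< : ∀ {i} → i < n → app v i < n
    app< {i} i<n with i <? n
    ... | yes p = Finₚ.toℕ<n _
    ... | no ¬p = ⊥-elim (¬p i<n)
    conditions : ∀ {x} → x ∈ upTo n → T (not (app v x ≡ᵇ x)) × T (app v (app v x) ≡ᵇ x)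
    conditions x∈ = Equivalence.to Boolₚ.T-∧ (All.lookup (Allₚ.all⁺ _ (upTo n) (≡true⇒T fpf)) x∈)

  involutive⇒fpf : ∀ {n} (v : Vec (Fin n) n) → (∀ {x} → x ∈ upTo n → app v x ≢ x × app v (app v x) ≡ x) →
    isFPFInvolution v ≡ true
  involutive⇒fpf {n} v H = T⇒≡true (Allₚ.all⁻ _ (All.tabulate {xs = upTo n} (λ {x} x∈ → ≡true⇒T
    (cong₂ _∧_ (cong not (≡ᵇ-≢ (proj₁ (H x∈)))) (trans (cong (_≡ᵇ x) (proj₂ (H x∈))) (≡ᵇ-refl x))))))

  -- Euler's relation V + 2j = N + 2 turns the vertex count N ∸ 2 of a torus into j = 2 joins;
  -- V ≥ 1 rules out the truncated case N = 1.
  euler-genus-1 : ∀ N l j → 1 ≤ N → 1 ≤ l → l ℕ.+ (j ℕ.+ j) ≡ N ℕ.+ 2 → (l ≡ᵇ N ∸ 2) ≡ (j ≡ᵇ 2)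
  euler-genus-1 (suc zero)    (suc l) j _ _ e = sym (≡ᵇ-≢ {j} {2} λ { refl → no-solution l e })
    where
    no-solution : ∀ l → ¬ (suc l ℕ.+ 4 ≡ 3)
    no-solution l e with s≤s (s≤s (s≤s ())) ← subst (4 ≤_) e (ℕₚ.m≤n+m 4 (suc l))
  euler-genus-1 (suc (suc N)) l j _ _ e with j ℕ.≟ 2
  ... | yes refl = trans (cong (_≡ᵇ N) (ℕₚ.+-cancelʳ-≡ 4 l N (trans e (regroup N)))) (≡ᵇ-refl N)
    where
    regroup : ∀ N → 2 ℕ.+ N ℕ.+ 2 ≡ N ℕ.+ 4
    regroup = ℕ-solve-∀
  ... | no j≢2 = trans (≡ᵇ-≢ l≢N) (sym (≡ᵇ-≢ j≢2))
    where
    regroup : ∀ N → 2 ℕ.+ N ℕ.+ 2 ≡ N ℕ.+ 4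
    regroup = ℕ-solve-∀
    half : ∀ j → j ℕ.+ j ≡ 4 → j ≡ 2
    half 2 _ = refl
    half 1 ()
    half (suc (suc (suc j))) e
      with s≤s (s≤s (s≤s (s≤s ()))) ← subst (6 ≤_) e (ℕₚ.+-mono-≤ {3} {3 ℕ.+ j} {3} {3 ℕ.+ j} (ℕₚ.m≤m+n 3 j) (ℕₚ.m≤m+n 3 j))
    l≢N : l ≢ N
    l≢N refl = j≢2 (half j (ℕₚ.+-cancelˡ-≡ N (j ℕ.+ j) 4 (trans e (regroup N))))

  initial-labels : ∀ a b → labels (interval 0 (suc a) ∷ []) (interval (suc a) (suc b)) ≡ upTo (suc a ℕ.+ suc b)
  initial-labels a b = trans (cong (_++ interval (suc a) (suc b)) (Listₚ.++-identityʳ (interval 0 (suc a))))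
    (trans (sym (interval-++ 0 (suc a) (suc b))) (sym (applyUpTo-interval 0 (suc a ℕ.+ suc b))))

  cycles-nonempty : ∀ {n} (σ : ℕ → ℕ) cs → cycle-edges cs ↭ map (λ i → i , σ i) (upTo (suc n)) → 1 ≤ length cs
  cycles-nonempty σ []       perm with () ← Permₚ.¬x∷xs↭[] (↭-sym perm)
  cycles-nonempty σ (c ∷ cs) perm = s≤s z≤n

  -- Without a crossing pair both sides are 0. With one, transitivity holds, the rebuilt cycles give
  -- `numCycles`, and Euler's relation translates the vertex count into the number of joins.
  pairing-genus1 : ∀ N a b f → 1 ≤ N → suc a ℕ.+ suc b ≡ N ℕ.+ N → Pairing f (upTo (suc a ℕ.+ suc b)) →
    ⟨ isTransitive (suc a ℕ.+ suc b) f (tau (suc a) (suc a ℕ.+ suc b)) ∧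
      (numCycles (suc a ℕ.+ suc b) (λ i → tau (suc a) (suc a ℕ.+ suc b) (f i)) ≡ᵇ N ∸ 2) ⟩ ≡
    runs N (interval 0 (suc a) ∷ []) (interval (suc a) (suc b)) f 2
  pairing-genus1 N a b f 1≤N size H
    with runs-outcome N (interval 0 (suc a) ∷ []) (interval (suc a) (suc b)) f
           (subst (Pairing f) (sym (initial-labels a b)) H)
           (trans (cong length (initial-labels a b)) (trans (Listₚ.length-upTo _) size))
  ... | inj₁ O = trans
    (cong (λ t → ⟨ t ∧ (numCycles (suc a ℕ.+ suc b) (λ i → tau (suc a) (suc a ℕ.+ suc b) (f i)) ≡ᵇ N ∸ 2) ⟩)
          (Transitivity.preserved⇒¬transitive a b f preserved))
    (sym (Unlinked.runs-eq O 2))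
    where
    first : ∀ {x} → x < suc a → x ∈ concat (interval 0 (suc a) ∷ [])
    first {x} x< = subst (x ∈_) (trans (applyUpTo-interval 0 (suc a)) (sym (Listₚ.++-identityʳ (interval 0 (suc a))))) (∈-upTo⁺ x<)
    preserved : ∀ {x} → x < suc a → f x < suc a
    preserved {x} x< = proj₂ (∈-interval⁻ 0 (suc a) (subst (f x ∈_) (Listₚ.++-identityʳ (interval 0 (suc a))) (Unlinked.preserved O (first x<))))
  ... | inj₂ O with x , x∈ , fx∈ ← Linked.crossing O (λ ()) = begin
    ⟨ isTransitive n f (tau m n) ∧ (numCycles n (λ i → tau m n (f i)) ≡ᵇ N ∸ 2) ⟩
      ≡⟨ cong₂ (λ s t → ⟨ s ∧ (t ≡ᵇ N ∸ 2) ⟩)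
           (Transitivity.crossing⇒transitive a b f
             (proj₂ (∈-interval⁻ 0 m (subst (x ∈_) (Listₚ.++-identityʳ (interval 0 m)) x∈)))
             (proj₁ (∈-interval⁻ m (suc b) fx∈)) (proj₂ (∈-interval⁻ m (suc b) fx∈)))
           (numCycles-length n (λ i → tau m n (f i)) (Linked.cycles O) edges) ⟩
    ⟨ length (Linked.cycles O) ≡ᵇ N ∸ 2 ⟩
      ≡⟨ cong ⟨_⟩ (euler-genus-1 N (length (Linked.cycles O)) (Linked.joined O) 1≤N
           (cycles-nonempty (λ i → tau m n (f i)) (Linked.cycles O) edges) (Linked.euler O)) ⟩
    ⟨ Linked.joined O ≡ᵇ 2 ⟩
      ≡⟨ sym (Linked.runs-eq O 2) ⟩
    runs N (interval 0 m ∷ []) (interval m (suc b)) f 2 ∎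
    where
    open ≡-Reasoning
    m n : ℕ
    m = suc a
    n = suc a ℕ.+ suc b
    edges : cycle-edges (Linked.cycles O) ↭ map (λ i → i , tau m n (f i)) (upTo n)
    edges = ↭-trans (Linked.edges O) (↭-trans
      (↭-reflexive (trans (boundary-tau f a b) (cong (map (λ i → f i , tau m n i)) (sym (applyUpTo-interval 0 n)))))
      (pairing-edges (tau m n) H))

  genus1-runs : ∀ N a b → 1 ≤ N → suc a ℕ.+ suc b ≡ 2 ℕ.* N → (v : Vec (Fin (2 ℕ.* N)) (2 ℕ.* N)) →
    ⟨ isGenus1Datum N (suc a) v ⟩ ≡ runs N (interval 0 (suc a) ∷ []) (interval (suc a) (suc b)) (app v) 2
  genus1-runs N a b 1≤N size v with isFPFInvolution v in fpf
  ... | true  = go (2 ℕ.* N) size (fpf⇒pairing v fpf)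
    where
    -- The number of sides is abstracted from the index 2N of v, so that the size equation can be
    -- matched with `refl`.
    go : ∀ n → suc a ℕ.+ suc b ≡ n → Pairing (app v) (upTo n) →
      ⟨ isTransitive n (app v) (tau (suc a) n) ∧ (numCycles n (λ i → tau (suc a) n (app v i)) ≡ᵇ N ∸ 2) ⟩ ≡
      runs N (interval 0 (suc a) ∷ []) (interval (suc a) (suc b)) (app v) 2
    go _ refl H = pairing-genus1 N a b (app v) 1≤N (trans size (cong (N ℕ.+_) (ℕₚ.+-identityʳ N))) H
  -- A vector that is not a fixed-point-free involution is no datum, and by `runs-involutive` its
  -- run vanishes too.
  ... | false with runs N (interval 0 (suc a) ∷ []) (interval (suc a) (suc b)) (app v) 2 ℤₚ.≟ 0ℤ
  ...   | yes ≡0 = sym ≡0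
  ...   | no  ≢0 = ⊥-elim (Boolₚ.not-¬ fpf (involutive⇒fpf v (λ x∈ →
      runs-involutive N (interval 0 (suc a) ∷ []) (interval (suc a) (suc b)) (app v) 2
        (subst Unique (sym labels-upTo) (Uniqueₚ.upTo⁺ (2 ℕ.* N))) ≢0 (subst (_ ∈_) (sym labels-upTo) x∈))))
    where
    labels-upTo : labels (interval 0 (suc a) ∷ []) (interval (suc a) (suc b)) ≡ upTo (2 ℕ.* N)
    labels-upTo = trans (initial-labels a b) (cong upTo size)

  genus1-count : ∀ N a b → 1 ≤ N → suc a ℕ.+ suc b ≡ 2 ℕ.* N →
    + length (filterᵇ (isGenus1Datum N (suc a)) (allVecs (2 ℕ.* N) (2 ℕ.* N))) ≡ w11 (suc b) (suc a)
  genus1-count N a b 1≤N size = begin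
    + length (filterᵇ (isGenus1Datum N (suc a)) (allVecs n n))
      ≡⟨ ∑-filterᵇ (isGenus1Datum N (suc a)) (allVecs n n) ⟩
    ∑ (allVecs n n) (λ v → ⟨ isGenus1Datum N (suc a) v ⟩)
      ≡⟨ ∑-cong (allVecs n n) (λ v → trans (genus1-runs N a b 1≤N size v) (sym (ℤₚ.*-identityˡ _))) ⟩
    ∑ (allVecs n n) (λ v → agree (app v) [] * runs N (interval 0 (suc a) ∷ []) (interval (suc a) (suc b)) (app v) 2)
      ≡⟨ ∑-runs N (interval 0 (suc a) ∷ []) (interval (suc a) (suc b)) n [] 2 (↭-reflexive (trans (initial-labels a b) (cong upTo size))) [] ⟩
    count N (length (interval 0 (suc a)) ∷ []) (length (interval (suc a) (suc b))) 2
      ≡⟨ cong₂ (λ s t → count N (s ∷ []) t 2) (length-interval 0 (suc a)) (length-interval (suc a) (suc b)) ⟩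
    count N (suc a ∷ []) (suc b) 2
      ≡⟨ count-linked₂ N (suc a ∷ []) b (ℕₚ.≤-reflexive (trans (cong (ℕ._+ suc b) (ℕₚ.+-identityʳ (suc a)))
           (trans size (cong (N ℕ.+_) (ℕₚ.+-identityʳ N))))) ⟩
    linked₂ (suc b) (suc a ∷ [])
      ≡⟨ linked₂-[] (suc b) (suc a) ⟩
    w11 (suc b) (suc a) ∎
    where
    open ≡-Reasoning
    n : ℕ
    n = 2 ℕ.* N

  -- Faces of size 0 and the final summation

  ⊛-zeroʳ : ∀ a {b} → (∀ n → b n ≡ 0ℤ) → ∀ n → (a ⊛ b) n ≡ 0ℤ
  ⊛-zeroʳ a {b} b≡0 n = trans (∑-cong (splits (suc n)) (λ (i , j) → trans (cong (_*_ (a i)) (b≡0 j)) (ℤₚ.*-zeroʳ (a i))))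
    (∑-zero (splits (suc n)))

  ⊛-zeroˡ : ∀ {a} b → (∀ n → a n ≡ 0ℤ) → ∀ n → (a ⊛ b) n ≡ 0ℤ
  ⊛-zeroˡ {a} b a≡0 n = trans (⊛-comm a b n) (⊛-zeroʳ b a≡0 n)

  joins-zeroˡ : ∀ {a} l → (∀ n → a n ≡ 0ℤ) → ∀ n → joins a l n ≡ 0ℤ
  joins-zeroˡ l a≡0 zero    = refl
  joins-zeroˡ l a≡0 (suc n) = trans (cong (_*_ (+ l)) (a≡0 _)) (ℤₚ.*-zeroʳ (+ l))

  joins-zeroʳ : ∀ a n → joins a 0 n ≡ 0ℤ
  joins-zeroʳ a zero    = refl
  joins-zeroʳ a (suc n) = refl

  w2-zero : ∀ n → w2 0 n ≡ 0ℤ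
  w2-zero = ⊛-zeroʳ u (joins-zeroʳ w)

  w3-zero : ∀ l n → w3 l 0 n ≡ 0ℤ
  w3-zero l = ⊛-zeroʳ u (λ n → cong₂ _+_
    (⊛-zeroʳ x (λ n → cong₂ _+_ (⊛-zeroˡ (w2 l) w2-zero n) (⊛-zeroʳ (w2 l) w2-zero n)) n)
    (cong₂ _+_ (joins-zeroˡ l w2-zero n) (joins-zeroʳ (w2 l) n)))

  w11-zero : ∀ n → w11 0 n ≡ 0ℤ
  w11-zero = ⊛-zeroʳ u (λ n → cong₂ _+_ (cong₂ _+_
    (⊛-zeroʳ x (λ n → trans (∑-cong (splits (suc n)) (λ (m , l) → w3-zero l m)) (∑-zero (splits (suc n)))) n)
    (⊛-zeroʳ x (λ n → cong₂ _+_ (⊛-zeroˡ w1 w2-zero n) (⊛-zeroʳ w1 w2-zero n)) n))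
    (joins-zeroʳ w1 n))

  ∑-splits-applyUpTo : ∀ p (h : ℕ → ℕ) (g : ℕ → ℤ) → ∑ (splits p) (λ (i , j) → g (h i)) ≡ ∑ (applyUpTo h p) g
  ∑-splits-applyUpTo zero    h g = ∑-splits-zero _
  ∑-splits-applyUpTo (suc p) h g = trans (∑-splits-suc p _) (cong (_+_ (g (h 0))) (∑-splits-applyUpTo p (h ∘ suc) g))

  -- `diag` also contains the two terms with a face of size 0; both vanish, and the compositions
  -- into positive parts remain.
  diag-interior : ∀ n → diag w11 (suc n) ≡ ∑ (splits n) (λ (a , b) → w11 (suc b) (suc a))
  diag-interior n = trans (∑-splits-suc (suc n) _) (trans (cong₂ _+_ (w11-0 (suc n)) (∑-splits-last n _))
    (trans (ℤₚ.+-identityˡ _) (trans (cong (_+_ (∑ (splits n) (λ (a , b) → w11 (suc b) (suc a)))) (w11-zero (suc n))) (ℤₚ.+-identityʳ _))))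

  +-sum : ∀ {A : Set} (g : A → ℕ) xs → + sum (map g xs) ≡ ∑ xs (λ x → + g x)
  +-sum g []       = refl
  +-sum g (x ∷ xs) = cong (_+_ (+ g x)) (+-sum g xs)

  ε-diag : ∀ N → 1 ≤ N → + ε₁-2 N ≡ diag w11 (N ℕ.+ N)
  ε-diag (suc N) 1≤N = begin
    + ε₁-2 (suc N)
      ≡⟨ +-sum data-count (map suc (upTo k)) ⟩
    ∑ (map suc (upTo k)) (λ m → + data-count m)
      ≡⟨ ∑-map suc (upTo k) _ ⟩
    ∑ (upTo k) (λ a → + data-count (suc a))
      ≡⟨ sym (∑-splits-applyUpTo k (λ i → i) (λ a → + data-count (suc a))) ⟩
    ∑ (splits k) (λ (a , b) → + data-count (suc a))
      ≡⟨ ∑-splits-cong k (λ a b e → genus1-count (suc N) a b 1≤N (cong suc (trans (ℕₚ.+-suc a b) e))) ⟩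
    ∑ (splits k) (λ (a , b) → w11 (suc b) (suc a))
      ≡⟨ sym (diag-interior k) ⟩
    diag w11 (suc k)
      ≡⟨ cong (λ t → diag w11 (suc N ℕ.+ t)) (ℕₚ.+-identityʳ (suc N)) ⟩
    diag w11 (suc N ℕ.+ suc N) ∎
    where
    open ≡-Reasoning
    k : ℕ
    k = 2 ℕ.* suc N ∸ 1
    data-count : ℕ → ℕ
    data-count m = length (filterᵇ (isGenus1Datum (suc N) m) (allVecs (2 ℕ.* suc N) (2 ℕ.* suc N)))

  -- Truncation could matter only for N = 1, where the factor N - 1 is 0 anyway.
  monus-product : ∀ N → 1 ≤ N → + N * (+ N + - + 1) * (+ N + - + 2) * (+ 13 * + N + + 3) ≡ + (N ℕ.* (N ∸ 1) ℕ.* (N ∸ 2) ℕ.* (13 ℕ.* N ℕ.+ 3))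
  monus-product (suc zero)    _ = refl
  monus-product (suc (suc N)) _ = pos-product (suc (suc N)) (suc N) N (suc (suc N))
    where
    pos-product : ∀ a b c d → + a * + b * + c * (+ 13 * + d + + 3) ≡ + (a ℕ.* b ℕ.* c ℕ.* (13 ℕ.* d ℕ.+ 3))
    pos-product a b c d = sym (trans (ℤₚ.pos-* (a ℕ.* b ℕ.* c) (13 ℕ.* d ℕ.+ 3)) (cong₂ _*_
      (trans (ℤₚ.pos-* (a ℕ.* b) c) (cong (λ t → t * + c) (ℤₚ.pos-* a b)))
      (cong (λ t → t + + 3) (ℤₚ.pos-* 13 d))))

  ε-formula : ∀ N → 1 ≤ N → + 768 * + ε₁-2 N ≡ + (4 ℕ.^ N) * + (N ℕ.* (N ∸ 1) ℕ.* (N ∸ 2) ℕ.* (13 ℕ.* N ℕ.+ 3))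
  ε-formula N 1≤N = trans (cong (_*_ (+ 768)) (ε-diag N 1≤N))
    (trans (diag-w11-even N) (cong (_*_ (+ (4 ℕ.^ N))) (monus-product N 1≤N)))

open import Data.Nat using (_+_; _*_; _^_)

theorem8 : (N : ℕ) → 1 ≤ N →
    3 * 4 ^ 4 * ε₁-2 N ≡ 4 ^ N * (N * (N ∸ 1) * (N ∸ 2) * (13 * N + 3))
-- 768 = 3 · 4⁴ is the denominator of the closed formula, moved to the side of the count.
theorem8 N 1≤N = ℤₚ.+-injective (trans (ℤₚ.pos-* 768 (ε₁-2 N)) (trans (ε-formula N 1≤N)
  (sym (ℤₚ.pos-* (4 ^ N) (N * (N ∸ 1) * (N ∸ 2) * (13 * N + 3))))))
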